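{- Let $p$ be a prime and let $K$ be a finitely generated field extension of $\mathbb{F}_p$. Let $E \subseteq K^n \times K^m$ be the zero set (in $K^{n+m}$) of a set of polynomials in $K[x_1,\ldots,x_{n+m}]$. Let $d,s \in \mathbb{N}$ and suppose $E$ is $K_{d,s}$-free, i.e.\ whenever $A\times B \subseteq E$ we have $|A| < d$ or $|B| < s$. Then there exist $\epsilon > 0$ and $C > 0$ such that for all finite subsets $A \subseteq K^n$ and $B \subseteq K^m$, $$|E \cap (A \times B)| \leq C\left(|A|^{1-\epsilon}|B|^{\frac{d-1}{d}(1+\epsilon)} + |A| + |B|\right).$$ -}

module Defs where

open import Level using (Level; _⊔_; 0ℓ)
open import Axiom.ExcludedMiddle using (ExcludedMiddle)
open import Algebra.Apartness.Bundles using (HeytingField; HeytingCommutativeRing)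
open import Algebra.Bundles using (CommutativeRing; RawRing)
open import Algebra.Morphism.Structures using (module RingMorphisms)
import Algebra.Definitions.RawSemiring as RawSemiringDefinitions
open import Data.Integer.Base as ℤ using (ℤ; +_; -[1+_]; +0; 0ℤ; 1ℤ)
open import Data.Integer.Divisibility.Signed as ℤ using (divides)
import Data.Integer.Properties as ℤ
open import Data.Integer.Tactic.RingSolver using (solve-∀)
open import Data.List.Base using (List; length; filter; foldr; cartesianProduct)
open import Data.List.Relation.Unary.All using (All)
import Data.List.Relation.Unary.Unique.Setoid as UniqueSetoid
open import Data.Nat.Base as ℕ using (ℕ; suc; NonZero)
open import Data.Nat.Coprimality using (Coprime; coprime-Bézout)
import Data.Nat.Divisibility as ℕ
open import Data.Nat.GCD using (module Bézout)
open import Data.Nat.Primality using (Prime; prime⇒irreducible; prime⇒nonTrivial)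
open import Data.Product.Base using (∃-syntax; _×_; _,_; proj₁; proj₂)
open import Data.Rational.Base as ℚ using (ℚ; mkℚ; 0ℚ; 1ℚ)
open import Data.Sum.Base using (_⊎_; inj₁; inj₂)
open import Data.Vec.Functional using (Vector; _++_)
import Data.Vec.Functional.Relation.Binary.Equality.Setoid as VectorEquality
open import Relation.Binary.Bundles using (Setoid)
open import Relation.Binary.Core using (REL)
open import Relation.Binary.PropositionalEquality.Core
  using (_≡_; refl; sym; trans; cong; cong₂; subst)
open import Relation.Nullary.Decidable using (Dec; yes; no; map′; decidable-stable)
open import Relation.Nullary.Negation using (¬_; contradiction)
open import Relation.Unary using (Pred; _∈_)

private
  variable
    c ℓ ℓ# c′ ℓ′ ℓ#′ r : Level

module Mod (p : ℕ) where

  infix 4 _≈_ _#_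

  record _≈_ (x y : ℤ) : Set where
    constructor mod
    field difference : + p ℤ.∣ x ℤ.- y

  _#_ : ℤ → ℤ → Set
  x # y = ¬ x ≈ y

  ≡⇒≈ : ∀ {x y} → x ≡ y → x ≈ y
  ≡⇒≈ {x} refl = mod (divides 0ℤ (ℤ.+-inverseʳ x))

  ≈-sym : ∀ {x y} → x ≈ y → y ≈ x
  ≈-sym {x} {y} (mod (divides q eq)) = mod (divides (ℤ.- q)
    (trans (swap x y) (trans (cong ℤ.-_ eq) (ℤ.neg-distribˡ-* q (+ p)))))
    where
    swap : ∀ x y → y ℤ.- x ≡ ℤ.- (x ℤ.- y)
    swap = solve-∀

  ≈-trans : ∀ {x y z} → x ≈ y → y ≈ z → x ≈ z
  ≈-trans {x} {y} {z} (mod (divides q eq)) (mod (divides r eq′)) = mod (divides (q ℤ.+ r)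
    (trans (split x y z) (trans (cong₂ ℤ._+_ eq eq′) (sym (ℤ.*-distribʳ-+ (+ p) q r)))))
    where
    split : ∀ x y z → x ℤ.- z ≡ (x ℤ.- y) ℤ.+ (y ℤ.- z)
    split = solve-∀

  +-cong : ∀ {x y u v} → x ≈ y → u ≈ v → x ℤ.+ u ≈ y ℤ.+ v
  +-cong {x} {y} {u} {v} (mod (divides q eq)) (mod (divides r eq′)) = mod (divides (q ℤ.+ r)
    (trans (split x y u v) (trans (cong₂ ℤ._+_ eq eq′) (sym (ℤ.*-distribʳ-+ (+ p) q r)))))
    where
    split : ∀ x y u v → (x ℤ.+ u) ℤ.- (y ℤ.+ v) ≡ (x ℤ.- y) ℤ.+ (u ℤ.- v)
    split = solve-∀

  *-cong : ∀ {x y u v} → x ≈ y → u ≈ v → x ℤ.* u ≈ y ℤ.* v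
  *-cong {x} {y} {u} {v} (mod (divides q eq)) (mod (divides r eq′)) = mod (divides (q ℤ.* u ℤ.+ y ℤ.* r)
    (trans (split x y u v)
      (trans (cong₂ (λ a b → a ℤ.* u ℤ.+ y ℤ.* b) eq eq′) (collect q r (+ p) u y))))
    where
    split : ∀ x y u v → x ℤ.* u ℤ.- y ℤ.* v ≡ (x ℤ.- y) ℤ.* u ℤ.+ y ℤ.* (u ℤ.- v)
    split = solve-∀
    collect : ∀ q r k u y → (q ℤ.* k) ℤ.* u ℤ.+ y ℤ.* (r ℤ.* k) ≡ (q ℤ.* u ℤ.+ y ℤ.* r) ℤ.* k
    collect = solve-∀

  -‿cong : ∀ {x y} → x ≈ y → ℤ.- x ≈ ℤ.- y
  -‿cong {x} {y} (mod (divides q eq)) = mod (divides (ℤ.- q)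
    (trans (split x y) (trans (cong ℤ.-_ eq) (ℤ.neg-distribˡ-* q (+ p)))))
    where
    split : ∀ x y → ℤ.- x ℤ.- ℤ.- y ≡ ℤ.- (x ℤ.- y)
    split = solve-∀

  commutativeRing : CommutativeRing 0ℓ 0ℓ
  commutativeRing = record
    { Carrier = ℤ
    ; _≈_     = _≈_
    ; _+_     = ℤ._+_
    ; _*_     = ℤ._*_
    ; -_      = ℤ.-_
    ; 0#      = 0ℤ
    ; 1#      = 1ℤ
    ; isCommutativeRing = record
      { isRing = record
        { +-isAbelianGroup = record
          { isGroup = record
            { isMonoid = record
              { isSemigroup = record
                { isMagma = record
                  { isEquivalence = record
                    { refl = ≡⇒≈ refl ; sym = ≈-sym ; trans = ≈-trans }
                  ; ∙-cong = +-cong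
                  }
                ; assoc = λ x y z → ≡⇒≈ (ℤ.+-assoc x y z)
                }
              ; identity = (λ x → ≡⇒≈ (ℤ.+-identityˡ x)) , (λ x → ≡⇒≈ (ℤ.+-identityʳ x))
              }
            ; inverse = (λ x → ≡⇒≈ (ℤ.+-inverseˡ x)) , (λ x → ≡⇒≈ (ℤ.+-inverseʳ x))
            ; ⁻¹-cong = -‿cong
            }
          ; comm = λ x y → ≡⇒≈ (ℤ.+-comm x y)
          }
        ; *-cong = *-cong
        ; *-assoc = λ x y z → ≡⇒≈ (ℤ.*-assoc x y z)
        ; *-identity = (λ x → ≡⇒≈ (ℤ.*-identityˡ x)) , (λ x → ≡⇒≈ (ℤ.*-identityʳ x))
        ; distrib = (λ x y z → ≡⇒≈ (ℤ.*-distribˡ-+ x y z)) , (λ x y z → ≡⇒≈ (ℤ.*-distribʳ-+ x y z))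
        }
      ; *-comm = λ x y → ≡⇒≈ (ℤ.*-comm x y)
      }
    }

  _≈?_ : ∀ x y → Dec (x ≈ y)
  x ≈? y = map′ mod _≈_.difference (+ p ℤ.∣? (x ℤ.- y))

  module _ (p-prime : Prime p) where

    coprime : ∀ {x y} → x # y → Coprime p ℤ.∣ x ℤ.- y ∣
    coprime x#y (d∣p , d∣x-y) with prime⇒irreducible p-prime d∣p
    ... | inj₁ d≡1  = d≡1
    ... | inj₂ refl = contradiction (mod (ℤ.∣ᵤ⇒∣ d∣x-y)) x#y

    private
      lift : ∀ a b k l → 1 ℕ.+ a ℕ.* b ≡ k ℕ.* l → 1ℤ ℤ.+ + a ℤ.* + b ≡ + k ℤ.* + l
      lift a b k l eq = trans (cong (λ t → 1ℤ ℤ.+ t) (sym (ℤ.pos-* a b)))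
                          (trans (cong +_ eq) (ℤ.pos-* k l))

      invertAbs : ∀ i → Coprime p ℤ.∣ i ∣ → ∃[ j ] + ℤ.∣ i ∣ ℤ.* j ≈ 1ℤ
      invertAbs i cop with coprime-Bézout cop
      ... | Bézout.+- x y eq = ℤ.- (+ y) , mod (divides (ℤ.- (+ x))
        (trans (rearrange (+ ℤ.∣ i ∣) (+ y))
          (trans (cong ℤ.-_ (lift y ℤ.∣ i ∣ x p eq)) (ℤ.neg-distribˡ-* (+ x) (+ p)))))
        where
        rearrange : ∀ i y → i ℤ.* (ℤ.- y) ℤ.- 1ℤ ≡ ℤ.- (1ℤ ℤ.+ y ℤ.* i)
        rearrange = solve-∀
      ... | Bézout.-+ x y eq = + y , mod (divides (+ x)
        (trans (cong (ℤ._- 1ℤ) (trans (ℤ.*-comm (+ ℤ.∣ i ∣) (+ y)) (sym (lift x p y ℤ.∣ i ∣ eq))))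
          (cancel (+ x ℤ.* + p))))
        where
        cancel : ∀ t → (1ℤ ℤ.+ t) ℤ.- 1ℤ ≡ t
        cancel = solve-∀

    inverse : ∀ {x y} → x # y → ∃[ j ] (x ℤ.- y) ℤ.* j ≈ 1ℤ
    inverse {x} {y} x#y with invertAbs (x ℤ.- y) (coprime x#y) | ℤ.+∣i∣≡i⊎+∣i∣≡-i (x ℤ.- y)
    ... | j , ij≈1 | inj₁ eq = j , subst (λ t → t ℤ.* j ≈ 1ℤ) eq ij≈1
    ... | j , ij≈1 | inj₂ eq = ℤ.- j ,
      ≈-trans (≡⇒≈ (flip (x ℤ.- y) j)) (subst (λ t → t ℤ.* j ≈ 1ℤ) eq ij≈1)
      where
      flip : ∀ i j → i ℤ.* (ℤ.- j) ≡ (ℤ.- i) ℤ.* j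
      flip = solve-∀

    1#0 : 1ℤ # 0ℤ
    1#0 (mod p∣1) with ℕ.∣1⇒≡1 (ℤ.∣⇒∣ᵤ p∣1)
    1#0 (mod p∣1) | refl with prime⇒nonTrivial p-prime
    1#0 (mod p∣1) | refl | ()

    #-cotransitive : ∀ {x y} → x # y → ∀ z → x # z ⊎ z # y
    #-cotransitive {x} x#y z with x ≈? z
    ... | no  x#z = inj₁ x#z
    ... | yes x≈z = inj₂ λ z≈y → x#y (≈-trans x≈z z≈y)

    invertible⇒# : ∀ {x y j} → j ℤ.* (x ℤ.- y) ≈ 1ℤ → x # y
    invertible⇒# {j = j} j[x-y]≈1 (mod (divides q eq)) = 1#0
      (≈-trans (≈-sym j[x-y]≈1) (mod (divides (j ℤ.* q)
        (trans (ℤ.+-identityʳ _) (trans (cong (j ℤ.*_) eq) (sym (ℤ.*-assoc j q (+ p))))))))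

𝔽 : ∀ p → Prime p → HeytingField 0ℓ 0ℓ 0ℓ
𝔽 p p-prime = record
  { Carrier = ℤ
  ; _≈_     = _≈_
  ; _#_     = _#_
  ; _+_     = ℤ._+_
  ; _*_     = ℤ._*_
  ; -_      = ℤ.-_
  ; 0#      = 0ℤ
  ; 1#      = 1ℤ
  ; isHeytingField = record
    { isHeytingCommutativeRing = record
      { isCommutativeRing   = CommutativeRing.isCommutativeRing 𝔽-commutativeRing
      ; isApartnessRelation = record
        { irrefl  = λ x≈y x#y → x#y x≈y
        ; sym     = λ x#y y≈x → x#y (≈-sym y≈x)
        ; cotrans = #-cotransitive p-prime
        }
      ; #⇒invertible = λ x#y → let (j , inv) = inverse p-prime x#y in
                         j , ≈-trans (≡⇒≈ (ℤ.*-comm j _)) inv , inv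
      ; invertible⇒# = λ (j , inv , _) → invertible⇒# p-prime {j = j} inv
      }
    ; tight = λ x y → decidable-stable (x ≈? y) , λ x≈y x#y → x#y x≈y
    }
  }
  where open Mod p renaming (commutativeRing to 𝔽-commutativeRing)

-- Under excluded middle a HeytingField is a field in the usual sense: tightness
-- makes _#_ the negation of _≈_, so that exactly the nonzero elements are
-- invertible.

commutativeRing : HeytingField c ℓ ℓ# → CommutativeRing c ℓ
commutativeRing K = HeytingCommutativeRing.commutativeRing (HeytingField.heytingCommutativeRing K)

rawRing : HeytingField c ℓ ℓ# → RawRing c ℓ
rawRing K = CommutativeRing.rawRing (commutativeRing K)

record Extension (F : HeytingField c ℓ ℓ#) (K : HeytingField c′ ℓ′ ℓ#′)
                 : Set (c ⊔ ℓ ⊔ c′ ⊔ ℓ′) where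
  private
    module F = HeytingField F
    module K = HeytingField K
  open RingMorphisms (rawRing F) (rawRing K) using (IsRingHomomorphism)
  field
    ι                  : F.Carrier → K.Carrier
    isRingHomomorphism : IsRingHomomorphism ι

module _ {F : HeytingField c ℓ ℓ#} {K : HeytingField c′ ℓ′ ℓ#′} (L : Extension F K) where
  open HeytingField K
  open Extension L

  -- The smallest subfield of K containing F and all g i.
  data Adjoin {k} (g : Vector Carrier k) : Pred Carrier (c ⊔ c′ ⊔ ℓ′) where
    base : ∀ a → Adjoin g (ι a)
    gen  : ∀ i → Adjoin g (g i)
    add  : ∀ {x y} → Adjoin g x → Adjoin g y → Adjoin g (x + y)
    neg  : ∀ {x} → Adjoin g x → Adjoin g (- x)
    mul  : ∀ {x y} → Adjoin g x → Adjoin g y → Adjoin g (x * y)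
    inv  : ∀ {x y} → x * y ≈ 1# → Adjoin g x → Adjoin g y
    resp : ∀ {x y} → x ≈ y → Adjoin g x → Adjoin g y

  FinitelyGenerated : Set (c ⊔ c′ ⊔ ℓ′)
  FinitelyGenerated = ∃[ k ] ∃[ g ] (∀ x → Adjoin {k} g x)

module _ (K : HeytingField c ℓ ℓ#) where
  open HeytingField K
  open RawSemiringDefinitions (RawRing.rawSemiring (rawRing K)) using (_^_; product)

  𝔸 : ℕ → Setoid c ℓ
  𝔸 = VectorEquality.≋-setoid (CommutativeRing.setoid (commutativeRing K))

  Point : ℕ → Set c
  Point = Vector Carrier

  -- A polynomial is presented as a list of terms, each a coefficient with a
  -- vector of exponents.  Presentations are not unique: exponent vectors may
  -- repeat and coefficients may vanish.
  Polynomial : ℕ → Set c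
  Polynomial N = List (Carrier × Vector ℕ N)

  eval : ∀ {N} → Polynomial N → Point N → Carrier
  eval f v = foldr (λ (a , e) t → a * product (λ i → v i ^ e i) + t) 0# f

  ZeroSet : ∀ {n m} → Pred (Polynomial (n ℕ.+ m)) r → REL (Point n) (Point m) (c ⊔ ℓ ⊔ r)
  ZeroSet S x y = ∀ f → f ∈ S → eval f (x ++ y) ≈ 0#

module _ (X : Setoid c ℓ) where
  open Setoid X using (Carrier)
  open UniqueSetoid X using (Unique)

  -- |P| < k; this fails for all k when P is infinite.
  Fewer : Pred Carrier r → ℕ → Set (c ⊔ ℓ ⊔ r)
  Fewer P k = ∀ xs → Unique xs → All P xs → length xs ℕ.< k

  record FiniteSubset : Set (c ⊔ ℓ) where
    field
      elements : List Carrier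
      unique   : Unique elements

∣_∣ : {X : Setoid c ℓ} → FiniteSubset X → ℕ
∣ A ∣ = length (FiniteSubset.elements A)

module _ {X : Setoid c ℓ} {Y : Setoid c′ ℓ′} where
  private
    module X = Setoid X
    module Y = Setoid Y

  KFree : REL X.Carrier Y.Carrier r → ℕ → ℕ → Set _
  KFree E d s = (A : Pred X.Carrier (c ⊔ ℓ)) (B : Pred Y.Carrier (c′ ⊔ ℓ′)) →
    (∀ {x y} → x ∈ A → y ∈ B → E x y) → Fewer X A d ⊎ Fewer Y B s

  -- Excluded middle is only used to decide membership in E.
  ∣_∩_×_∣[_] : REL X.Carrier Y.Carrier r → FiniteSubset X → FiniteSubset Y →
               ExcludedMiddle r → ℕ
  ∣ E ∩ A × B ∣[ em ] = length (filter (λ (x , y) → em {E x y})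
    (cartesianProduct (FiniteSubset.elements A) (FiniteSubset.elements B)))

open RawSemiringDefinitions ℚ.+-*-rawSemiring using () renaming (_^_ to _^ℚ_)

infix 10 _/1

_/1 : ℕ → ℚ
n /1 = + n ℚ./ 1

-- The real number a ^ r, for rational r = u / v, is given by its rational upper
-- bounds q: those with q ≥ 0 and a ^ u ≤ q ^ v.  For u < 0 the power of a is
-- moved to the other side, so that a negative power of 0 is infinite.  As
-- a ^ r is the infimum of its upper bounds, an upper estimate by a monotone
-- continuous expression in a ^ r and b ^ t holds exactly when it holds with
-- all upper bounds x of a ^ r and y of b ^ t in their place.
infix 4 _^_≤_

_^_≤_ : ℕ → ℚ → ℚ → Set
a ^ mkℚ (+ u)    v-1 _ ≤ q = 0ℚ ℚ.≤ q × (a ℕ.^ u) /1 ℚ.≤ q ^ℚ suc v-1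
a ^ mkℚ -[1+ u ] v-1 _ ≤ q = 0ℚ ℚ.≤ q × 1ℚ ℚ.≤ q ^ℚ suc v-1 ℚ.* (a ℕ.^ suc u) /1

{-# OPTIONS --safe #-}
{- Call a relation E ⊆ X × Y regular if all finite A ⊆ X and B ⊆ Y contain subsets of
   proportional size whose product is contained in E or disjoint from E.

   Zero sets over K are regular.  By Hilbert's basis theorem finitely many polynomials suffice,
   and a polynomial f (x , y) is a dot product u (x) · v (y), so it is enough that orthogonality
   of vectors over K is regular.  This holds over the prime field by the pigeonhole principle
   and passes from a field F to the fractions of F [ t ].  If t is algebraic, compare
   coordinates.  If t is transcendental, change the lattice F [ t ]ⁿ: as long as nearly all of
   the vectors in A lie modulo t in one hyperplane h, replace the lattice by the preimage of h,
   dually the functionals by those proportional to h modulo t.  If this stops, the residues of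
   A avoid every hyperplane in proportion, and regularity over F yields a large rectangle of
   pairs that are not orthogonal even modulo t.  If it does not stop, a dimension count produces
   a functional of small degree whose values on half of A are divisible by a larger power of t,
   hence vanish, and the dimension drops.

   If E is regular and K_{d,s}-free, then split A × B into A₁ × B₁, which E meets trivially,
   A₁ × (B ∖ B₁) and (A ∖ A₁) × B.  Iterating L times and applying the Kővári–Sós–Turán bound to
   all pieces gives |E ∩ (A × B)| ≪ λ^L |A| |B|^((d-1)/d) + 2^L |B| + |A| with λ < 1, and L is
   chosen with 4^L ≈ |A| / |B|^((d-1)/d). -}
module Submission where

open import Algebra.Apartness.Bundles using (HeytingField)
open import Algebra.Bundles using (CommutativeRing; Monoid; RawRing)
open import Axiom.ExcludedMiddle using (ExcludedMiddle)
open import Data.Nat.Primality using (Prime)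
open import Data.Product.Base using (∃-syntax; _×_; _,_; proj₁; proj₂)
open import Data.Sum.Base using (_⊎_; inj₁; inj₂)
open import Function.Base using (_∘_; id; const)
open import Function.Bundles using (_⇔_; mk⇔; Equivalence)
open import Level using (Level; _⊔_)
open import Relation.Binary.Core using (REL)
open import Relation.Nullary.Decidable using (yes; no; T?; decidable-stable)
open import Relation.Nullary.Negation using (¬_; contradiction)
open import Relation.Unary using (Pred)

-- The constants of regularity must not depend on degrees: the points of A are arbitrary, so the
-- polynomials representing them over F [ t ] have unbounded degree, and losing a proportion of A at
-- every power of t would be fatal. Hence a change of lattice discards no point. A vector that
-- misses the hyperplane of one step merely fails to gain a factor t there, and e counts these
-- failures. Concentration with threshold 4 (n + 1) keeps the average of e small against the number
-- of steps. That number may grow with the degree; the threshold does not.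
--
-- In the counting part, λ^M ≤ 1/4 determines ε = 1 / M: then λ^L is at most about (|B|^((d-1)/d) /
-- |A|)^(1/M), which turns λ^L |A| |B|^((d-1)/d) into |A|^(1-ε) |B|^((d-1)/d (1+ε)). The loss 2^L
-- |B| is affordable because 2^L is only the square root of 4^L and (d-1)/d ≥ 1/2; so d = 1 is
-- treated apart. Real powers are replaced by inequalities between natural numbers, with a fraction
-- w / v in the role of |B|^((d-1)/d).

module Regularity where

  open import Data.Bool.Base using (Bool; true; false; T; not; _∧_)
  open import Data.Bool.Properties using (T-∧)
  open import Data.List.Base using (List; []; _∷_; length; filterᵇ)
  open import Data.List.Properties using (length-filter)
  open import Data.List.Relation.Unary.All as All using (All; []; _∷_)
  open import Data.List.Relation.Unary.All.Properties using (all-filter; filter⁺)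
  open import Data.Nat.Base hiding (_⊔_)
  open import Data.Nat.Properties
  open import Data.Nat.Tactic.RingSolver using (solve-∀)
  open import Data.Unit.Base using (tt)
  open import Relation.Binary.PropositionalEquality using (_≡_; refl; sym; trans; cong; cong₂; subst)
  open import Relation.Nullary.Decidable using (⌊_⌋; toWitness; fromWitness)

  private variable
    i j r r′ : Level
    X : Set i
    Y : Set j

  -- Bernoulli's inequality (1 + 1 / A)^m ≥ 1 + m / A, cleared of fractions; m = A * k makes the
  -- right-hand side 1 + k.
  bernoulli-gap : ∀ a k → ∃[ n ] k * a ^ n < suc a ^ n
  bernoulli-gap zero    k = 1 , subst (_< 1) (sym (*-zeroʳ k)) (s≤s z≤n)
  bernoulli-gap (suc a) k = n , *-cancelˡ-< A _ _ (begin-strict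
      A * (k * A ^ n)  <⟨ m<n+m _ (m^n>0 A (suc n)) ⟩
      A * A ^ n + A * (k * A ^ n) ≡⟨ regroup A k (A ^ n) ⟩
      (A + A * k) * A ^ n      ≤⟨ bernoulli n ⟩
      A * suc A ^ n            ∎)
    where
    open ≤-Reasoning
    A = suc a
    n = A * k
    regroup : ∀ x y z → x * z + x * (y * z) ≡ (x + x * y) * z
    regroup = solve-∀
    expand : ∀ x y z → (x + suc y) * (x * z) + y * z ≡ suc x * ((x + y) * z)
    expand = solve-∀
    swap : ∀ x y z → x * (y * z) ≡ y * (x * z)
    swap = solve-∀
    bernoulli : ∀ m → (A + m) * A ^ m ≤ A * suc A ^ m
    bernoulli zero    = ≤-reflexive (cong (_* 1) (+-identityʳ A))
    bernoulli (suc m) = begin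
      (A + suc m) * (A * A ^ m)  ≤⟨ m≤m+n _ (m * A ^ m) ⟩
      (A + suc m) * (A * A ^ m) + m * A ^ m ≡⟨ expand A m (A ^ m) ⟩
      suc A * ((A + m) * A ^ m)  ≤⟨ *-monoʳ-≤ (suc A) (bernoulli m) ⟩
      suc A * (A * suc A ^ m)  ≡⟨ swap (suc A) A (suc A ^ m) ⟩
      A * (suc A * suc A ^ m)               ∎

  abstract
    power-gap : ∀ a k → ∃[ n ] k * a ^ n < suc a ^ n
    power-gap = bernoulli-gap

  count : (X → Bool) → List X → ℕ
  count p xs = length (filterᵇ p xs)

  count-complement : ∀ (p : X → Bool) xs → count p xs + count (not ∘ p) xs ≡ length xs
  count-complement p []       = refl
  count-complement p (x ∷ xs) with p x
  ... | true  = cong suc (count-complement p xs)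
  ... | false = trans (+-suc _ _) (cong suc (count-complement p xs))

  count-filter : ∀ (p q : X → Bool) xs → count q (filterᵇ p xs) ≡ count (λ x → p x ∧ q x) xs
  count-filter p q []       = refl
  count-filter p q (x ∷ xs) with p x
  ... | false = count-filter p q xs
  ... | true  with q x
  ...   | true  = cong suc (count-filter p q xs)
  ...   | false = count-filter p q xs

  count-mono : ∀ {p q : X → Bool} {xs} → All (λ x → T (p x) → T (q x)) xs → count p xs ≤ count q xs
  count-mono [] = z≤n
  count-mono {p = p} {q} {x ∷ xs} (p⇒q ∷ ps) with p x | q x
  ... | true  | true  = s≤s (count-mono ps)
  ... | true  | false = contradiction (p⇒q tt) (λ ())
  ... | false | true  = m≤n⇒m≤1+n (count-mono ps)
  ... | false | false = count-mono ps

  count-true : ∀ {p : X → Bool} {xs} → All (T ∘ p) xs → count p xs ≡ length xs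
  count-true [] = refl
  count-true {p = p} {x ∷ xs} (px ∷ pxs) with p x
  ... | true = cong suc (count-true pxs)

  count-everything : ∀ c (xs : List X) → length xs ≤ suc c * count (const true) xs
  count-everything c xs = ≤-trans (≤-reflexive (sym (count-true {p = const true} (All.universal (const tt) xs))))
                                  (m≤n*m _ (suc c))

  T-not : ∀ {b} → T (not b) → ¬ T b
  T-not {false} _ ()

  ¬T⇒T-not : ∀ {b} → ¬ T b → T (not b)
  ¬T⇒T-not {false} _  = tt
  ¬T⇒T-not {true}  ¬t = ¬t tt

  half-complement : ∀ (p : X → Bool) xs → 2 * count (not ∘ p) xs ≤ length xs → length xs ≤ 2 * count p xs
  half-complement p xs le = +-cancelʳ-≤ (2 * n′) _ _ (begin
      length xs + 2 * n′  ≤⟨ +-monoʳ-≤ (length xs) le ⟩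
      length xs + length xs     ≡⟨ cong₂ _+_ eq eq ⟨
      (n + n′) + (n + n′)  ≡⟨ double n n′ ⟩
      2 * n + 2 * n′            ∎)
    where
    open ≤-Reasoning
    n  = count p xs
    n′ = count (not ∘ p) xs
    eq = count-complement p xs
    double : ∀ a b → (a + b) + (a + b) ≡ 2 * a + 2 * b
    double = solve-∀

  complement-shrinks : ∀ c (p : X → Bool) xs → length xs ≤ suc c * count p xs →
                       suc c * count (not ∘ p) xs ≤ c * length xs
  complement-shrinks c p xs large = +-cancelˡ-≤ (length xs) _ _ (begin
    length xs + suc c * n′  ≤⟨ +-monoˡ-≤ _ large ⟩
    suc c * count p xs + suc c * n′ ≡⟨ *-distribˡ-+ (suc c) (count p xs) n′ ⟨
    suc c * (count p xs + n′)      ≡⟨ cong (suc c *_) (count-complement p xs) ⟩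
    suc c * length xs              ∎)
    where
    open ≤-Reasoning
    n′ = count (not ∘ p) xs

  half-majority : ∀ (p : X → Bool) xs → length xs ≤ 2 * count p xs ⊎ length xs ≤ 2 * count (not ∘ p) xs
  half-majority p xs with ≤-total (2 * count (not ∘ p) xs) (length xs)
  ... | inj₁ le = inj₁ (half-complement p xs le)
  ... | inj₂ le = inj₂ le

  total : (X → ℕ) → List X → ℕ
  total f []       = 0
  total f (x ∷ xs) = f x + total f xs

  indicator : Bool → ℕ
  indicator true  = 1
  indicator false = 0

  total-zero : ∀ (xs : List X) → total (const 0) xs ≡ 0
  total-zero []       = refl
  total-zero (x ∷ xs) = total-zero xs

  total-count : ∀ p (f : X → ℕ) xs → total (λ x → indicator (p x) + f x) xs ≡ count p xs + total f xs
  total-count p f []       = refl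
  total-count p f (x ∷ xs) with p x
  ... | true  = cong suc (trans (cong (f x +_) (total-count p f xs)) (swap (f x) (count p xs) (total f xs)))
    where
    swap : ∀ a b d → a + (b + d) ≡ b + (a + d)
    swap = solve-∀
  ... | false = trans (cong (f x +_) (total-count p f xs)) (swap (f x) (count p xs) (total f xs))
    where
    swap : ∀ a b d → a + (b + d) ≡ b + (a + d)
    swap = solve-∀

  markov : ∀ d {p : X → Bool} {f : X → ℕ} {xs} → All (λ x → T (p x) → d ≤ f x) xs → d * count p xs ≤ total f xs
  markov d [] = ≤-reflexive (*-zeroʳ d)
  markov d {p} {xs = x ∷ xs} (d≤ ∷ ds) with p x
  ... | true  = ≤-trans (≤-reflexive (*-suc d (count p xs))) (+-mono-≤ (d≤ tt) (markov d ds))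
  ... | false = m≤n⇒m≤o+n _ (markov d ds)

  -- Homogeneous rectangles and regular relations

  Homogeneous : REL X Y r → (X → Bool) → (Y → Bool) → Set _
  Homogeneous E p q = (∀ {x y} → T (p x) → T (q y) → E x y) ⊎ (∀ {x y} → T (p x) → T (q y) → ¬ E x y)

  record HomogeneousRectangle {X : Set i} {Y : Set j} (c : ℕ) (E : REL X Y r) (xs : List X) (ys : List Y)
                              : Set (i ⊔ j ⊔ r) where
    constructor rectangle
    field
      left        : X → Bool
      right       : Y → Bool
      left-large  : length xs ≤ c * count left xs
      right-large : length ys ≤ c * count right ys
      homogeneous : Homogeneous E left right

  -- The strong Erdős–Hajnal property.
  Regular : ℕ → REL X Y r → Set _
  Regular c E = ∀ xs ys → HomogeneousRectangle c E xs ys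

  rectangle-weaken : ∀ {E : REL X Y r} {c c′ xs ys} → c ≤ c′ →
                     HomogeneousRectangle c E xs ys → HomogeneousRectangle c′ E xs ys
  rectangle-weaken c≤c′ (rectangle p q lx ly hom) =
    rectangle p q (≤-trans lx (*-monoˡ-≤ _ c≤c′)) (≤-trans ly (*-monoˡ-≤ _ c≤c′)) hom

  rectangle-resp : ∀ {E : REL X Y r} {E′ : REL X Y r′} {c xs ys} → (∀ {x y} → E x y ⇔ E′ x y) →
                   HomogeneousRectangle c E xs ys → HomogeneousRectangle c E′ xs ys
  rectangle-resp E⇔E′ (rectangle p q lx ly (inj₁ full))  =
    rectangle p q lx ly (inj₁ λ px qy → Equivalence.to E⇔E′ (full px qy))
  rectangle-resp E⇔E′ (rectangle p q lx ly (inj₂ empty)) =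
    rectangle p q lx ly (inj₂ λ px qy → empty px qy ∘ Equivalence.from E⇔E′)

  regular-resp : ∀ {E : REL X Y r} {E′ : REL X Y r′} {c} → (∀ {x y} → E x y ⇔ E′ x y) →
                 Regular c E → Regular c E′
  regular-resp E⇔E′ reg xs ys = rectangle-resp E⇔E′ (reg xs ys)

  refine-count : ∀ c c′ (p p′ : X → Bool) xs → length xs ≤ c * count p xs →
                 count p xs ≤ c′ * count p′ (filterᵇ p xs) →
                 length xs ≤ c * c′ * count (λ x → p x ∧ p′ x) xs
  refine-count c c′ p p′ xs le le′ = begin
    length xs  ≤⟨ le ⟩
    c * count p xs  ≤⟨ *-monoʳ-≤ c le′ ⟩
    c * (c′ * count p′ (filterᵇ p xs))  ≡⟨ *-assoc c c′ _ ⟨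
    c * c′ * count p′ (filterᵇ p xs)  ≡⟨ cong (c * c′ *_) (count-filter p p′ xs) ⟩
    c * c′ * count (λ x → p x ∧ p′ x) xs     ∎
    where open ≤-Reasoning

  -- Serves to replace a relation by one that agrees with it on p × q alone; the losses of the two
  -- passages multiply.
  rectangle-refine : ∀ {E : REL X Y r} {E′ : REL X Y r′} {c c′ xs ys} (p : X → Bool) (q : Y → Bool) →
                     length xs ≤ c * count p xs → length ys ≤ c * count q ys →
                     (∀ {x y} → T (p x) → T (q y) → E x y ⇔ E′ x y) →
                     HomogeneousRectangle c′ E (filterᵇ p xs) (filterᵇ q ys) →
                     HomogeneousRectangle (c * c′) E′ xs ys
  rectangle-refine {E = E} {E′} {c} {c′} {xs} {ys} p q lx ly E⇔E′ (rectangle p′ q′ lx′ ly′ hom) =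
    rectangle (λ x → p x ∧ p′ x) (λ y → q y ∧ q′ y)
    (refine-count c c′ p p′ xs lx lx′) (refine-count c c′ q q′ ys ly ly′) (homogeneous hom)
    where
    split : ∀ {a b} → T (a ∧ b) → T a × T b
    split = Equivalence.to T-∧
    homogeneous : Homogeneous E p′ q′ → Homogeneous E′ _ _
    homogeneous (inj₁ full) = inj₁ λ px qy → let (px , p′x) = split px ; (qy , q′y) = split qy in
      Equivalence.to (E⇔E′ px qy) (full p′x q′y)
    homogeneous (inj₂ empty) = inj₂ λ px qy → let (px , p′x) = split px ; (qy , q′y) = split qy in
      empty p′x q′y ∘ Equivalence.from (E⇔E′ px qy)

  regular-∩ : ∀ {E : REL X Y r} {E′ : REL X Y r′} {c c′} → Regular c E → Regular c′ E′ →
              Regular (c * c′) (λ x y → E x y × E′ x y)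
  regular-∩ {E = E} {E′} {c} {c′} reg reg′ xs ys with reg xs ys
  ... | rectangle p q lx ly (inj₁ full) = rectangle-refine {c = c} p q lx ly
    (λ px qy → mk⇔ (full px qy ,_) proj₂) (reg′ _ _)
  -- Already p × q is empty. The second rectangle only supplies sizes for the constant c * c′, which
  -- need not exceed c, as c′ may be 0.
  ... | rectangle p q lx ly (inj₂ empty) with reg′ (filterᵇ p xs) (filterᵇ q ys)
  ...   | rectangle p′ q′ lx′ ly′ _ = rectangle _ _ (refine-count c c′ p p′ xs lx lx′) (refine-count c c′ q q′ ys ly ly′)
    (inj₂ λ px qy (e , _) → empty (proj₁ (Equivalence.to T-∧ px)) (proj₁ (Equivalence.to T-∧ qy)) e)

  regular-true : ∀ {E : REL X Y r} → (∀ {x y} → E x y) → Regular 1 E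
  regular-true all xs ys =
    rectangle (const true) (const true) (count-everything 0 xs) (count-everything 0 ys) (inj₁ λ _ _ → all)

  module Classical (em : ∀ {a} → ExcludedMiddle a) where

    decide : Set r → Bool
    decide P = ⌊ em {_} {P} ⌋

    decided : ∀ {P : Set r} → T (decide P) → P
    decided = toWitness

    decide-true : ∀ {P : Set r} → P → T (decide P)
    decide-true = fromWitness

    decide-false : ∀ {P : Set r} → ¬ P → T (not (decide P))
    decide-false ¬p = ¬T⇒T-not (¬p ∘ decided)

    undecided : ∀ {P : Set r} → T (not (decide P)) → ¬ P
    undecided t p = T-not t (decide-true p)

    non-edges : REL X Y r → Y → X → Bool
    non-edges E y x = not (decide (E x y))

    EmptyRectangle : ℕ → REL X Y r → List X → List Y → Set _
    EmptyRectangle c E xs ys = ∃[ p ] ∃[ q ]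
      length xs ≤ c * count p xs × length ys ≤ c * count q ys × (∀ {x y} → T (p x) → T (q y) → ¬ E x y)

    -- As long as regularity returns full rectangles p × q, pass to (xs ∖ p) × (ys ∩ q): this loses
    -- no non-edge, while xs shrinks geometrically.
    empty-rectangle-iterate : ∀ {E : REL X Y r} {c} → Regular (suc c) E → ∀ n k m xs ys →
      All (λ y → m ≤ k * count (non-edges E y) xs) ys → 0 < length ys → k * length xs * c ^ n < m * suc c ^ n →
      ∃[ p ] ∃[ q ] m ≤ k * suc c * count p xs × length ys ≤ suc c ^ n * count q ys ×
        (∀ {x y} → T (p x) → T (q y) → ¬ E x y)
    -- For n = 0 the last hypothesis says that k * length xs is less than m: so few xs cannot hold
    -- the non-edges that have survived at y.
    empty-rectangle-iterate {c = c} reg zero k m xs (y ∷ ys) (m≤ ∷ _) _ lt =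
      contradiction lt (≤⇒≯ (*-monoˡ-≤ 1 (≤-trans m≤ (*-monoʳ-≤ k (length-filter _ xs)))))
    empty-rectangle-iterate {E = E} {c} reg (suc n) k m xs ys dense pos lt with reg xs ys
    ... | rectangle p q lx ly (inj₂ empty) = p , q ,
      ≤-trans (m≤length pos dense) (≤-trans (*-monoʳ-≤ k lx) (≤-reflexive (sym (*-assoc k (suc c) _)))) ,
      ≤-trans ly bound , empty
      where
      m≤length : ∀ {ys} → 0 < length ys → All (λ y → m ≤ k * count (non-edges E y) xs) ys → m ≤ k * length xs
      m≤length _ (m≤ ∷ _) = ≤-trans m≤ (*-monoʳ-≤ k (length-filter _ xs))
      bound : suc c * count q ys ≤ suc c ^ suc n * count q ys
      bound = *-monoˡ-≤ (count q ys) (m≤m*n (suc c) (suc c ^ n) ⦃ m^n≢0 (suc c) n ⦄)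
    ... | rectangle p q lx ly (inj₁ full) =
      let (p′ , q′ , lx′ , ly′ , empty) = empty-rectangle-iterate {E = E} reg n k m (filterᵇ (not ∘ p) xs) (filterᵇ q ys)
                                            dense′ (count-positive pos ly) lt′
      in (λ x → not (p x) ∧ p′ x) , (λ y → q y ∧ q′ y) ,
         subst (λ l → m ≤ k * suc c * l) (count-filter (not ∘ p) p′ xs) lx′ ,
         refine-count (suc c) (suc c ^ n) q q′ ys ly ly′ ,
         λ px qy → empty (proj₂ (Equivalence.to T-∧ px)) (proj₂ (Equivalence.to T-∧ qy))
      where
      count-positive : ∀ {a b} → 0 < a → a ≤ suc c * b → 0 < b
      count-positive {b = zero}  0<a a≤ = contradiction (≤-trans 0<a a≤) (subst (λ z → ¬ 0 < z) (sym (*-zeroʳ (suc c))) λ ())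
      count-positive {b = suc b} 0<a a≤ = s≤s z≤n
      dense′ : All (λ y → m ≤ k * count (non-edges E y) (filterᵇ (not ∘ p) xs)) (filterᵇ q ys)
      dense′ = All.map (λ {y} (qy , m≤) → ≤-trans m≤ (*-monoʳ-≤ k (≤-trans
          (count-mono (All.universal (λ x ¬e → Equivalence.from T-∧
            (¬T⇒T-not (λ px → undecided ¬e (full px qy)) , ¬e)) xs))
          (≤-reflexive (sym (count-filter (not ∘ p) (non-edges E y) xs))))))
        (All.zip (all-filter (T? ∘ q) ys , filter⁺ (T? ∘ q) dense))
      lt′ : k * count (not ∘ p) xs * c ^ n < m * suc c ^ n
      lt′ = *-cancelˡ-< (suc c) _ _ (begin-strict
          suc c * (k * x′ * c ^ n)      ≡⟨ push (suc c) k x′ (c ^ n) ⟩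
          k * (suc c * x′) * c ^ n      ≤⟨ *-monoˡ-≤ (c ^ n) (*-monoʳ-≤ k (complement-shrinks c p xs lx)) ⟩
          k * (c * length xs) * c ^ n   ≡⟨ rotate k c (length xs) (c ^ n) ⟩
          k * length xs * (c * c ^ n)   <⟨ lt ⟩
          m * (suc c * suc c ^ n)  ≡⟨ swap m (suc c) (suc c ^ n) ⟩
          suc c * (m * suc c ^ n)       ∎)
        where
        open ≤-Reasoning
        x′ = count (not ∘ p) xs
        push : ∀ a k x b → a * (k * x * b) ≡ k * (a * x) * b
        push = solve-∀
        rotate : ∀ k a b d → k * (a * b) * d ≡ k * b * (a * d)
        rotate = solve-∀
        swap : ∀ a b k → a * (b * k) ≡ b * (a * k)
        swap = solve-∀

    -- The number n of rounds satisfies k * c ^ n < suc c ^ n: after n full rectangles xs would be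
    -- smaller than the proportion 1 / k of non-edges that every y still has in it. Hence an empty
    -- rectangle turns up earlier, and c′ depends only on c and k.
    empty-rectangle : ∀ c k → ∃[ c′ ] (∀ {E : REL X Y r} → Regular c E → ∀ xs ys →
      All (λ y → length xs ≤ k * count (non-edges E y) xs) ys → EmptyRectangle c′ E xs ys)
    empty-rectangle {X = X} {Y = Y} {r = r} c k = c′ , empty-rectangles
      where
      gaps = power-gap c k
      n = proj₁ gaps
      c′ = suc (k * suc c + suc c ^ n)
      x≤c′ : k * suc c ≤ c′
      x≤c′ = m≤n⇒m≤1+n (m≤m+n _ _)
      y≤c′ : suc c ^ n ≤ c′
      y≤c′ = m≤n⇒m≤1+n (m≤n+m _ _)
      empty-rectangles : ∀ {E : REL X Y r} → Regular c E → ∀ xs ys →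
        All (λ y → length xs ≤ k * count (non-edges E y) xs) ys → EmptyRectangle c′ E xs ys
      empty-rectangles reg xs []         _ = const true , const false , count-everything (k * suc c + suc c ^ n) xs , z≤n , λ _ ()
      empty-rectangles reg [] ys@(_ ∷ _) _ = const false , const true , z≤n , count-everything (k * suc c + suc c ^ n) ys , λ ()
      empty-rectangles {E = E} reg xs@(_ ∷ xs′) ys@(_ ∷ _) dense =
        let (p , q , lx , ly , empty) = empty-rectangle-iterate {E = E} reg′ n k (length xs) xs ys dense (s≤s z≤n) gap
        in p , q , ≤-trans lx (*-monoˡ-≤ _ x≤c′) , ≤-trans ly (*-monoˡ-≤ _ y≤c′) , empty
        where
        reg′ : Regular (suc c) E
        reg′ xs ys = rectangle-weaken (n≤1+n c) (reg xs ys)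
        reorder : ∀ a b d → b * (a * d) ≡ a * b * d
        reorder = solve-∀
        gap : k * length xs * c ^ n < length xs * suc c ^ n
        gap = subst (_< length xs * suc c ^ n) (reorder k (length xs) (c ^ n))
                (*-monoʳ-< (length xs) (proj₂ gaps))

-- A ring solver with integer coefficients for arbitrary commutative rings

module IntegerSolver {c ℓ : Level} (R : CommutativeRing c ℓ) where

  open import Algebra.Solver.Ring.AlmostCommutativeRing using (fromCommutativeRing; _-Raw-AlmostCommutative⟶_)
  open import Data.Maybe.Base using (Maybe; just; nothing)
  open import Data.Nat.Base as ℕ using (ℕ; suc)
  import Data.Nat.Properties as ℕ
  open import Relation.Binary.PropositionalEquality.Core as ≡ using (_≡_)
  open CommutativeRing R
  open import Algebra.Properties.Ring ring
  open import Algebra.Properties.AbelianGroup +-abelianGroup using (⁻¹-∙-comm)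
  open import Algebra.Properties.CommutativeSemigroup +-commutativeSemigroup using (interchange)
  open import Algebra.Properties.Semiring.Mult semiring using (×-homo-+; ×1-homo-*) renaming (_×_ to _·_)
  open import Relation.Binary.Reasoning.Setoid setoid

  private
    -- (m , n) stands for the integer m − n, so that no sign has to be decided.
    Differences : RawRing _ _
    Differences = record
      { Carrier = ℕ × ℕ
      ; _≈_ = _≡_
      ; _+_ = λ (m , n) (m′ , n′) → m ℕ.+ m′ , n ℕ.+ n′
      ; _*_ = λ (m , n) (m′ , n′) → m ℕ.* m′ ℕ.+ n ℕ.* n′ , m ℕ.* n′ ℕ.+ n ℕ.* m′
      ; -_  = λ (m , n) → n , m
      ; 0#  = 0 , 0
      ; 1#  = 1 , 0
      }
    module ℕ² = RawRing Differences

    difference : ℕ × ℕ → Carrier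
    difference (m , n) = m · 1# - n · 1#

    -- The two special cases let `con (0 , 0)` and `con (1 , 0)` denote the ring's own zero and one
    -- by definition, as the solved equations require.
    ⟦_⟧ : ℕ × ℕ → Carrier
    ⟦ 0 , 0 ⟧ = 0#
    ⟦ 1 , 0 ⟧ = 1#
    ⟦ x ⟧     = difference x

    ⟦⟧≈ : ∀ x → ⟦ x ⟧ ≈ difference x
    ⟦⟧≈ (0 , 0)             = sym (-‿inverseʳ 0#)
    ⟦⟧≈ (1 , 0)             = sym (trans (+-cong (+-identityʳ 1#) -0#≈0#) (+-identityʳ 1#))
    ⟦⟧≈ (suc (suc m) , 0)   = refl
    ⟦⟧≈ (0 , suc n)         = refl
    ⟦⟧≈ (1 , suc n)         = refl
    ⟦⟧≈ (suc (suc m) , suc n) = refl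

    +-homo : ∀ x y → difference (x ℕ².+ y) ≈ difference x + difference y
    +-homo (m , n) (m′ , n′) = begin
      (m ℕ.+ m′) · 1# - (n ℕ.+ n′) · 1#  ≈⟨ +-cong (×-homo-+ 1# m m′) (-‿cong (×-homo-+ 1# n n′)) ⟩
      (m · 1# + m′ · 1#) - (n · 1# + n′ · 1#)  ≈⟨ +-congˡ (⁻¹-∙-comm _ _) ⟨
      (m · 1# + m′ · 1#) + (- (n · 1#) - n′ · 1#)   ≈⟨ interchange _ _ _ _ ⟩
      (m · 1# - n · 1#) + (m′ · 1# - n′ · 1#)       ∎

    *-homo : ∀ x y → difference (x ℕ².* y) ≈ difference x * difference y
    *-homo (m , n) (m′ , n′) = begin
      (m ℕ.* m′ ℕ.+ n ℕ.* n′) · 1# - (m ℕ.* n′ ℕ.+ n ℕ.* m′) · 1#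
        ≈⟨ +-cong (split m m′ n n′) (-‿cong (split m n′ n m′)) ⟩
      (a * a′ + b * b′) - (a * b′ + b * a′)  ≈⟨ +-congˡ (⁻¹-∙-comm _ _) ⟨
      (a * a′ + b * b′) + (- (a * b′) - b * a′)      ≈⟨ +-congˡ (+-comm _ _) ⟩
      (a * a′ + b * b′) + (- (b * a′) - a * b′)      ≈⟨ interchange _ _ _ _ ⟩
      (a * a′ - b * a′) + (b * b′ - a * b′)  ≈⟨ +-cong ([y-z]x≈yx-zx a′ a b) (flip b a b′) ⟨
      (a - b) * a′ + (a - b) * - b′  ≈⟨ distribˡ (a - b) a′ (- b′) ⟨
      (a - b) * (a′ - b′)                            ∎
      where
      a = m · 1# ; b = n · 1# ; a′ = m′ · 1# ; b′ = n′ · 1#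
      split : ∀ k l k′ l′ → (k ℕ.* l ℕ.+ k′ ℕ.* l′) · 1# ≈ (k · 1#) * (l · 1#) + (k′ · 1#) * (l′ · 1#)
      split k l k′ l′ = trans (×-homo-+ 1# (k ℕ.* l) (k′ ℕ.* l′)) (+-cong (×1-homo-* k l) (×1-homo-* k′ l′))
      flip : ∀ x y z → (y - x) * - z ≈ x * z - y * z
      flip x y z = begin
        (y - x) * - z  ≈⟨ distribʳ (- z) y (- x) ⟩
        y * - z + - x * - z  ≈⟨ +-cong (sym (-‿distribʳ-* y z)) (trans (sym (-‿distribˡ-* x (- z))) (trans (-‿cong (sym (-‿distribʳ-* x z))) (-‿involutive (x * z)))) ⟩
        - (y * z) + x * z    ≈⟨ +-comm _ _ ⟩
        x * z - y * z        ∎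

    -‿homo : ∀ x → difference (ℕ².- x) ≈ - difference x
    -‿homo (m , n) = begin
      n · 1# - m · 1#  ≈⟨ +-comm _ _ ⟩
      - (m · 1#) + n · 1#  ≈⟨ +-congˡ (-‿involutive _) ⟨
      - (m · 1#) + - (- (n · 1#))  ≈⟨ ⁻¹-∙-comm _ _ ⟩
      - (m · 1# - n · 1#)          ∎

    morphism : Differences -Raw-AlmostCommutative⟶ fromCommutativeRing R
    morphism = record
      { ⟦_⟧    = ⟦_⟧
      ; +-homo = λ x y → trans (⟦⟧≈ (x ℕ².+ y)) (trans (+-homo x y) (sym (+-cong (⟦⟧≈ x) (⟦⟧≈ y))))
      ; *-homo = λ x y → trans (⟦⟧≈ (x ℕ².* y)) (trans (*-homo x y) (sym (*-cong (⟦⟧≈ x) (⟦⟧≈ y))))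
      ; -‿homo = λ x → trans (⟦⟧≈ (ℕ².- x)) (trans (-‿homo x) (sym (-‿cong (⟦⟧≈ x))))
      ; 0-homo = refl
      ; 1-homo = refl
      }

    _≟_ : ∀ x y → Maybe (⟦ x ⟧ ≈ ⟦ y ⟧)
    x@(m , n) ≟ y@(m′ , n′) with m ℕ.+ n′ ℕ.≟ m′ ℕ.+ n
    ... | no  _  = nothing
    ... | yes eq = just (trans (⟦⟧≈ x) (trans equal (sym (⟦⟧≈ y))))
      where
      a = m · 1# ; b = n · 1# ; a′ = m′ · 1# ; b′ = n′ · 1#
      cross : a + b′ ≈ a′ + b
      cross = trans (sym (×-homo-+ 1# m n′)) (trans (reflexive (≡.cong (_· 1#) eq)) (×-homo-+ 1# m′ n))
      cancel : ∀ x y → (x + y) - y ≈ x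
      cancel x y = trans (+-assoc x y (- y)) (trans (+-congˡ (-‿inverseʳ y)) (+-identityʳ x))
      equal : a - b ≈ a′ - b′
      equal = begin
        a - b  ≈⟨ +-congʳ (cancel a b′) ⟨
        ((a + b′) - b′) - b    ≈⟨ +-congʳ (+-congʳ cross) ⟩
        ((a′ + b) - b′) - b    ≈⟨ +-assoc _ _ _ ⟩
        (a′ + b) + (- b′ - b)  ≈⟨ +-congˡ (+-comm _ _) ⟩
        (a′ + b) + (- b - b′)  ≈⟨ +-assoc _ _ _ ⟨
        ((a′ + b) - b) - b′    ≈⟨ +-congʳ (cancel a′ b) ⟩
        a′ - b′                ∎

  open import Algebra.Solver.Ring Differences (fromCommutativeRing R) morphism _≟_ public
    using (solve; _:=_; _:+_; _:*_; _:-_; :-_; con)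

-- Dot products, subrings and polynomial expressions in one element

module Adjunction {c ℓ : Level} (R : CommutativeRing c ℓ) where

  open import Data.Fin.Base using (Fin; zero; suc; _↑ˡ_; _↑ʳ_; punchIn)
  open import Data.Fin.Properties using (_≟_; punchInᵢ≢i)
  open import Data.Nat.Base as ℕ using (ℕ; zero; suc; z≤n; s≤s)
  import Data.Nat.Properties as ℕ
  open import Data.Vec.Functional using (Vector; removeAt)
  open import Relation.Binary.PropositionalEquality.Core as ≡ using (_≡_; _≢_)
  open import Relation.Unary using (_⊆_)
  open CommutativeRing R hiding (zero)
  open import Algebra.Properties.Semiring.Sum semiring public
    using (sum; sum-cong-≋; sum-replicate-zero; sum-remove; ∑-distrib-+; *-distribˡ-sum; *-distribʳ-sum)
  open import Relation.Binary.Reasoning.Setoid setoid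
  open IntegerSolver R public

  module _ {a b} (M : Monoid a b) where
    open Monoid M using (_∙_) renaming (Carrier to A; _≈_ to _≈ₘ_)
    open import Algebra.Definitions.RawMonoid (Monoid.rawMonoid M) using () renaming (sum to ∑)

    sum-split : ∀ n {k} (f : Vector A (n ℕ.+ k)) → ∑ f ≈ₘ ∑ (f ∘ (_↑ˡ k)) ∙ ∑ (f ∘ (n ↑ʳ_))
    sum-split zero    f = Monoid.sym M (Monoid.identityˡ M _)
    sum-split (suc n) f = Monoid.trans M (Monoid.∙-congˡ M (sum-split n (f ∘ suc))) (Monoid.sym M (Monoid.assoc M _ _ _))

  record IsField : Set (c ⊔ ℓ) where
    field
      1≉0     : ¬ 1# ≈ 0#
      inverse : ∀ x → ¬ x ≈ 0# → ∃[ y ] y * x ≈ 1#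

  dot : ∀ {n} → Vector Carrier n → Vector Carrier n → Carrier
  dot u v = sum (λ i → u i * v i)

  dot-cong : ∀ {n} {u u′ v v′ : Vector Carrier n} → (∀ i → u i ≈ u′ i) → (∀ i → v i ≈ v′ i) → dot u v ≈ dot u′ v′
  dot-cong u≈u′ v≈v′ = sum-cong-≋ λ i → *-cong (u≈u′ i) (v≈v′ i)

  dot-comm : ∀ {n} (u v : Vector Carrier n) → dot u v ≈ dot v u
  dot-comm u v = sum-cong-≋ λ i → *-comm (u i) (v i)

  dot-+ : ∀ {n} (u u′ v : Vector Carrier n) → dot (λ i → u i + u′ i) v ≈ dot u v + dot u′ v
  dot-+ u u′ v = trans (sum-cong-≋ λ i → distribʳ (v i) (u i) (u′ i)) (∑-distrib-+ (λ i → u i * v i) (λ i → u′ i * v i))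

  dot-* : ∀ {n} a (u v : Vector Carrier n) → dot (λ i → a * u i) v ≈ a * dot u v
  dot-* a u v = trans (sum-cong-≋ λ i → *-assoc a (u i) (v i)) (sym (*-distribˡ-sum a (λ i → u i * v i)))

  dot-zeroˡ : ∀ {n} {u v : Vector Carrier n} → (∀ i → u i ≈ 0#) → dot u v ≈ 0#
  dot-zeroˡ {n} {v = v} u≈0 = trans (sum-cong-≋ λ i → trans (*-congʳ (u≈0 i)) (zeroˡ (v i))) (sum-replicate-zero n)

  dot-zeroʳ : ∀ {n} {u v : Vector Carrier n} → (∀ i → v i ≈ 0#) → dot u v ≈ 0#
  dot-zeroʳ {u = u} {v} v≈0 = trans (dot-comm u v) (dot-zeroˡ v≈0)

  δ : ∀ {n} → Fin n → Vector Carrier n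
  δ i k with i ≟ k
  ... | yes _ = 1#
  ... | no  _ = 0#

  δ-diagonal : ∀ {n} (i : Fin n) → δ i i ≈ 1#
  δ-diagonal i with i ≟ i
  ... | yes _   = refl
  ... | no  i≢i = contradiction ≡.refl i≢i

  δ-off : ∀ {n} {i k : Fin n} → i ≢ k → δ i k ≈ 0#
  δ-off {i = i} {k} i≢k with i ≟ k
  ... | yes i≡k = contradiction i≡k i≢k
  ... | no  _   = refl

  dot-δ : ∀ {n} (i : Fin n) v → dot (δ i) v ≈ v i
  dot-δ {suc n} i v = begin
    dot (δ i) v  ≈⟨ sum-remove {i = i} (λ k → δ i k * v k) ⟩
    δ i i * v i + sum (removeAt (λ k → δ i k * v k) i) ≈⟨ +-cong (trans (*-congʳ (δ-diagonal i)) (*-identityˡ (v i)))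
                                                            (dot-zeroˡ {v = v ∘ punchIn i} λ k → δ-off (punchInᵢ≢i i k ∘ ≡.sym)) ⟩
    v i + 0#  ≈⟨ +-identityʳ (v i) ⟩
    v i                                               ∎

  record IsSubring (F : Pred Carrier (c ⊔ ℓ)) : Set (c ⊔ ℓ) where
    field
      resp  : ∀ {x y} → x ≈ y → F x → F y
      0∈    : F 0#
      1∈    : F 1#
      +-closed : ∀ {x y} → F x → F y → F (x + y)
      *-closed : ∀ {x y} → F x → F y → F (x * y)
      neg-closed : ∀ {x} → F x → F (- x)

    minus-closed : ∀ {x y} → F x → F y → F (x - y)
    minus-closed x∈ y∈ = +-closed x∈ (neg-closed y∈)

    sum-closed : ∀ {n} {f : Vector Carrier n} → (∀ i → F (f i)) → F (sum f)
    sum-closed {zero}  f∈ = 0∈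
    sum-closed {suc n} f∈ = +-closed (f∈ zero) (sum-closed (f∈ ∘ suc))

    dot-closed : ∀ {n} {u v : Vector Carrier n} → (∀ i → F (u i)) → (∀ i → F (v i)) → F (dot u v)
    dot-closed u∈ v∈ = sum-closed λ i → *-closed (u∈ i) (v∈ i)

    δ-closed : ∀ {n} (i k : Fin n) → F (δ i k)
    δ-closed i k with i ≟ k
    ... | yes _ = 1∈
    ... | no  _ = 0∈

  module Polynomials {F : Pred Carrier (c ⊔ ℓ)} (F-isSubring : IsSubring F) (t : Carrier) where
    private module F = IsSubring F-isSubring

    -- Horner form of the values at t of polynomials over F of degree below m. These are ring
    -- elements and not formal polynomials: t may be algebraic, and then x has several
    -- presentations.
    data Poly : ℕ → Carrier → Set (c ⊔ ℓ) where
      nil  : ∀ {x} → x ≈ 0# → Poly 0 x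
      cons : ∀ {m x a y} → F a → Poly m y → x ≈ a + t * y → Poly (suc m) x

    poly-resp : ∀ {m x y} → x ≈ y → Poly m x → Poly m y
    poly-resp x≈y (nil x≈0)         = nil (trans (sym x≈y) x≈0)
    poly-resp x≈y (cons a∈ y∈ x≈a+) = cons a∈ y∈ (trans (sym x≈y) x≈a+)

    poly-zero : ∀ m → Poly m 0#
    poly-zero zero    = nil refl
    poly-zero (suc m) = cons F.0∈ (poly-zero m) (sym (trans (+-identityˡ _) (zeroʳ t)))

    poly-weaken : ∀ {m n x} → m ℕ.≤ n → Poly m x → Poly n x
    poly-weaken {n = n} z≤n (nil x≈0)         = poly-resp (sym x≈0) (poly-zero n)
    poly-weaken (s≤s m≤n)   (cons a∈ y∈ x≈a+) = cons a∈ (poly-weaken m≤n y∈) x≈a+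

    poly-+ : ∀ {m x y} → Poly m x → Poly m y → Poly m (x + y)
    poly-+ (nil x≈0) (nil y≈0) = nil (trans (+-cong x≈0 y≈0) (+-identityʳ 0#))
    poly-+ (cons {a = a} {y = x} a∈ x∈ x≈a+) (cons {a = b} {y = y} b∈ y∈ y≈b+) =
      cons (F.+-closed a∈ b∈) (poly-+ x∈ y∈) (trans (+-cong x≈a+ y≈b+)
        (solve 5 (λ a b t x y → (a :+ t :* x) :+ (b :+ t :* y) := (a :+ b) :+ t :* (x :+ y)) refl a b t x y))

    poly-scale : ∀ {m a x} → F a → Poly m x → Poly m (a * x)
    poly-scale {a = a} a∈ (nil x≈0) = nil (trans (*-congˡ x≈0) (zeroʳ a))
    poly-scale {a = a} a∈ (cons {a = b} {y = y} b∈ y∈ x≈b+) =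
      cons (F.*-closed a∈ b∈) (poly-scale a∈ y∈) (trans (*-congˡ x≈b+)
        (solve 4 (λ a b t y → a :* (b :+ t :* y) := a :* b :+ t :* (a :* y)) refl a b t y))

    poly-shift : ∀ {m x} → Poly m x → Poly (suc m) (t * x)
    poly-shift x∈ = cons F.0∈ x∈ (sym (+-identityˡ _))

    poly-constant : ∀ {a} → F a → Poly 1 a
    poly-constant {a} a∈ = cons a∈ (nil refl) (sym (trans (+-congˡ (zeroʳ t)) (+-identityʳ a)))

    poly-* : ∀ {m n x y} → Poly m x → Poly n y → Poly (m ℕ.+ n) (x * y)
    poly-* {n = n} {y = y} (nil x≈0) y∈ = poly-resp (sym (trans (*-congʳ x≈0) (zeroˡ y))) (poly-zero n)
    poly-* {suc m} {n} {y = y} (cons {a = a} {y = x} a∈ x∈ x≈a+) y∈ = poly-resp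
      (sym (trans (*-congʳ x≈a+) (solve 4 (λ a t x y → (a :+ t :* x) :* y := a :* y :+ t :* (x :* y)) refl a t x y)))
      (poly-+ (poly-weaken (ℕ.m≤n+m n (suc m)) (poly-scale a∈ y∈)) (poly-shift (poly-* x∈ y∈)))

    poly-sum : ∀ {m n} {f : Vector Carrier n} → (∀ i → Poly m (f i)) → Poly m (sum f)
    poly-sum {m} {zero}  f∈ = poly-zero m
    poly-sum {m} {suc n} f∈ = poly-+ (f∈ zero) (poly-sum (f∈ ∘ suc))

    Adjoined : Pred Carrier (c ⊔ ℓ)
    Adjoined x = ∃[ m ] Poly m x

    base-adjoined : F ⊆ Adjoined
    base-adjoined a∈ = 1 , poly-constant a∈

    t-adjoined : Adjoined t
    t-adjoined = 2 , poly-resp (*-identityʳ t) (poly-shift (poly-constant F.1∈))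

    adjoined-isSubring : IsSubring Adjoined
    adjoined-isSubring = record
      { resp       = λ x≈y (m , x∈) → m , poly-resp x≈y x∈
      ; 0∈         = 0 , nil refl
      ; 1∈         = base-adjoined F.1∈
      ; +-closed   = λ (m , x∈) (n , y∈) → m ℕ.⊔ n ,
                       poly-+ (poly-weaken (ℕ.m≤m⊔n m n) x∈) (poly-weaken (ℕ.m≤n⊔m m n) y∈)
      ; *-closed   = λ (m , x∈) (n , y∈) → m ℕ.+ n , poly-* x∈ y∈
      ; neg-closed = λ {x} (m , x∈) → m , poly-resp (-1*x≈-x x) (poly-scale (F.neg-closed F.1∈) x∈)
      }
      where open import Algebra.Properties.Ring ring using (-1*x≈-x)

    split-constant : ∀ {x} → Adjoined x → ∃[ a ] ∃[ y ] F a × Adjoined y × x ≈ a + t * y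
    split-constant (0 , nil x≈0) = 0# , 0# , F.0∈ , (0 , nil refl) , trans x≈0 (sym (trans (+-identityˡ _) (zeroʳ t)))
    split-constant (suc m , cons {a = a} {y = y} a∈ y∈ x≈a+) = a , y , a∈ , (m , y∈) , x≈a+

-- Hilbert's basis theorem

module Noetherian (em : ∀ {a : Level} → ExcludedMiddle a) {c ℓ : Level} (R : CommutativeRing c ℓ) where

  open import Data.Fin.Base using (zero; suc)
  open import Data.Vec.Functional using (Vector)
  open import Data.List.Base using (List; []; _∷_)
  open import Data.List.Relation.Unary.All using (All; []; _∷_)
  open import Data.Nat.Base as ℕ using (ℕ; zero; suc)
  import Data.Nat.Properties as ℕ
  open import Data.Nat.Induction using (<-rec)
  open import Relation.Binary.PropositionalEquality.Core as ≡ using (_≡_)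
  open import Relation.Unary using (_⊆_)
  open CommutativeRing R hiding (zero)
  open import Algebra.Properties.Semiring.Exp semiring using (_^_; ^-homo-*)
  open Adjunction R

  least : ∀ {p} {P : Pred ℕ p} → ∃[ n ] P n → ∃[ n ] P n × (∀ {m} → m ℕ.< n → ¬ P m)
  least {P = P} (n , pn) = <-rec (λ n → P n → ∃[ k ] P k × (∀ {m} → m ℕ.< k → ¬ P m)) search n pn
    where
    search : ∀ n → (∀ {m} → m ℕ.< n → P m → ∃[ k ] P k × (∀ {m} → m ℕ.< k → ¬ P m)) →
             P n → ∃[ k ] P k × (∀ {m} → m ℕ.< k → ¬ P m)
    search n rec pn with em {_} {∃[ m ] m ℕ.< n × P m}
    ... | yes (m , m<n , pm) = rec m<n pm
    ... | no  none           = n , pn , λ m<n pm → none (_ , m<n , pm)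

  module _ (F : Pred Carrier (c ⊔ ℓ)) where

    data Ideal : List Carrier → Carrier → Set (c ⊔ ℓ) where
      nil  : ∀ {x} → x ≈ 0# → Ideal [] x
      cons : ∀ {f fs x r y} → F r → Ideal fs y → x ≈ r * f + y → Ideal (f ∷ fs) x

    -- The ascending chain condition in inductive form.
    data Terminating (fs : List Carrier) : Set (c ⊔ ℓ) where
      extend : (∀ {f} → F f → ¬ Ideal fs f → Terminating (f ∷ fs)) → Terminating fs

    Noetherian : Set (c ⊔ ℓ)
    Noetherian = Terminating []

    ideal-resp : ∀ {fs x y} → x ≈ y → Ideal fs x → Ideal fs y
    ideal-resp x≈y (nil x≈0)         = nil (trans (sym x≈y) x≈0)
    ideal-resp x≈y (cons r∈ y∈ x≈r+) = cons r∈ y∈ (trans (sym x≈y) x≈r+)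

    -- An element outside the larger ideal is outside the smaller one, so every extension of gs is
    -- matched by one of fs.
    terminating-mono : ∀ {fs gs} → Ideal fs ⊆ Ideal gs → Terminating fs → Terminating gs
    terminating-mono fs⊆gs (extend next) = extend λ f∈ f∉gs →
      terminating-mono (λ { (cons r∈ y∈ x≈) → cons r∈ (fs⊆gs y∈) x≈ }) (next f∈ λ f∈fs → f∉gs (fs⊆gs f∈fs))

    finitely-generated : ∀ {p} {P : Pred Carrier p} → P ⊆ F → Noetherian → ∃[ fs ] All P fs × P ⊆ Ideal fs
    finitely-generated {P = P} P⊆F = generate []
      where
      generate : ∀ {fs} → All P fs → Terminating fs → ∃[ gs ] All P gs × P ⊆ Ideal gs
      generate {fs} fs∈ (extend next) with em {_} {∃[ f ] P f × ¬ Ideal fs f}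
      ... | yes (f , f∈ , f∉) = generate (f∈ ∷ fs∈) (next (P⊆F f∈) f∉)
      ... | no  none          = fs , fs∈ , λ {f} f∈ → decidable-stable em λ f∉ → none (f , f∈ , f∉)

  module _ {F : Pred Carrier (c ⊔ ℓ)} (F-isSubring : IsSubring F) where
    private module F = IsSubring F-isSubring

    ideal-+ : ∀ {fs x y} → Ideal F fs x → Ideal F fs y → Ideal F fs (x + y)
    ideal-+ (nil x≈0) (nil y≈0) = nil (trans (+-cong x≈0 y≈0) (+-identityʳ 0#))
    ideal-+ (cons {f = f} {r = r} {y = x} r∈ x∈ x≈) (cons {r = s} {y = y} s∈ y∈ y≈) =
      cons (F.+-closed r∈ s∈) (ideal-+ x∈ y∈) (trans (+-cong x≈ y≈)
        (solve 5 (λ f r s x y → (r :* f :+ x) :+ (s :* f :+ y) := (r :+ s) :* f :+ (x :+ y)) refl f r s x y))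

    ideal-* : ∀ {fs r x} → F r → Ideal F fs x → Ideal F fs (r * x)
    ideal-* {r = r} r∈ (nil x≈0) = nil (trans (*-congˡ x≈0) (zeroʳ r))
    ideal-* {r = r} r∈ (cons {f = f} {r = s} {y = y} s∈ y∈ x≈) =
      cons (F.*-closed r∈ s∈) (ideal-* r∈ y∈) (trans (*-congˡ x≈)
        (solve 4 (λ r s f y → r :* (s :* f :+ y) := r :* s :* f :+ r :* y) refl r s f y))

    ideal-minus : ∀ {fs x y} → Ideal F fs x → Ideal F fs y → Ideal F fs (x - y)
    ideal-minus {x = x} {y} x∈ y∈ = ideal-resp F (+-congˡ (-1*x≈-x y)) (ideal-+ x∈ (ideal-* (F.neg-closed F.1∈) y∈))
      where open import Algebra.Properties.Ring ring using (-1*x≈-x)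

    ideal-zero : ∀ fs → Ideal F fs 0#
    ideal-zero []       = nil refl
    ideal-zero (f ∷ fs) = cons F.0∈ (ideal-zero fs) (sym (trans (+-identityʳ _) (zeroˡ f)))

    ideal-weaken : ∀ {f fs} → Ideal F fs ⊆ Ideal F (f ∷ fs)
    ideal-weaken {f} x∈ = cons F.0∈ x∈ (sym (trans (+-congʳ (zeroˡ f)) (+-identityˡ _)))

    -- Once a nonzero f with inverse y has been added, every g is the multiple (g * y) * f, so the
    -- chain stops.
    field-noetherian : (∀ {x} → F x → ¬ x ≈ 0# → ∃[ y ] F y × y * x ≈ 1#) → Noetherian F
    field-noetherian inverse = extend λ {f} f∈ f∉ → extend λ {g} g∈ g∉ →
      let (y , y∈ , yf≈1) = inverse f∈ λ f≈0 → f∉ (nil f≈0)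
      in contradiction (cons (F.*-closed g∈ y∈) (nil refl)
           (sym (trans (+-identityʳ _) (trans (*-assoc g y f) (trans (*-congˡ yf≈1) (*-identityʳ g)))))) g∉

  module _ {F : Pred Carrier (c ⊔ ℓ)} (F-isSubring : IsSubring F) (t : Carrier) where
    private module F = IsSubring F-isSubring
    open Polynomials F-isSubring t
    private module O = IsSubring adjoined-isSubring

    power-poly : ∀ m → Poly (suc m) (t ^ m)
    power-poly zero    = poly-constant F.1∈
    power-poly (suc m) = poly-shift (power-poly m)

    add-leading : ∀ {m a y} → F a → Poly m y → Poly (suc m) (a * t ^ m + y)
    add-leading {m} a∈ y∈ = poly-+ (poly-scale a∈ (power-poly m)) (poly-weaken (ℕ.n≤1+n m) y∈)

    -- The coefficient may be zero and, for algebraic t, it is not determined by x. It is therefore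
    -- a relation, which has the advantage of being closed under sums. Algebraic t do occur:
    -- coordinate functions over a finite field satisfy an equation.
    record Leading (m : ℕ) (a x : Carrier) : Set (c ⊔ ℓ) where
      constructor leading
      field
        {rest}      : Carrier
        coefficient : F a
        lower       : Poly m rest
        decompose   : x ≈ a * t ^ m + rest

    leading-coefficient : ∀ {m x} → Poly (suc m) x → ∃[ a ] Leading m a x
    leading-coefficient {zero} (cons {a = a} {y = y} a∈ (nil y≈0) x≈) =
      a , leading a∈ (nil refl) (trans x≈ (+-cong (sym (*-identityʳ a)) (trans (*-congˡ y≈0) (zeroʳ t))))
    leading-coefficient {suc m} (cons {a = b} b∈ y∈ x≈) with leading-coefficient y∈
    ... | a , leading {z} a∈ z∈ y≈ = a , leading a∈ (cons b∈ z∈ refl) (trans x≈ (trans (+-congˡ (*-congˡ y≈))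
      (solve 5 (λ a b t s z → b :+ t :* (a :* s :+ z) := a :* (t :* s) :+ (b :+ t :* z)) refl a b t (t ^ m) z)))

    leading-+ : ∀ {m a b x y} → Leading m a x → Leading m b y → Leading m (a + b) (x + y)
    leading-+ {m} {a} {b} (leading {x} a∈ x∈ x≈) (leading {y} b∈ y∈ y≈) =
      leading (F.+-closed a∈ b∈) (poly-+ x∈ y∈) (trans (+-cong x≈ y≈)
        (solve 5 (λ a b s x y → (a :* s :+ x) :+ (b :* s :+ y) := (a :+ b) :* s :+ (x :+ y)) refl a b (t ^ m) x y))

    leading-scale : ∀ {m k a r x} → F r → Leading m a x → Leading (k ℕ.+ m) (r * a) (r * t ^ k * x)
    leading-scale {m} {k} {a} {r} r∈ (leading {x} a∈ x∈ x≈) =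
      leading (F.*-closed r∈ a∈) (poly-resp (sym (*-assoc r (t ^ k) x)) (poly-scale r∈ (shift k x∈)))
        (trans (*-congˡ x≈) (trans
          (solve 5 (λ r s a u x → r :* s :* (a :* u :+ x) := r :* a :* (s :* u) :+ r :* s :* x) refl r (t ^ k) a (t ^ m) x)
          (+-congʳ (*-congˡ (sym (^-homo-* t k m))))))
      where
      shift : ∀ k {m x} → Poly m x → Poly (k ℕ.+ m) (t ^ k * x)
      shift zero    x∈ = poly-resp (sym (*-identityˡ _)) x∈
      shift (suc k) x∈ = poly-resp (sym (*-assoc t (t ^ k) _)) (poly-shift (shift k x∈))

    leading-difference : ∀ {m a x y} → Leading m a x → Leading m a y → Poly m (x - y)
    leading-difference {m} {a} (leading {x} a∈ x∈ x≈) (leading {y} _ y∈ y≈) =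
      poly-resp (sym (trans (+-cong x≈ (-‿cong y≈))
          (solve 3 (λ s x y → (s :+ x) :- (s :+ y) := x :- y) refl (a * t ^ m) x y)))
        (poly-resp (+-congˡ (-1*x≈-x y)) (poly-+ x∈ (poly-scale (F.neg-closed F.1∈) y∈)))
      where open import Algebra.Properties.Ring ring using (-1*x≈-x)

    data Leads (d : ℕ) : List Carrier → List Carrier → Set (c ⊔ ℓ) where
      []   : Leads d [] []
      _∷_ : ∀ {g gs a as} → ∃[ m ] m ℕ.≤ d × Leading m a g → Leads d gs as → Leads d (g ∷ gs) (a ∷ as)

    leads-weaken : ∀ {d e gs as} → d ℕ.≤ e → Leads d gs as → Leads e gs as
    leads-weaken d≤e []                  = []
    leads-weaken d≤e ((m , m≤d , l) ∷ ls) = (m , ℕ.≤-trans m≤d d≤e , l) ∷ leads-weaken d≤e ls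

    -- Multiplying each g by t ^ (d ∸ m) brings all leading terms to the same degree d, where they
    -- can be combined as the coefficients are.
    lift-leading : ∀ {d gs as a} → Leads d gs as → Ideal F as a → ∃[ h ] Ideal Adjoined gs h × Leading d a h
    lift-leading [] (nil a≈0) = 0# , nil refl ,
      leading (F.resp (sym a≈0) F.0∈) (poly-zero _) (sym (trans (+-identityʳ _) (trans (*-congʳ a≈0) (zeroˡ _))))
    lift-leading {d} {g ∷ gs} {a ∷ as} ((m , m≤d , l) ∷ ls) (cons {r = r} r∈ y∈ a≈) with lift-leading ls y∈
    ... | h , h∈ , lh = r * t ^ (d ℕ.∸ m) * g + h , cons scalar h∈ refl , leading-resp
      (sym a≈) (leading-+ (≡.subst (λ n → Leading n (r * a) (r * t ^ (d ℕ.∸ m) * g)) (ℕ.m∸n+n≡m m≤d) (leading-scale r∈ l)) lh)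
      where
      scalar : Adjoined (r * t ^ (d ℕ.∸ m))
      scalar = _ , poly-scale r∈ (power-poly (d ℕ.∸ m))
      leading-resp : ∀ {m a b x} → a ≈ b → Leading m a x → Leading m b x
      leading-resp a≈b (leading a∈ y∈ x≈) = leading (F.resp a≈b a∈) y∈ (trans x≈ (+-congʳ (*-congʳ a≈b)))

    -- A chain that can be extended without end is extended by an element of least degree among
    -- those that keep this possible; then its leading coefficients form such a chain over F.
    leads-terminate : ∀ {as} → Terminating F as → ∀ d gs → Leads d gs as →
      (∀ {f} → Poly d f → ¬ Ideal Adjoined gs f → Terminating Adjoined (f ∷ gs)) → Terminating Adjoined gs
    leads-terminate {as} (extend next) d gs ls low with em {_} {Terminating Adjoined gs}
    ... | yes terminating = terminating
    ... | no  endless with em {_} {∃[ m ] ∃[ f ] Poly m f × ¬ Ideal Adjoined gs f × ¬ Terminating Adjoined (f ∷ gs)}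
    ...   | no  none  = extend λ {f} (m , f∈) f∉ → decidable-stable em λ nt → none (m , f , f∈ , f∉ , nt)
    ...   | yes some with least some
    ...     | zero , (f , nil f≈0 , f∉ , _) , _ =
      contradiction (ideal-resp Adjoined (sym f≈0) (ideal-zero adjoined-isSubring gs)) f∉
    ...     | suc m , (f , f∈ , f∉ , endless-f) , minimal with leading-coefficient f∈
    ...       | a , la@(leading a∈ _ _) =
      contradiction (leads-terminate (next a∈ a∉) m (f ∷ gs) ((m , ℕ.≤-refl , la) ∷ ls′) low′) endless-f
      where
      -- Here d ≤ m, since `low` makes all extensions of degree below d terminate, whereas that by f
      -- does not.
      ls′ : Leads m gs as
      ls′ = leads-weaken (ℕ.≮⇒≥ λ m<d → endless-f (low (poly-weaken m<d f∈) f∉)) ls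
      terminates : ∀ {g} → Poly m g → ¬ Ideal Adjoined gs g → Terminating Adjoined (g ∷ gs)
      terminates {g} g∈ g∉ = decidable-stable em λ nt → minimal ℕ.≤-refl (g , g∈ , g∉ , nt)
      -- By minimality of m, adding g to gs terminates; adding f as well only enlarges the ideal.
      low′ : ∀ {g} → Poly m g → ¬ Ideal Adjoined (f ∷ gs) g → Terminating Adjoined (g ∷ f ∷ gs)
      low′ g∈ g∉ = terminating-mono Adjoined
        (λ { (cons r∈ y∈ x≈) → cons r∈ (ideal-weaken adjoined-isSubring y∈) x≈ })
        (terminates g∈ (λ g∈gs → g∉ (ideal-weaken adjoined-isSubring g∈gs)))
      -- Otherwise some h in the ideal of gs has the leading term a * t ^ m too. Then f - h has
      -- degree below m, so adding it terminates by minimality; but with gs it generates the same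
      -- ideal as f does.
      a∉ : ¬ Ideal F as a
      a∉ a∈as with lift-leading ls′ a∈as
      ... | h , h∈ , lh = endless-f (terminating-mono Adjoined replace
              (terminates (leading-difference la lh) λ f-h∈ → f∉ (ideal-resp Adjoined
                (solve 2 (λ f h → (f :- h) :+ h := f) refl f h) (ideal-+ adjoined-isSubring f-h∈ h∈))))
        where
        replace : Ideal Adjoined (f - h ∷ gs) ⊆ Ideal Adjoined (f ∷ gs)
        replace (cons {r = r} {y = y} r∈ y∈ x≈) =
          cons r∈ (ideal-minus adjoined-isSubring y∈ (ideal-* adjoined-isSubring r∈ h∈))
            (trans x≈ (solve 4 (λ f h r y → r :* (f :- h) :+ y := r :* f :+ (y :- r :* h)) refl f h r y))

    adjoined-noetherian : Noetherian F → Noetherian Adjoined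
    adjoined-noetherian noetherian = leads-terminate noetherian 0 [] []
      λ { (nil f≈0) f∉ → contradiction (nil f≈0) f∉ }

  record NoetherianExtension (F : Pred Carrier (c ⊔ ℓ)) : Set (Level.suc (c ⊔ ℓ)) where
    field
      {L}        : Pred Carrier (c ⊔ ℓ)
      isSubring  : IsSubring L
      noetherian : Noetherian L
      extends    : F ⊆ L

  adjoin-noetherian : ∀ {F : Pred Carrier (c ⊔ ℓ)} → IsSubring F → Noetherian F → ∀ {k} (g : Vector Carrier k) →
                      ∃[ E ] (∀ l → NoetherianExtension.L {F} E (g l))
  adjoin-noetherian F-isSubring F-noetherian {zero} g =
    record { isSubring = F-isSubring ; noetherian = F-noetherian ; extends = λ x∈ → x∈ } , λ ()
  adjoin-noetherian {F} F-isSubring F-noetherian {suc k} g =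
    let (E , g∈) = adjoin-noetherian adjoined-isSubring (adjoined-noetherian F-isSubring (g zero) F-noetherian) (g ∘ suc)
        module E = NoetherianExtension E
    in record { isSubring = E.isSubring ; noetherian = E.noetherian ; extends = λ x∈ → E.extends (base-adjoined x∈) } ,
       λ { zero → E.extends t-adjoined ; (suc l) → g∈ l }
    where open Polynomials F-isSubring (g zero)

-- Fraction fields and algebraic extensions

module FieldExtensions (em : ∀ {a : Level} → ExcludedMiddle a) {c ℓ : Level} (R : CommutativeRing c ℓ)
  (R-isField : Adjunction.IsField R) {i j : Level} (I : Set i) (J : Set j) where

  open CommutativeRing R hiding (zero)
  open Adjunction.IsField R-isField
  open import Data.Fin.Base using (Fin; zero; suc; splitAt)
  open import Data.Nat.Base as ℕ using (ℕ; zero; suc; z≤n; s≤s)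
  import Data.Nat.Properties as ℕ
  open import Data.Vec.Functional using (Vector; tail; _++_; []; _∷_)
  open import Data.Vec.Functional.Properties using (lookup-++ˡ; lookup-++ʳ)
  open import Relation.Binary.PropositionalEquality.Core as ≡ using (_≡_)
  open import Relation.Unary using (_⊆_)
  open import Relation.Binary.Reasoning.Setoid setoid
  open import Algebra.Properties.Semiring.Exp semiring using (_^_)
  open import Algebra.Properties.Semiring.Sum semiring using (∑-comm)
  open Regularity
  open Adjunction R
  open Noetherian em R using (least; leading; leading-coefficient; add-leading)

  cancel : ∀ {x y} → ¬ x ≈ 0# → x * y ≈ 0# → y ≈ 0#
  cancel {x} {y} x≉0 xy≈0 = let (z , zx≈1) = inverse x x≉0 in begin
    y  ≈⟨ trans (*-congʳ zx≈1) (*-identityˡ y) ⟨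
    z * x * y    ≈⟨ *-assoc z x y ⟩
    z * (x * y)  ≈⟨ trans (*-congˡ xy≈0) (zeroʳ z) ⟩
    0#           ∎

  nonzero-* : ∀ {x y} → ¬ x ≈ 0# → ¬ y ≈ 0# → ¬ x * y ≈ 0#
  nonzero-* x≉0 y≉0 xy≈0 = y≉0 (cancel x≉0 xy≈0)

  x-y≈0⇒x≈y : ∀ {x y} → x - y ≈ 0# → x ≈ y
  x-y≈0⇒x≈y {x} {y} x-y≈0 = trans (solve 2 (λ x y → x := (x :- y) :+ y) refl x y)
    (trans (+-congʳ x-y≈0) (+-identityˡ y))

  *-cancelˡ : ∀ {x y z} → ¬ x ≈ 0# → x * y ≈ x * z → y ≈ z
  *-cancelˡ {x} {y} {z} x≉0 xy≈xz = x-y≈0⇒x≈y (cancel x≉0 (trans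
    (solve 3 (λ x y z → x :* (y :- z) := x :* y :- x :* z) refl x y z)
    (trans (+-congʳ xy≈xz) (-‿inverseʳ (x * z)))))

  record IsSubfield (F : Pred Carrier (c ⊔ ℓ)) : Set (c ⊔ ℓ) where
    field
      isSubring  : IsSubring F
      inv-closed : ∀ {x y} → y * x ≈ 1# → F x → F y
    open IsSubring isSubring public

    reciprocal : ∀ {x} → F x → ¬ x ≈ 0# → ∃[ y ] F y × y * x ≈ 1#
    reciprocal {x} x∈ x≉0 = let (y , yx≈1) = inverse x x≉0 in y , inv-closed yx≈1 x∈ , yx≈1

  -- The constant k is fixed before the vectors, hence independent of their denominators and
  -- degrees. The sets I and J index the points on the two sides.
  DotRegular : Pred Carrier (c ⊔ ℓ) → Set _
  DotRegular F = ∀ n → ∃[ k ] (∀ (u : I → Vector Carrier n) (v : J → Vector Carrier n) →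
    (∀ a i → F (u a i)) → (∀ b i → F (v b i)) → Regular k (λ a b → dot (u a) (v b) ≈ 0#))

  module _ {O : Pred Carrier (c ⊔ ℓ)} (O-isSubring : IsSubring O) where
    private module O = IsSubring O-isSubring

    Fraction : Pred Carrier (c ⊔ ℓ)
    Fraction x = ∃[ d ] O d × ¬ d ≈ 0# × O (d * x)

    subring-fraction : O ⊆ Fraction
    subring-fraction x∈ = 1# , O.1∈ , 1≉0 , O.resp (sym (*-identityˡ _)) x∈

    fraction-isSubfield : IsSubfield Fraction
    fraction-isSubfield = record
      { isSubring = record
        { resp       = λ x≈y (d , d∈ , d≉0 , dx∈) → d , d∈ , d≉0 , O.resp (*-congˡ x≈y) dx∈
        ; 0∈         = subring-fraction O.0∈
        ; 1∈         = subring-fraction O.1∈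
        ; +-closed   = λ {x} {y} (d , d∈ , d≉0 , dx∈) (e , e∈ , e≉0 , ey∈) →
            d * e , O.*-closed d∈ e∈ , nonzero-* d≉0 e≉0 ,
            O.resp (solve 4 (λ d e x y → e :* (d :* x) :+ d :* (e :* y) := d :* e :* (x :+ y)) refl d e x y)
              (O.+-closed (O.*-closed e∈ dx∈) (O.*-closed d∈ ey∈))
        ; *-closed   = λ {x} {y} (d , d∈ , d≉0 , dx∈) (e , e∈ , e≉0 , ey∈) →
            d * e , O.*-closed d∈ e∈ , nonzero-* d≉0 e≉0 ,
            O.resp (solve 4 (λ d e x y → d :* x :* (e :* y) := d :* e :* (x :* y)) refl d e x y) (O.*-closed dx∈ ey∈)
        ; neg-closed = λ {x} (d , d∈ , d≉0 , dx∈) → d , d∈ , d≉0 ,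
            O.resp (solve 2 (λ d x → :- (d :* x) := d :* (:- x)) refl d x) (O.neg-closed dx∈)
        }
      ; inv-closed = λ {x} {y} yx≈1 (d , d∈ , d≉0 , dx∈) →
          d * x , dx∈ , (λ dx≈0 → 1≉0 (trans (sym yx≈1) (trans (*-congˡ (cancel d≉0 dx≈0)) (zeroʳ y)))) ,
          O.resp (trans (sym (trans (*-congˡ yx≈1) (*-identityʳ d)))
            (solve 3 (λ d x y → d :* (y :* x) := d :* x :* y) refl d x y)) d∈
      }

    clear-denominators : ∀ {n} {w : Vector Carrier n} → (∀ i → Fraction (w i)) →
                         ∃[ d ] O d × ¬ d ≈ 0# × (∀ i → O (d * w i))
    clear-denominators {zero}          w∈ = 1# , O.1∈ , 1≉0 , λ ()
    clear-denominators {suc n} {w} w∈ =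
      let (d , d∈ , d≉0 , dw∈) = clear-denominators (w∈ ∘ suc)
          (e , e∈ , e≉0 , ew∈) = w∈ zero
      in d * e , O.*-closed d∈ e∈ , nonzero-* d≉0 e≉0 ,
         λ { zero    → O.resp (sym (*-assoc d e (w zero))) (O.*-closed d∈ ew∈)
           ; (suc i) → O.resp (solve 3 (λ d e x → e :* (d :* x) := d :* e :* x) refl d e (w (suc i)))
                         (O.*-closed e∈ (dw∈ i)) }

    dot-scaled : ∀ {n} {d e} (u v : Vector Carrier n) → ¬ d ≈ 0# → ¬ e ≈ 0# →
                 dot (λ i → d * u i) (λ i → e * v i) ≈ 0# ⇔ dot u v ≈ 0#
    dot-scaled {d = d} {e} u v d≉0 e≉0 = mk⇔
      (λ eq → cancel (nonzero-* d≉0 e≉0) (trans (sym scaled) eq))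
      (λ eq → trans scaled (trans (*-congˡ eq) (zeroʳ (d * e))))
      where
      scaled : dot (λ i → d * u i) (λ i → e * v i) ≈ d * e * dot u v
      scaled = begin
        dot (λ i → d * u i) (λ i → e * v i)  ≈⟨ dot-* d u (λ i → e * v i) ⟩
        d * dot u (λ i → e * v i)  ≈⟨ *-congˡ (dot-comm u (λ i → e * v i)) ⟩
        d * dot (λ i → e * v i) u  ≈⟨ *-congˡ (trans (dot-* e v u) (*-congˡ (dot-comm v u))) ⟩
        d * (e * dot u v)  ≈⟨ *-assoc d e (dot u v) ⟨
        d * e * dot u v                      ∎

    -- Every vector is multiplied by a denominator of its own, which does not change the vectors
    -- orthogonal to it.
    fraction-dotRegular : DotRegular O → DotRegular Fraction
    fraction-dotRegular reg n = let (k , reg-n) = reg n in k , λ u v u∈ v∈ →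
      let clear-u = λ a → clear-denominators (u∈ a)
          clear-v = λ b → clear-denominators (v∈ b)
      in regular-resp (λ {a} {b} → dot-scaled (u a) (v b) (proj₁ (proj₂ (proj₂ (clear-u a)))) (proj₁ (proj₂ (proj₂ (clear-v b)))))
           (reg-n _ _ (λ a → proj₂ (proj₂ (proj₂ (clear-u a)))) (λ b → proj₂ (proj₂ (proj₂ (clear-v b)))))

  regular-∀ : ∀ {r k n} {E : Fin n → REL I J r} → (∀ l → Regular k (E l)) → Regular (k ℕ.^ n) (λ a b → ∀ l → E l a b)
  regular-∀ {n = zero}  reg = regular-true λ ()
  regular-∀ {n = suc n} reg = regular-resp
    (mk⇔ (λ { (e , es) zero → e ; (e , es) (suc l) → es l }) (λ es → es zero , es ∘ suc))
    (regular-∩ (reg zero) (regular-∀ (reg ∘ suc)))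

  flatten : ∀ {n q} → (Fin n → Vector Carrier q) → Vector Carrier (n ℕ.* q)
  flatten {zero}  f = []
  flatten {suc n} f = f zero ++ flatten (f ∘ suc)

  flatten-closed : ∀ {p} {P : Pred Carrier p} {n q} {f : Fin n → Vector Carrier q} →
                   (∀ l i → P (f l i)) → ∀ i → P (flatten f i)
  flatten-closed {P = P} {n = suc n} {q} {f} f∈ i with splitAt q i
  ... | inj₁ k = f∈ zero k
  ... | inj₂ k = flatten-closed {P = P} {f = f ∘ suc} (f∈ ∘ suc) k

  dot-flatten : ∀ {n q} (f g : Fin n → Vector Carrier q) → dot (flatten f) (flatten g) ≈ sum (λ l → dot (f l) (g l))
  dot-flatten {zero}      f g = refl
  dot-flatten {suc n} {q} f g = trans (sum-split +-monoid q _) (+-cong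
    (sum-cong-≋ λ i → reflexive (≡.cong₂ _*_ (lookup-++ˡ (f zero) (flatten (f ∘ suc)) i)
                                            (lookup-++ˡ (g zero) (flatten (g ∘ suc)) i)))
    (trans (sum-cong-≋ λ i → reflexive (≡.cong₂ _*_ (lookup-++ʳ (f zero) (flatten (f ∘ suc)) i)
                                                   (lookup-++ʳ (g zero) (flatten (g ∘ suc)) i)))
           (dot-flatten (f ∘ suc) (g ∘ suc))))

  module _ {F : Pred Carrier (c ⊔ ℓ)} (F-isSubfield : IsSubfield F) (t : Carrier) where
    private module F = IsSubfield F-isSubfield
    open Polynomials F.isSubring t
    private module O = IsSubring adjoined-isSubring

    Algebraic : Set (c ⊔ ℓ)
    Algebraic = ∃[ q ] Poly q (t ^ q)

    powers : ∀ q → Vector Carrier q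
    powers zero    = []
    powers (suc q) = t ^ q ∷ powers q

    powers-poly : ∀ {q} {a : Vector Carrier q} → (∀ k → F (a k)) → Poly q (dot a (powers q))
    powers-poly {zero}  a∈ = nil refl
    powers-poly {suc q} a∈ = add-leading F.isSubring t (a∈ zero) (powers-poly (a∈ ∘ suc))

    coordinates : ∀ {q x} → Poly q x → ∃[ a ] (∀ k → F (a k)) × x ≈ dot a (powers q)
    coordinates {zero}  (nil x≈0) = [] , (λ ()) , x≈0
    coordinates {suc q} x∈ with leading-coefficient F.isSubring t x∈
    ... | a , leading a∈ y∈ x≈ with coordinates y∈
    ...   | b , b∈ , y≈ = a ∷ b , (λ { zero → a∈ ; (suc k) → b∈ k }) , trans x≈ (+-congˡ y≈)

    module _ {q} (t^q∈ : Poly q (t ^ q)) (minimal : ∀ {m} → m ℕ.< q → ¬ Poly m (t ^ m)) where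

      -- A relation with nonzero leading coefficient could be solved for t ^ m with m < q, against
      -- the minimality of q; once that coefficient vanishes, a shorter relation remains.
      powers-independent : ∀ {m} (a : Vector Carrier m) → m ℕ.≤ q → (∀ k → F (a k)) →
                    dot a (powers m) ≈ 0# → ∀ k → a k ≈ 0#
      powers-independent {suc m} a m<q a∈ eq = all
        where
        rest = dot (tail a) (powers m)
        a₀≈0 : a zero ≈ 0#
        a₀≈0 = decidable-stable em λ a₀≉0 →
          let (b , b∈ , ba₀≈1) = F.reciprocal (a∈ zero) a₀≉0
          in minimal m<q (poly-resp
            (sym (x-y≈0⇒x≈y (begin
              t ^ m - (- b) * rest  ≈⟨ solve 3 (λ s b r → s :- (:- b) :* r := s :+ b :* r) refl (t ^ m) b rest ⟩
              t ^ m + b * rest  ≈⟨ +-congʳ (trans (*-congʳ ba₀≈1) (*-identityˡ _)) ⟨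
              b * a zero * t ^ m + b * rest      ≈⟨ solve 4 (λ b a s r → b :* a :* s :+ b :* r := b :* (a :* s :+ r)) refl b (a zero) (t ^ m) rest ⟩
              b * (a zero * t ^ m + rest)  ≈⟨ trans (*-congˡ eq) (zeroʳ b) ⟩
              0#                                 ∎)))
            (poly-scale (F.neg-closed b∈) (powers-poly (a∈ ∘ suc))))
        all : ∀ k → a k ≈ 0#
        all zero    = a₀≈0
        all (suc k) = powers-independent (tail a) (ℕ.<⇒≤ m<q) (a∈ ∘ suc) (begin
          rest  ≈⟨ +-identityˡ rest ⟨
          0# + rest  ≈⟨ +-congʳ (trans (*-congʳ a₀≈0) (zeroˡ (t ^ m))) ⟨
          a zero * t ^ m + rest   ≈⟨ eq ⟩
          0#                      ∎) k

      reduce-shift : ∀ {n} → Poly n (t ^ n) → ∀ {x} → Poly n x → Poly n (t * x)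
      reduce-shift {zero}  _    (nil x≈0) = nil (trans (*-congˡ x≈0) (zeroʳ t))
      reduce-shift {suc n} t^n∈ {x} x∈ with leading-coefficient F.isSubring t x∈
      ... | a , leading {y} a∈ y∈ x≈ = poly-resp
        (sym (trans (*-congˡ x≈) (solve 4 (λ t a s y → t :* (a :* s :+ y) := a :* (t :* s) :+ t :* y) refl t a (t ^ n) y)))
        (poly-+ (poly-scale a∈ t^n∈) (poly-shift y∈))

      0<q : 0 ℕ.< q
      0<q = positive t^q∈
        where
        positive : ∀ {n} → Poly n (t ^ n) → 0 ℕ.< n
        positive (nil 1≈0)    = contradiction 1≈0 1≉0
        positive (cons _ _ _) = s≤s z≤n

      reduce : ∀ {x} → Adjoined x → Poly q x
      reduce (zero  , nil x≈0)       = poly-resp (sym x≈0) (poly-zero q)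
      reduce (suc m , cons a∈ y∈ x≈) = poly-resp (sym x≈)
        (poly-+ (poly-weaken 0<q (poly-constant a∈)) (reduce-shift t^q∈ (reduce (m , y∈))))

      powers-adjoined : ∀ k → Adjoined (powers q k)
      powers-adjoined k = q , poly-resp (dot-δ k (powers q)) (powers-poly (F.δ-closed k))

      -- Let s_i be the powers of t below q. Expanding u_l in the s_i, and each v_l s_i in the s_k,
      -- gives the dot product the form Σ_k D_k s_k, where D_k is a dot product over F of vectors
      -- with n * q entries. By independence it vanishes exactly if all q of the D_k do, and this is
      -- an intersection of q regular relations.
      minimal-dotRegular : DotRegular F → DotRegular Adjoined
      minimal-dotRegular reg n = let (k , reg-nq) = reg (n ℕ.* q) in k ℕ.^ q , λ u v u∈ v∈ →
        let U = λ a l → proj₁ (coordinates (reduce (u∈ a l)))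
            U∈ = λ a l → proj₁ (proj₂ (coordinates (reduce (u∈ a l))))
            V′ = λ b l i → coordinates (reduce (O.*-closed (v∈ b l) (powers-adjoined i)))
            V = λ b k l i → proj₁ (V′ b l i) k
            D = λ k a b → dot (flatten (U a)) (flatten (V b k))
            expand : ∀ a b → dot (u a) (v b) ≈ sum (λ k → D k a b * powers q k)
            expand a b = begin
              sum (λ l → u a l * v b l)
                ≈⟨ sum-cong-≋ (λ l → expand-term (U a l) (V′ b l) (proj₂ (proj₂ (coordinates (reduce (u∈ a l)))))) ⟩
              sum (λ l → sum (λ k → dot (U a l) (V b k l) * powers q k))
                ≈⟨ ∑-comm (λ l k → dot (U a l) (V b k l) * powers q k) ⟩
              sum (λ k → sum (λ l → dot (U a l) (V b k l) * powers q k))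
                ≈⟨ sum-cong-≋ (λ k → trans (*-congʳ (dot-flatten (U a) (V b k)))
                     (*-distribʳ-sum (powers q k) (λ l → dot (U a l) (V b k l)))) ⟨
              sum (λ k → D k a b * powers q k) ∎
        in regular-resp (λ {a} {b} → mk⇔
             (λ eqs → trans (expand a b) (dot-zeroˡ eqs))
             (λ eq → powers-independent (λ k → D k a b) ℕ.≤-refl
                (λ k → F.dot-closed (flatten-closed {P = F} (U∈ a)) (flatten-closed {P = F} (λ l i → proj₁ (proj₂ (V′ b l i)) k)))
                (trans (sym (expand a b)) eq)))
           (regular-∀ {E = D′ D} (λ k → reg-nq (λ a → flatten (U a)) (λ b → flatten (V b k))
             (λ a → flatten-closed {P = F} (U∈ a)) (λ b → flatten-closed {P = F} (λ l i → proj₁ (proj₂ (V′ b l i)) k))))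
        where
        D′ : (Fin q → I → J → Carrier) → Fin q → REL I J ℓ
        D′ D k a b = D k a b ≈ 0#
        expand-term : ∀ {x y} (a : Vector Carrier q)
          (w : ∀ i → ∃[ b ] (∀ k → F (b k)) × y * powers q i ≈ dot b (powers q)) → x ≈ dot a (powers q) →
          x * y ≈ sum (λ k → dot a (λ i → proj₁ (w i) k) * powers q k)
        expand-term {x} {y} a w x≈ = begin
          x * y  ≈⟨ *-congʳ x≈ ⟩
          sum (λ i → a i * powers q i) * y  ≈⟨ *-distribʳ-sum y (λ i → a i * powers q i) ⟩
          sum (λ i → a i * powers q i * y)  ≈⟨ sum-cong-≋ (λ i → trans
            (solve 3 (λ a s y → a :* s :* y := a :* (y :* s)) refl (a i) (powers q i) y)
            (trans (*-congˡ (proj₂ (proj₂ (w i)))) (*-distribˡ-sum (a i) (λ k → proj₁ (w i) k * powers q k)))) ⟩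
          sum (λ i → sum (λ k → a i * (proj₁ (w i) k * powers q k)))
            ≈⟨ ∑-comm (λ i k → a i * (proj₁ (w i) k * powers q k)) ⟩
          sum (λ k → sum (λ i → a i * (proj₁ (w i) k * powers q k)))
            ≈⟨ sum-cong-≋ (λ k → trans (sum-cong-≋ (λ i → sym (*-assoc (a i) (proj₁ (w i) k) (powers q k))))
                                     (sym (*-distribʳ-sum (powers q k) (λ i → a i * proj₁ (w i) k)))) ⟩
          sum (λ k → dot a (λ i → proj₁ (w i) k) * powers q k)  ∎

    algebraic-dotRegular : Algebraic → DotRegular F → DotRegular Adjoined
    algebraic-dotRegular algebraic = let (_ , t^q∈ , minimal) = least algebraic in minimal-dotRegular t^q∈ minimal

-- Linear independence over a subfield, and vectors of polynomials

module LinearIndependence (em : ∀ {a : Level} → ExcludedMiddle a) {c ℓ : Level} (R : CommutativeRing c ℓ)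
  (R-isField : Adjunction.IsField R) {i j : Level} (I : Set i) (J : Set j) where

  open CommutativeRing R hiding (zero)
  open Adjunction.IsField R-isField
  open import Data.Fin.Base using (Fin; zero; suc)
  open import Data.List.Base using (List; []; _∷_; length; map; _++_; allFin)
  open import Data.List.Properties using (length-++; length-map; length-tabulate)
  open import Data.List.Relation.Unary.All as All using (All; []; _∷_)
  import Data.List.Relation.Unary.All.Properties as All
  open import Data.List.Relation.Unary.AllPairs using ([]; _∷_)
  open import Data.List.Relation.Unary.Unique.Propositional using (Unique)
  open import Data.List.Relation.Unary.Unique.Propositional.Properties using (allFin⁺)
  open import Data.Nat.Base as ℕ using (ℕ; zero; suc; z≤n; s≤s)
  import Data.Nat.Properties as ℕ
  open import Data.Vec.Functional using (Vector)
  open import Relation.Binary.PropositionalEquality.Core as ≡ using (_≡_)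
  open import Relation.Unary using (_⊆_)
  open Adjunction R
  open FieldExtensions em R R-isField I J

  module _ {F : Pred Carrier (c ⊔ ℓ)} (F-isSubfield : IsSubfield F) where
    private module F = IsSubfield F-isSubfield

    module _ {n : ℕ} where

      data Span : List (Vector Carrier n) → Vector Carrier n → Set (c ⊔ ℓ) where
        nil  : ∀ {x} → (∀ k → x k ≈ 0#) → Span [] x
        cons : ∀ {v vs x a y} → F a → Span vs y → (∀ k → x k ≈ a * v k + y k) → Span (v ∷ vs) x

      data Independent : List (Vector Carrier n) → Set (c ⊔ ℓ) where
        []  : Independent []
        _∷_ : ∀ {v vs} → ¬ Span vs v → Independent vs → Independent (v ∷ vs)

      span-resp : ∀ {vs x y} → (∀ k → x k ≈ y k) → Span vs x → Span vs y
      span-resp x≈y (nil x≈0)        = nil λ k → trans (sym (x≈y k)) (x≈0 k)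
      span-resp x≈y (cons a∈ y∈ x≈a+) = cons a∈ y∈ λ k → trans (sym (x≈y k)) (x≈a+ k)

      span-combine : ∀ {vs a x y} → F a → Span vs x → Span vs y → Span vs (λ k → a * x k + y k)
      span-combine {a = a} a∈ (nil x≈0) (nil y≈0) =
        nil λ k → trans (+-cong (trans (*-congˡ (x≈0 k)) (zeroʳ a)) (y≈0 k)) (+-identityʳ 0#)
      span-combine {a = a} a∈ (cons {v} {a = b} {y = x} b∈ x∈ x≈) (cons {a = d} {y = y} d∈ y∈ y≈) =
        cons (F.+-closed (F.*-closed a∈ b∈) d∈) (span-combine a∈ x∈ y∈) λ k →
          trans (+-cong (*-congˡ (x≈ k)) (y≈ k))
            (solve 6 (λ a b d v x y → a :* (b :* v :+ x) :+ (d :* v :+ y) := (a :* b :+ d) :* v :+ (a :* x :+ y))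
              refl a b d (v k) (x k) (y k))

      span-zero : ∀ vs → Span vs (λ _ → 0#)
      span-zero []       = nil λ _ → refl
      span-zero (v ∷ vs) = cons F.0∈ (span-zero vs) λ k → sym (trans (+-identityʳ _) (zeroˡ (v k)))

      span-weaken : ∀ {v vs} → Span vs ⊆ Span (v ∷ vs)
      span-weaken {v} x∈ = cons F.0∈ x∈ λ k → sym (trans (+-congʳ (zeroˡ (v k))) (+-identityˡ _))

      span-head : ∀ {v vs} → Span (v ∷ vs) v
      span-head {v} {vs} = cons F.1∈ (span-zero vs) λ k → sym (trans (+-identityʳ _) (*-identityˡ (v k)))

      record IsSubspace {p} (P : Pred (Vector Carrier n) p) : Set (c ⊔ ℓ ⊔ p) where
        field
          resp    : ∀ {x y} → (∀ k → x k ≈ y k) → P x → P y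
          0∈      : P (λ _ → 0#)
          combine : ∀ {a x y} → F a → P x → P y → P (λ k → a * x k + y k)

      span-minimal : ∀ {p} {P : Pred (Vector Carrier n) p} → IsSubspace P → ∀ {vs} → All P vs → Span vs ⊆ P
      span-minimal P-isSubspace []         (nil x≈0)      = IsSubspace.resp P-isSubspace (λ k → sym (x≈0 k)) (IsSubspace.0∈ P-isSubspace)
      span-minimal P-isSubspace (v∈ ∷ vs∈) (cons a∈ y∈ x≈) = IsSubspace.resp P-isSubspace (λ k → sym (x≈ k))
        (IsSubspace.combine P-isSubspace a∈ v∈ (span-minimal P-isSubspace vs∈ y∈))

      record Shifted {p} (W : Pred (Vector Carrier n) p) (v : Vector Carrier n) (vs : List (Vector Carrier n))
                     : Set (c ⊔ ℓ ⊔ p) where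
        field
          shifts       : List (Vector Carrier n)
          members      : All W shifts
          independent  : Independent shifts
          unshift      : ∀ {x} → Span shifts x → ∃[ a ] F a × Span vs (λ k → x k + a * v k)
          same-length  : length shifts ≡ length vs

      -- If y + a v lay in the span of the other shifts, then y + (a + b) v would lie in the span of
      -- vs for some b. For a + b = 0 this contradicts the independence of y; otherwise v itself
      -- would lie in the span of y and vs.
      shift-by : ∀ {p} {W : Pred (Vector Carrier n) p} {v vs} →
        All (λ y → ∃[ a ] F a × W (λ k → y k + a * v k)) vs → Independent vs → ¬ Span vs v → Shifted W v vs
      shift-by [] [] v∉ = record
        { shifts = [] ; members = [] ; independent = []
        ; unshift = λ { {x} (nil x≈0) → 0# , F.0∈ , nil λ k → trans (+-cong (x≈0 k) (zeroˡ _)) (+-identityʳ 0#) }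
        ; same-length = ≡.refl
        }
      shift-by {W = W} {v} {y ∷ vs} ((a , a∈ , w) ∷ ws) (y∉ ∷ ind) v∉ = record
        { shifts = _ ∷ S.shifts ; members = w ∷ S.members ; independent = new ∷ S.independent
        ; unshift = λ { {x} (cons {a = r} {y = z} r∈ z∈ x≈) → let (b , b∈ , z+∈) = S.unshift z∈ in
            b - r * a , F.minus-closed b∈ (F.*-closed r∈ a∈) , cons r∈ z+∈ λ k → trans (+-congʳ (x≈ k))
              (solve 6 (λ r a b y v z → r :* (y :+ a :* v) :+ z :+ (b :- r :* a) :* v := r :* y :+ (z :+ b :* v))
                refl r a b (y k) (v k) (z k)) }
        ; same-length = ≡.cong suc S.same-length
        }
        where
        module S = Shifted (shift-by {W = W} ws ind (v∉ ∘ span-weaken))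
        new : ¬ Span S.shifts (λ k → y k + a * v k)
        new d∈ with S.unshift d∈
        ... | b , b∈ , s∈ with em {_} {a + b ≈ 0#}
        ...   | yes a+b≈0 = y∉ (span-resp (λ k → trans
                (solve 4 (λ y a b v → y :+ a :* v :+ b :* v := y :+ (a :+ b) :* v) refl (y k) a b (v k))
                (trans (+-congˡ (trans (*-congʳ a+b≈0) (zeroˡ (v k)))) (+-identityʳ (y k)))) s∈)
        ...   | no a+b≉0 =
          let (e , e∈ , e[a+b]≈1) = F.reciprocal (F.+-closed a∈ b∈) a+b≉0
          in v∉ (span-resp (λ k → trans
               (solve 5 (λ e a b y v → (:- e) :* y :+ (e :* (y :+ a :* v :+ b :* v) :+ con (0 , 0)) := e :* (a :+ b) :* v)
                 refl e a b (y k) (v k))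
               (trans (*-congʳ e[a+b]≈1) (*-identityˡ (v k))))
             (span-combine (F.neg-closed e∈) span-head (span-combine e∈ (span-weaken s∈) (span-zero _))))

      -- The first hypothesis says that W has codimension at most one in V.
      eliminate : ∀ {p q} {V : Pred (Vector Carrier n) p} {W : Pred (Vector Carrier n) q} →
        (∀ {x y} → V x → V y → W x ⊎ ∃[ a ] F a × W (λ k → y k + a * x k)) →
        ∀ {vs} → All V vs → Independent vs →
        ∃[ ws ] All W ws × Independent ws × Span ws ⊆ Span vs × length vs ℕ.≤ suc (length ws)
      eliminate codim [] [] = [] , [] , [] , (λ x∈ → x∈) , z≤n
      eliminate {V = V} {W} codim {v ∷ vs} (v∈ ∷ vs∈) (v∉ ∷ ind) with em {_} {W v}
      ... | yes w = let (ws , ws∈ , ind′ , incl , len) = eliminate {W = W} codim vs∈ ind in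
        v ∷ ws , w ∷ ws∈ , (v∉ ∘ incl) ∷ ind′ , (λ { (cons a∈ y∈ x≈) → cons a∈ (incl y∈) x≈ }) , s≤s len
      ... | no ¬w = S.shifts , S.members , S.independent ,
        (λ {x} x∈ → let (a , a∈ , x+∈) = S.unshift x∈ in cons (F.neg-closed a∈) x+∈
          λ k → solve 3 (λ x a v → x := (:- a) :* v :+ (x :+ a :* v)) refl (x k) a (v k)) ,
        s≤s (ℕ.≤-reflexive (≡.sym S.same-length))
        where
        pivot : ∀ {y} → V y → ∃[ a ] F a × W (λ k → y k + a * v k)
        pivot y∈ with codim v∈ y∈
        ... | inj₁ w = contradiction w ¬w
        ... | inj₂ s = s
        module S = Shifted (shift-by {W = W} (All.map pivot vs∈) ind v∉)

      -- Each of the m conditions costs at most one vector. They are imposed one at a time, by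
      -- pivoting inside the space cut out so far; closure of W l under combinations preserves the
      -- conditions imposed before.
      eliminate-all : ∀ {p q m} {V : Pred (Vector Carrier n) p} (W : Fin m → Pred (Vector Carrier n) q) →
        (∀ l {x y} → V x → V y → W l x ⊎ ∃[ a ] F a × V (λ k → y k + a * x k) × W l (λ k → y k + a * x k)) →
        (∀ l {a x y} → F a → W l x → W l y → W l (λ k → y k + a * x k)) →
        ∀ {vs} → All V vs → Independent vs →
        ∃[ ws ] All (λ x → V x × (∀ l → W l x)) ws × Independent ws × Span ws ⊆ Span vs × length vs ℕ.≤ m ℕ.+ length ws
      eliminate-all {m = zero} W codim closed {vs} vs∈ ind =
        vs , All.map (λ v∈ → v∈ , λ ()) vs∈ , ind , id , ℕ.≤-refl
      eliminate-all {m = suc m} {V} W codim closed vs∈ ind =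
        let (ws , ws∈ , ind′ , incl , len) = eliminate-all (W ∘ suc) (codim ∘ suc) (closed ∘ suc) vs∈ ind
            (us , us∈ , ind″ , incl′ , len′) = eliminate {W = λ x → V x × (∀ l → W l x)} step ws∈ ind′
        in us , us∈ , ind″ , incl ∘ incl′ ,
           ℕ.≤-trans len (ℕ.≤-trans (ℕ.+-monoʳ-≤ m len′) (ℕ.≤-reflexive (ℕ.+-suc m (length us))))
        where
        step : ∀ {x y} → V x × (∀ l → W (suc l) x) → V y × (∀ l → W (suc l) y) →
               (V x × (∀ l → W l x)) ⊎ ∃[ a ] F a × V (λ k → y k + a * x k) × (∀ l → W l (λ k → y k + a * x k))
        step (x∈ , wx) (y∈ , wy) with codim zero x∈ y∈
        ... | inj₁ w = inj₁ (x∈ , λ { zero → w ; (suc l) → wx l })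
        ... | inj₂ (a , a∈ , v∈ , w) = inj₂ (a , a∈ , v∈ , λ { zero → w ; (suc l) → closed (suc l) a∈ (wx l) (wy l) })

      record IsLinear (T : Vector Carrier n → Vector Carrier n) : Set (c ⊔ ℓ) where
        field
          cong    : ∀ {x y} → (∀ k → x k ≈ y k) → ∀ k → T x k ≈ T y k
          T-zero  : ∀ k → T (λ _ → 0#) k ≈ 0#
          combine : ∀ a x y k → T (λ k → a * x k + y k) k ≈ a * T x k + T y k

      record Preimages {p} (P : Pred (Vector Carrier n) p) (T : Vector Carrier n → Vector Carrier n)
                       (vs : List (Vector Carrier n)) : Set (c ⊔ ℓ ⊔ p) where
        field
          preimages   : List (Vector Carrier n)
          members     : All P preimages
          span-image  : ∀ {y} → Span preimages y → Span vs (T y)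
          independent : Independent vs → Independent preimages
          same-length : length preimages ≡ length vs

      -- T carries a linear relation between the preimages to one between the given vectors, so
      -- independence passes back.
      pull-back : ∀ {p} {P : Pred (Vector Carrier n) p} {T} → IsLinear T → ∀ {vs} →
                  All (λ x → ∃[ y ] P y × (∀ k → x k ≈ T y k)) vs → Preimages P T vs
      pull-back T-isLinear [] = record
        { preimages = [] ; members = [] ; independent = id ; same-length = ≡.refl
        ; span-image = λ { (nil y≈0) → nil λ k → trans (IsLinear.cong T-isLinear y≈0 k) (IsLinear.T-zero T-isLinear k) }
        }
      pull-back {P = P} {T} T-isLinear {v ∷ vs} ((w , w∈ , v≈Tw) ∷ rest) = record
        { preimages   = w ∷ Q.preimages
        ; members     = w∈ ∷ Q.members
        ; span-image  = λ { (cons {a = a} {y = y} a∈ y∈ x≈) → cons a∈ (Q.span-image y∈) λ k →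
            trans (IsLinear.cong T-isLinear x≈ k) (trans (IsLinear.combine T-isLinear a w y k)
              (+-congʳ (*-congˡ (sym (v≈Tw k))))) }
        ; independent = λ { (v∉ ∷ ind) →
            (λ w∈ → v∉ (span-resp (λ k → sym (v≈Tw k)) (Q.span-image w∈))) ∷ Q.independent ind }
        ; same-length = ≡.cong suc Q.same-length
        }
        where module Q = Preimages (pull-back {P = P} {T} T-isLinear rest)

    module _ (t : Carrier) where
      open Polynomials F.isSubring t
      private module O = IsSubring adjoined-isSubring

      Multiple : Pred Carrier (c ⊔ ℓ)
      Multiple x = ∃[ y ] Adjoined y × x ≈ t * y

      multiple-combine : ∀ {a x y} → Adjoined a → Multiple x → Multiple y → Multiple (a * x + y)
      multiple-combine {a} a∈ (x , x∈ , x≈) (y , y∈ , y≈) = a * x + y , O.+-closed (O.*-closed a∈ x∈) y∈ ,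
        trans (+-cong (*-congˡ x≈) y≈) (solve 4 (λ a t x y → a :* (t :* x) :+ t :* y := t :* (a :* x :+ y)) refl a t x y)

      multiple-zero : Multiple 0#
      multiple-zero = 0# , O.0∈ , sym (zeroʳ t)

      -- Equivalent to transcendence over F: in a polynomial relation the constant coefficient is a
      -- multiple of t, hence 0, and then t can be cancelled.
      record Transcendental : Set (c ⊔ ℓ) where
        field
          nonzero         : ¬ t ≈ 0#
          constant-unique : ∀ {a} → F a → Multiple a → a ≈ 0#

      -- The vectors t^j e_l with j < m. For transcendental t they form an F-basis of the vectors
      -- with entries of degree below m.
      monomials : ∀ {n} → ℕ → List (Vector Carrier n)
      monomials {n} zero    = []
      monomials {n} (suc m) = map δ (allFin n) ++ map (λ x k → t * x k) (monomials m)

      length-monomials : ∀ n m → length (monomials {n} m) ≡ m ℕ.* n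
      length-monomials n zero    = ≡.refl
      length-monomials n (suc m) = ≡.trans (length-++ (map δ (allFin n))) (≡.cong₂ ℕ._+_
        (≡.trans (length-map δ (allFin n)) (length-tabulate id))
        (≡.trans (length-map _ (monomials m)) (length-monomials n m)))

      monomials-poly : ∀ {n} m → All (λ x → ∀ k → Poly m (x k)) (monomials {n} m)
      monomials-poly zero    = []
      monomials-poly (suc m) = All.++⁺
        (All.map⁺ (All.universal (λ l k → poly-weaken (s≤s z≤n) (poly-constant (F.δ-closed l k))) _))
        (All.map⁺ (All.map (λ x∈ k → poly-shift (x∈ k)) (monomials-poly m)))

      span-poly : ∀ {n m} {x : Vector Carrier n} → Span (monomials m) x → ∀ k → Poly m (x k)
      span-poly {n} {m} = span-minimal (record
        { resp    = λ x≈y x∈ k → poly-resp (x≈y k) (x∈ k)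
        ; 0∈      = λ k → poly-zero m
        ; combine = λ a∈ x∈ y∈ k → poly-+ (poly-scale a∈ (x∈ k)) (y∈ k)
        }) (monomials-poly m)

      module _ (transcendental : Transcendental) where
        open Transcendental transcendental

        -- In coordinate l all the other vectors are multiples of t, while δ l has the entry 1,
        -- which is not such a multiple.
        δ-independent : ∀ {n} {ls : List (Fin n)} {vs} → Unique ls → All (λ x → ∀ k → Multiple (x k)) vs →
                        Independent vs → Independent (map δ ls ++ vs)
        δ-independent [] vs∈ ind = ind
        δ-independent {n} {l ∷ ls} {vs} (l∉ ∷ unique) vs∈ ind = new ∷ δ-independent unique vs∈ ind
          where
          new : ¬ Span (map δ ls ++ vs) (δ l)
          new δ∈ = 1≉0 (trans (sym (δ-diagonal l)) (constant-unique (F.δ-closed l l)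
            (span-minimal {P = λ x → Multiple (x l)} (record
              { resp    = λ x≈y (z , z∈ , x≈) → z , z∈ , trans (sym (x≈y l)) x≈
              ; 0∈      = multiple-zero
              ; combine = multiple-combine ∘ base-adjoined
              }) (All.++⁺ (All.map⁺ (All.map (λ l≢k → 0# , O.0∈ , trans (δ-off (l≢k ∘ ≡.sym)) (sym (zeroʳ t))) l∉))
                        (All.map (λ x∈ → x∈ l) vs∈)) δ∈)))

        scale-independent : ∀ {n} {vs : List (Vector Carrier n)} → Independent vs → Independent (map (λ x k → t * x k) vs)
        scale-independent [] = []
        scale-independent {n} (v∉ ∷ ind) = (λ tv∈ → let (y , y∈ , eq) = unscale tv∈ in
          v∉ (span-resp (λ k → *-cancelˡ nonzero (sym (eq k))) y∈)) ∷ scale-independent ind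
          where
          unscale : ∀ {vs : List (Vector Carrier n)} {x} → Span (map (λ x k → t * x k) vs) x →
                    ∃[ y ] Span vs y × (∀ k → x k ≈ t * y k)
          unscale {[]}     (nil x≈0) = (λ _ → 0#) , nil (λ _ → refl) , λ k → trans (x≈0 k) (sym (zeroʳ t))
          unscale {v ∷ vs} (cons {a = a} a∈ y∈ x≈) = let (z , z∈ , y≈) = unscale y∈ in
            (λ k → a * v k + z k) , cons a∈ z∈ (λ _ → refl) , λ k → trans (x≈ k) (trans (+-congˡ (y≈ k))
              (solve 4 (λ a t v z → a :* (t :* v) :+ t :* z := t :* (a :* v :+ z)) refl a t (v k) (z k)))

        monomials-independent : ∀ {n} m → Independent (monomials {n} m)
        monomials-independent zero        = []
        monomials-independent {n} (suc m) = δ-independent (allFin⁺ n)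
          (All.map⁺ (All.map (λ {x} x∈ k → x k , (m , x∈ k) , refl) (monomials-poly m)))
          (scale-independent (monomials-independent m))

-- Changing the lattice along a hyperplane modulo t

module LatticeReduction (em : ∀ {a : Level} → ExcludedMiddle a) {c ℓ : Level} (R : CommutativeRing c ℓ)
  (R-isField : Adjunction.IsField R) {i j : Level} (I : Set i) (J : Set j) where

  open CommutativeRing R hiding (zero)
  open Adjunction.IsField R-isField
  open import Data.Bool.Base using (Bool; T; not)
  open import Data.Fin.Base using (Fin; zero; suc; punchIn; punchOut)
  open import Data.Fin.Properties using (_≟_; punchIn-punchOut)
  open import Data.List.Base using (List; []; _∷_; length)
  open import Data.List.Relation.Unary.All as All using (All; []; _∷_)
  open import Data.Nat.Base as ℕ using (ℕ; zero; suc; s≤s)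
  import Data.Nat.Properties as ℕ
  open import Data.Vec.Functional using (Vector)
  open import Relation.Binary.PropositionalEquality.Core as ≡ using (_≡_)
  open import Relation.Unary using (_⊆_)
  open import Relation.Binary.Reasoning.Setoid setoid
  open import Algebra.Properties.Semiring.Exp semiring using (_^_; ^-homo-*)
  open Regularity
  open Regularity.Classical em
  open Adjunction R
  open FieldExtensions em R R-isField I J
  open LinearIndependence em R R-isField I J

  dot-linearˡ : ∀ {n} a b (x y z : Vector Carrier n) → dot (λ k → a * x k + b * y k) z ≈ a * dot x z + b * dot y z
  dot-linearˡ a b x y z = trans (dot-+ (λ k → a * x k) (λ k → b * y k) z) (+-cong (dot-* a x z) (dot-* b y z))

  dot-linearʳ : ∀ {n} a b (x y z : Vector Carrier n) → dot z (λ k → a * x k + b * y k) ≈ a * dot z x + b * dot z y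
  dot-linearʳ a b x y z = trans (dot-comm z _) (trans (dot-linearˡ a b x y z)
    (+-cong (*-congˡ (dot-comm x z)) (*-congˡ (dot-comm y z))))

  nonzero-entry : ∀ {n} {x : Vector Carrier n} → ¬ (∀ k → x k ≈ 0#) → ∃[ k ] ¬ x k ≈ 0#
  nonzero-entry x≉0 = decidable-stable em λ none → x≉0 λ k → decidable-stable em λ xk≉0 → none (k , xk≉0)

  module Lattices {F : Pred Carrier (c ⊔ ℓ)} (F-isSubfield : IsSubfield F) (t : Carrier)
                  (transcendental : Transcendental F-isSubfield t) where
    private module F = IsSubfield F-isSubfield
    open Polynomials F.isSubring t
    private
      module O = IsSubring adjoined-isSubring
      M : Pred Carrier (c ⊔ ℓ)
      M = Multiple F-isSubfield t
    open Transcendental transcendental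

    power-nonzero : ∀ k → ¬ t ^ k ≈ 0#
    power-nonzero zero    = 1≉0
    power-nonzero (suc k) = nonzero-* nonzero (power-nonzero k)

    -- The constant coefficient is divisible by t and so vanishes; then one factor t cancels on both
    -- sides, and m rounds use up all coefficients. This is how high divisibility becomes
    -- orthogonality.
    divisible-zero : ∀ {m n x z} → Poly m x → m ℕ.≤ n → Adjoined z → x ≈ t ^ n * z → x ≈ 0#
    divisible-zero (nil x≈0) _ _ _ = x≈0
    divisible-zero {suc m} {suc n} {x} {z} (cons {a = a} {y = y} a∈ y∈ x≈) (s≤s m≤n) z∈ x≈tz = begin
      x  ≈⟨ x≈ ⟩
      a + t * y  ≈⟨ +-cong a≈0 (trans (*-congˡ (divisible-zero y∈ m≤n z∈ y≈)) (zeroʳ t)) ⟩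
      0# + 0#    ≈⟨ +-identityʳ 0# ⟩
      0#         ∎
      where
      w = t ^ n * z
      power-adjoined : ∀ n → Adjoined (t ^ n)
      power-adjoined zero    = O.1∈
      power-adjoined (suc n) = O.*-closed t-adjoined (power-adjoined n)
      eq : a + t * y ≈ t * w
      eq = trans (sym x≈) (trans x≈tz (*-assoc t (t ^ n) z))
      a≈0 : a ≈ 0#
      a≈0 = constant-unique a∈ (w - y , O.minus-closed (O.*-closed (power-adjoined n) z∈) (m , y∈) ,
        trans (solve 3 (λ a t y → a := (a :+ t :* y) :- t :* y) refl a t y) (trans (+-congʳ eq)
          (solve 3 (λ t w y → t :* w :- t :* y := t :* (w :- y)) refl t w y)))
      y≈ : y ≈ w
      y≈ = *-cancelˡ nonzero (trans (sym (trans (+-congʳ a≈0) (+-identityˡ _))) eq)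

    module Step {n} (p : Fin n) (h : Vector Carrier n) (h∈ : ∀ k → F (h k)) (hp≈1 : h p ≈ 1#) where

      -- The correction t * δ p gives κ p = 1 - t, whence T preserves the pivot coordinate. So T is
      -- injective, and its image on integral vectors consists of the integral x for which all x k -
      -- h k * x p are divisible by t.
      κ : Vector Carrier n
      κ k = h k - t * δ p k

      -- x ↦ T x maps the lattice O^n onto the vectors that are proportional to h modulo t.
      T⟦_⟧ Tᵗ⟦_⟧ : Vector Carrier n → Vector Carrier n
      T⟦ x ⟧ k  = t * x k + x p * κ k
      Tᵗ⟦ x ⟧ k = t * x k + dot κ x * δ p k

      adjoint : ∀ x y → dot T⟦ x ⟧ y ≈ dot x Tᵗ⟦ y ⟧
      adjoint x y = begin
        dot T⟦ x ⟧ y  ≈⟨ dot-linearˡ t (x p) x κ y ⟩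
        t * dot x y + x p * dot κ y  ≈⟨ +-congˡ (*-comm _ _) ⟩
        t * dot x y + dot κ y * x p  ≈⟨ +-congˡ (*-congˡ (trans (dot-comm x (δ p)) (dot-δ p x))) ⟨
        t * dot x y + dot κ y * dot x (δ p)  ≈⟨ dot-linearʳ t (dot κ y) y (δ p) x ⟨
        dot x Tᵗ⟦ y ⟧                             ∎

      dot-κ : ∀ x → dot κ x ≈ dot h x - t * x p
      dot-κ x = begin
        dot κ x  ≈⟨ dot-cong {v = x} (λ k → solve 3 (λ h t d → h :- t :* d := con (1 , 0) :* h :+ (:- t) :* d)
                                                 refl (h k) t (δ p k)) (λ _ → refl) ⟩
        dot (λ k → 1# * h k + - t * δ p k) x ≈⟨ dot-linearˡ 1# (- t) h (δ p) x ⟩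
        1# * dot h x + - t * dot (δ p) x    ≈⟨ +-congˡ (*-congˡ (dot-δ p x)) ⟩
        1# * dot h x + - t * x p  ≈⟨ solve 3 (λ h t x → con (1 , 0) :* h :+ (:- t) :* x := h :- t :* x) refl (dot h x) t (x p) ⟩
        dot h x - t * x p                   ∎

      κp≈1-t : κ p ≈ 1# - t
      κp≈1-t = +-cong hp≈1 (-‿cong (trans (*-congˡ (δ-diagonal p)) (*-identityʳ t)))

      T-pivot : ∀ x → T⟦ x ⟧ p ≈ x p
      T-pivot x = trans (+-congˡ (*-congˡ κp≈1-t))
        (solve 2 (λ t x → t :* x :+ x :* (con (1 , 0) :- t) := x) refl t (x p))

      T-isLinear : IsLinear F-isSubfield T⟦_⟧
      T-isLinear = record
        { cong    = λ x≈y k → +-cong (*-congˡ (x≈y k)) (*-congʳ (x≈y p))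
        ; T-zero  = λ k → solve 2 (λ t κ → t :* con (0 , 0) :+ con (0 , 0) :* κ := con (0 , 0)) refl t (κ k)
        ; combine = λ a x y k → solve 7 (λ a t κ x y xp yp →
            t :* (a :* x :+ y) :+ (a :* xp :+ yp) :* κ := a :* (t :* x :+ xp :* κ) :+ (t :* y :+ yp :* κ))
            refl a t (κ k) (x k) (y k) (x p) (y p)
        }

      T-injective : ∀ {x} → (∀ k → T⟦ x ⟧ k ≈ 0#) → ∀ k → x k ≈ 0#
      T-injective {x} Tx≈0 k = cancel nonzero (trans (sym (+-identityʳ _))
        (trans (+-congˡ (sym (trans (*-congʳ xp≈0) (zeroˡ (κ k))))) (Tx≈0 k)))
        where
        xp≈0 : x p ≈ 0#
        xp≈0 = trans (sym (T-pivot x)) (Tx≈0 p)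

      T-preimage : ∀ {x : Vector Carrier n} → (∀ k → Adjoined (x k)) → (∀ k → M (x k - h k * x p)) →
                   ∃[ y ] (∀ k → Adjoined (y k)) × (∀ k → x k ≈ T⟦ y ⟧ k)
      T-preimage {x} x∈ proportional = y , (λ k → O.+-closed (w∈ k) (O.*-closed (x∈ p) (O.δ-closed p k))) , x≈Ty
        where
        w  = λ k → proj₁ (proportional k)
        w∈ = λ k → proj₁ (proj₂ (proportional k))
        w≈ : ∀ k → x k - h k * x p ≈ t * w k
        w≈ = λ k → proj₂ (proj₂ (proportional k))
        y : Vector Carrier n
        y k = w k + x p * δ p k
        wp≈0 : w p ≈ 0#
        wp≈0 = cancel nonzero (trans (sym (w≈ p)) (trans (+-congˡ (-‿cong (trans (*-congʳ hp≈1) (*-identityˡ (x p)))))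
          (-‿inverseʳ (x p))))
        yp≈xp : y p ≈ x p
        yp≈xp = trans (+-cong wp≈0 (trans (*-congˡ (δ-diagonal p)) (*-identityʳ (x p)))) (+-identityˡ (x p))
        x≈Ty : ∀ k → x k ≈ T⟦ y ⟧ k
        x≈Ty k = begin
          x k  ≈⟨ solve 3 (λ x h xp → x := (x :- h :* xp) :+ h :* xp) refl (x k) (h k) (x p) ⟩
          (x k - h k * x p) + h k * x p  ≈⟨ +-congʳ (w≈ k) ⟩
          t * w k + h k * x p  ≈⟨ solve 5 (λ t w h xp d →
              t :* w :+ h :* xp := t :* (w :+ xp :* d) :+ xp :* (h :- t :* d)) refl t (w k) (h k) (x p) (δ p k) ⟩
          t * y k + x p * κ k  ≈⟨ +-congˡ (*-congʳ yp≈xp) ⟨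
          T⟦ y ⟧ k                                                ∎

      outside : Vector Carrier n → Bool
      outside x = not (decide (M (dot h x)))

      -- Modulo t the transpose Tᵗ sends x to (h · x) δ p. If t divides h · x, then `image` is Tᵗ x
      -- divided by t, otherwise it is Tᵗ x itself. The exponent `indicator (outside x)` puts both
      -- cases into one equation.
      record Pushed (x : Vector Carrier n) : Set (c ⊔ ℓ) where
        field
          image    : Vector Carrier n
          integral : ∀ k → Adjoined (image k)
          relation : ∀ k → t ^ indicator (outside x) * Tᵗ⟦ x ⟧ k ≈ t * image k

        dot-relation : ∀ y → t ^ indicator (outside x) * dot y Tᵗ⟦ x ⟧ ≈ t * dot y image
        dot-relation y = begin
          s * dot y Tᵗ⟦ x ⟧  ≈⟨ *-congˡ (dot-comm y _) ⟩
          s * dot Tᵗ⟦ x ⟧ y  ≈⟨ dot-* s Tᵗ⟦ x ⟧ y ⟨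
          dot (λ k → s * Tᵗ⟦ x ⟧ k) y     ≈⟨ dot-cong {v = y} relation (λ _ → refl) ⟩
          dot (λ k → t * image k) y  ≈⟨ dot-* t image y ⟩
          t * dot image y  ≈⟨ *-congˡ (dot-comm image y) ⟩
          t * dot y image                 ∎
          where s = t ^ indicator (outside x)

      F⊆O : F ⊆ Adjoined
      F⊆O = base-adjoined

      κ-integral : ∀ k → Adjoined (κ k)
      κ-integral k = O.minus-closed (F⊆O (h∈ k)) (O.*-closed t-adjoined (O.δ-closed p k))

      push : ∀ {x : Vector Carrier n} → (∀ k → Adjoined (x k)) → Pushed x
      push {x} x∈ with em {_} {M (dot h x)} in decision
      ... | yes (z , z∈ , hx≈tz) = record
        -- With h · x = t z one has κ · x = t (z - x p), so this is Tᵗ x divided by t.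
        { image    = λ k → x k + (z - x p) * δ p k
        ; integral = λ k → O.+-closed (x∈ k) (O.*-closed (O.minus-closed z∈ (x∈ p)) (O.δ-closed p k))
        ; relation = λ k → trans (*-congʳ (reflexive exponent)) (trans (*-identityˡ _) (begin
            t * x k + dot κ x * δ p k  ≈⟨ +-congˡ (*-congʳ (trans (dot-κ x) (+-congʳ hx≈tz))) ⟩
            t * x k + (t * z - t * x p) * δ p k    ≈⟨ solve 5 (λ t x z xp d →
                t :* x :+ (t :* z :- t :* xp) :* d := t :* (x :+ (z :- xp) :* d)) refl t (x k) z (x p) (δ p k) ⟩
            t * (x k + (z - x p) * δ p k)          ∎))
        }
        where
        exponent : t ^ indicator (outside x) ≡ 1#
        exponent rewrite decision = ≡.refl
      ... | no _ = record
        { image    = Tᵗ⟦ x ⟧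
        ; integral = λ k → O.+-closed (O.*-closed t-adjoined (x∈ k))
                             (O.*-closed (O.dot-closed κ-integral x∈) (O.δ-closed p k))
        ; relation = λ k → *-congʳ (trans (reflexive exponent) (*-identityʳ t))
        }
        where
        exponent : t ^ indicator (outside x) ≡ t * 1#
        exponent rewrite decision = ≡.refl

      -- t times the inverse of T. The factor t keeps the vectors integral and does not affect
      -- orthogonality.
      T⁻¹⟦_⟧ : Vector Carrier n → Vector Carrier n
      T⁻¹⟦ y ⟧ k = y k - y p * κ k

      T-inverse : ∀ y k → T⟦ T⁻¹⟦ y ⟧ ⟧ k ≈ t * y k
      T-inverse y k = begin
        t * (y k - y p * κ k) + (y p - y p * κ p) * κ k  ≈⟨ +-congˡ (*-congʳ (+-congˡ (-‿cong (*-congˡ κp≈1-t)))) ⟩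
        t * (y k - y p * κ k) + (y p - y p * (1# - t)) * κ k  ≈⟨ solve 4 (λ t y yp κ →
            t :* (y :- yp :* κ) :+ (yp :- yp :* (con (1 , 0) :- t)) :* κ := t :* y) refl t (y k) (y p) (κ k) ⟩
        t * y k                                               ∎

      T⁻¹-integral : ∀ {y : Vector Carrier n} → (∀ k → Adjoined (y k)) → ∀ k → Adjoined (T⁻¹⟦ y ⟧ k)
      T⁻¹-integral y∈ k = O.minus-closed (y∈ k) (O.*-closed (y∈ p) (κ-integral k))

      push-dot : ∀ {x y} (x↦ : Pushed x) → dot (Pushed.image x↦) T⁻¹⟦ y ⟧ ≈ 0# ⇔ dot x y ≈ 0#
      push-dot {x} {y} x↦ = mk⇔
        (λ eq → cancel nonzero (cancel (power-nonzero (indicator (outside x)))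
          (trans (sym scaled) (trans (*-congˡ eq) (zeroʳ t)))))
        (λ eq → cancel nonzero (trans scaled (trans (*-congˡ (trans (*-congˡ eq) (zeroʳ t))) (zeroʳ s))))
        where
        open Pushed x↦
        s = t ^ indicator (outside x)
        scaled : t * dot image T⁻¹⟦ y ⟧ ≈ s * (t * dot x y)
        scaled = begin
          t * dot image T⁻¹⟦ y ⟧  ≈⟨ *-congˡ (dot-comm image _) ⟩
          t * dot T⁻¹⟦ y ⟧ image  ≈⟨ dot-relation T⁻¹⟦ y ⟧ ⟨
          s * dot T⁻¹⟦ y ⟧ Tᵗ⟦ x ⟧  ≈⟨ *-congˡ (adjoint T⁻¹⟦ y ⟧ x) ⟨
          s * dot T⟦ T⁻¹⟦ y ⟧ ⟧ x  ≈⟨ *-congˡ (trans (dot-cong {v = x} (T-inverse y) (λ _ → refl)) (dot-* t y x)) ⟩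
          s * (t * dot y x)  ≈⟨ *-congˡ (*-congˡ (dot-comm y x)) ⟩
          s * (t * dot x y)                ∎

      -- Compared with y on the image of x, the functional T y gains a factor t on a vector x inside
      -- the hyperplane. Outside there is no gain, and e grows by one to account for it.
      push-divisible : ∀ {x y k e z} (x↦ : Pushed x) → t ^ e * dot y (Pushed.image x↦) ≈ t ^ k * z →
                       t ^ (indicator (outside x) ℕ.+ e) * dot T⟦ y ⟧ x ≈ t ^ suc k * z
      push-divisible {x} {y} {k} {e} {z} x↦ eq = begin
        t ^ (o ℕ.+ e) * dot T⟦ y ⟧ x  ≈⟨ *-cong (^-homo-* t o e) (adjoint y x) ⟩
        t ^ o * t ^ e * dot y Tᵗ⟦ x ⟧  ≈⟨ solve 3 (λ a b d → a :* b :* d := b :* (a :* d)) refl (t ^ o) (t ^ e) (dot y Tᵗ⟦ x ⟧) ⟩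
        t ^ e * (t ^ o * dot y Tᵗ⟦ x ⟧)  ≈⟨ *-congˡ (dot-relation y) ⟩
        t ^ e * (t * dot y image)  ≈⟨ solve 3 (λ a t d → a :* (t :* d) := t :* (a :* d)) refl (t ^ e) t (dot y image) ⟩
        t * (t ^ e * dot y image)  ≈⟨ *-congˡ eq ⟩
        t * (t ^ k * z)  ≈⟨ *-assoc t (t ^ k) z ⟨
        t * t ^ k * z                         ∎
        where
        open Pushed x↦
        o = indicator (outside x)

    Integral : ∀ {n} → Pred (Vector Carrier n) (c ⊔ ℓ)
    Integral x = ∀ k → Adjoined (x k)

    integral-combine : ∀ {n a} {x y : Vector Carrier n} → F a → Integral x → Integral y → Integral (λ k → x k + a * y k)
    integral-combine a∈ x∈ y∈ k = O.+-closed (x∈ k) (O.*-closed (base-adjoined a∈) (y∈ k))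

    module _ {n : ℕ} where

      -- k is the number of steps made, so that t^(k - e a) divides the pairing of witness with u a.
      record Escape (δ₀ : ℕ) (xs : List I) (u : I → Vector Carrier (suc n)) (k : ℕ) (vs : List (Vector Carrier (suc n)))
                    : Set (c ⊔ ℓ ⊔ i) where
        field
          witness         : Vector Carrier (suc n)
          in-span         : Span F-isSubfield vs witness
          witness-nonzero : ¬ (∀ l → witness l ≈ 0#)
          e               : I → ℕ
          divisible       : ∀ a → ∃[ z ] Adjoined z × t ^ e a * dot witness (u a) ≈ t ^ k * z
          e-small         : δ₀ ℕ.* total e xs ℕ.≤ k ℕ.* length xs

      Concentrated : ℕ → List I → (I → Vector Carrier (suc n)) → Set _
      Concentrated δ₀ xs u = ∃[ p ] ∃[ h ] ∃[ h∈ ] ∃[ hp≈1 ]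
        δ₀ ℕ.* count (λ a → Step.outside {suc n} p h h∈ hp≈1 (u a)) xs ℕ.≤ length xs

      Outcome : ℕ → ℕ → List I → List J → (I → Vector Carrier (suc n)) → (J → Vector Carrier (suc n)) → ℕ → Set _
      Outcome δ₀ C xs ys u v k = HomogeneousRectangle C (λ a b → dot (u a) (v b) ≈ 0#) xs ys ⊎
        (∀ {vs} → All Integral vs → Independent F-isSubfield vs → n ℕ.* k ℕ.< length vs → Escape δ₀ xs u k vs)

      -- Induction on the number k of steps. The lists xs and ys stay the same throughout, so C does
      -- not depend on k. A step imposes n congruences modulo t on the candidate functionals, each
      -- of codimension at most one over F; therefore more than n * k independent candidates leave a
      -- nonzero witness.
      escape : ∀ {δ₀ xs ys u v C} →
        (∀ {u : I → Vector Carrier (suc n)} {v : J → Vector Carrier (suc n)} → (∀ a → Integral (u a)) → (∀ b → Integral (v b)) →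
          ¬ Concentrated δ₀ xs u → HomogeneousRectangle C (λ a b → dot (u a) (v b) ≈ 0#) xs ys) →
        ∀ k → (∀ a → Integral (u a)) → (∀ b → Integral (v b)) → Outcome δ₀ C xs ys u v k
      escape {δ₀} {xs} {u = u} spread zero u∈ v∈ = inj₂ initial
        where
        initial : ∀ {vs} → All Integral vs → Independent F-isSubfield vs → n ℕ.* 0 ℕ.< length vs → Escape δ₀ xs u 0 vs
        initial {[]}     _        _         lt = contradiction lt λ ()
        initial {v ∷ vs} (v∈ ∷ _) (v∉ ∷ _) _  = record
          { witness         = v
          ; in-span         = span-head F-isSubfield
          ; witness-nonzero = λ v≈0 → v∉ (span-resp F-isSubfield (λ k → sym (v≈0 k)) (span-zero F-isSubfield vs))
          ; e               = const 0
          ; divisible       = λ a → dot v (u a) , O.dot-closed v∈ (u∈ a) , refl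
          ; e-small         = ℕ.≤-reflexive (≡.trans (≡.cong (δ₀ ℕ.*_) (total-zero xs)) (ℕ.*-zeroʳ δ₀))
          }
      escape {δ₀} {xs} {ys} {u} {v} {C} spread (suc k) u∈ v∈ with em {_} {Concentrated δ₀ xs u}
      ... | no ¬concentrated = inj₁ (spread u∈ v∈ ¬concentrated)
      ... | yes (p , h , h∈ , hp≈1 , few) = step (escape {u = u′} {v′} spread k (λ a → Pushed.integral (push (u∈ a))) (λ b → T⁻¹-integral {v b} (v∈ b)))
        where
        open Step p h h∈ hp≈1
        u′ : I → Vector Carrier (suc n)
        u′ a = Pushed.image (push (u∈ a))
        v′ : J → Vector Carrier (suc n)
        v′ b = T⁻¹⟦ v b ⟧
        q : Fin n → Fin (suc n)
        q = punchIn p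
        -- The congruences that put x into the image of T. There are n of them for n + 1
        -- coordinates, as the one at p holds by h p = 1.
        W : Fin n → Pred (Vector Carrier (suc n)) (c ⊔ ℓ)
        W l x = M (x (q l) - h (q l) * x p)
        φ-combine : ∀ l a (x y : Vector Carrier (suc n)) →
          a * (x (q l) - h (q l) * x p) + (y (q l) - h (q l) * y p) ≈
          (y (q l) + a * x (q l)) - h (q l) * (y p + a * x p)
        φ-combine l a x y = solve 6 (λ a x h xp y yp → a :* (x :- h :* xp) :+ (y :- h :* yp) :=
          (y :+ a :* x) :- h :* (yp :+ a :* xp)) refl a (x (q l)) (h (q l)) (x p) (y (q l)) (y p)
        φ-integral : ∀ l {x} → Integral x → Adjoined (x (q l) - h (q l) * x p)
        φ-integral l x∈ = O.minus-closed (x∈ (q l)) (O.*-closed (base-adjoined (h∈ (q l))) (x∈ p))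
        M-resp : ∀ {x y} → x ≈ y → M x → M y
        M-resp x≈y (z , z∈ , x≈) = z , z∈ , trans (sym x≈y) x≈
        W-closed : ∀ l {a x y} → F a → W l x → W l y → W l (λ k → y k + a * x k)
        W-closed l {a} {x} {y} a∈ x∈ y∈ = M-resp (φ-combine l a x y) (multiple-combine F-isSubfield t (base-adjoined a∈) x∈ y∈)
        -- The residues a and b of the two values lie in the field F, so subtracting b / a times x
        -- from y removes the residue b.
        codim : ∀ l {x y} → Integral x → Integral y →
                W l x ⊎ ∃[ a ] F a × Integral (λ k → y k + a * x k) × W l (λ k → y k + a * x k)
        codim l {x} {y} x∈ y∈ with split-constant (φ-integral l x∈) | split-constant (φ-integral l y∈)
        ... | a , x′ , a∈ , x′∈ , x≈ | b , y′ , b∈ , y′∈ , y≈ with em {_} {a ≈ 0#}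
        ...   | yes a≈0 = inj₁ (x′ , x′∈ , trans x≈ (trans (+-congʳ a≈0) (+-identityˡ _)))
        ...   | no a≉0  =
          let (r , r∈ , ra≈1) = F.reciprocal a∈ a≉0
              s∈ = F.neg-closed (F.*-closed b∈ r∈)
          in inj₂ (- (b * r) , s∈ , integral-combine s∈ y∈ x∈ ,
               M-resp (φ-combine l (- (b * r)) x y)
                 (- (b * r) * x′ + y′ , O.+-closed (O.*-closed (base-adjoined s∈) x′∈) y′∈ , (begin
                   - (b * r) * (x (q l) - h (q l) * x p) + (y (q l) - h (q l) * y p)
                     ≈⟨ +-cong (*-congˡ x≈) y≈ ⟩
                   - (b * r) * (a + t * x′) + (b + t * y′)
                     ≈⟨ solve 6 (λ a b r t x y → (:- (b :* r)) :* (a :+ t :* x) :+ (b :+ t :* y) :=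
                          b :* (con (1 , 0) :- r :* a) :+ t :* ((:- (b :* r)) :* x :+ y)) refl a b r t x′ y′ ⟩
                   b * (1# - r * a) + t * (- (b * r) * x′ + y′)
                     ≈⟨ +-congʳ (trans (*-congˡ (trans (+-congˡ (-‿cong ra≈1)) (-‿inverseʳ 1#))) (zeroʳ b)) ⟩
                   0# + t * (- (b * r) * x′ + y′)
                     ≈⟨ +-identityˡ _ ⟩
                   t * (- (b * r) * x′ + y′) ∎)))
        lift : ∀ {x} → Integral x × (∀ l → W l x) → ∃[ y ] Integral y × (∀ k → x k ≈ T⟦ y ⟧ k)
        lift {x} (x∈ , ws) = T-preimage {x} x∈ proportional
          where
          proportional : ∀ k → M (x k - h k * x p)
          proportional k with p ≟ k
          ... | yes ≡.refl = M-resp (sym (trans (+-congˡ (-‿cong (trans (*-congʳ hp≈1) (*-identityˡ (x p)))))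
                                     (-‿inverseʳ (x p)))) (multiple-zero F-isSubfield t)
          ... | no p≢k = ≡.subst (λ k → M (x k - h k * x p)) (punchIn-punchOut p≢k) (ws (punchOut p≢k))
        step : Outcome δ₀ C xs ys u′ v′ k → Outcome δ₀ C xs ys u v (suc k)
        step (inj₁ rect) = inj₁ (rectangle-resp (λ {a} {b} → push-dot {u a} {v b} (push (u∈ a))) rect)
        -- The remaining k steps are applied to T-preimages of the surviving candidates. Applying T
        -- to their witness returns it to the span of the original vs, which is what bounds its
        -- degree in the end.
        step (inj₂ esc) = inj₂ λ {vs} vs∈ ind lt →
          let (ws , ws∈ , ind′ , incl , len) = eliminate-all F-isSubfield W codim W-closed vs∈ ind
              module Q = Preimages (pull-back F-isSubfield {P = Integral} T-isLinear (All.map lift ws∈))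
              module E = Escape (esc Q.members (Q.independent ind′)
                (ℕ.+-cancelˡ-< n _ _ (ℕ.<-≤-trans (≡.subst (ℕ._< length vs) (ℕ.*-suc n k) lt)
                  (ℕ.≤-trans len (ℕ.≤-reflexive (≡.cong (n ℕ.+_) (≡.sym Q.same-length)))))))
          in record
            { witness         = T⟦ E.witness ⟧
            ; in-span         = incl (Q.span-image E.in-span)
            ; witness-nonzero = λ eq → E.witness-nonzero (T-injective eq)
            ; e               = λ a → indicator (outside (u a)) ℕ.+ E.e a
            ; divisible       = λ a → let (z , z∈ , eq) = E.divisible a in z , z∈ , push-divisible {u a} {E.witness} {k} {E.e a} (push (u∈ a)) eq
            ; e-small         = ℕ.≤-trans
                (ℕ.≤-reflexive (≡.trans (≡.cong (δ₀ ℕ.*_) (total-count (λ a → outside (u a)) E.e xs)) (ℕ.*-distribˡ-+ δ₀ _ _)))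
                (ℕ.+-mono-≤ few E.e-small)
            }

-- Dot products over F [ t ] for transcendental t

module TranscendentalExtensions (em : ∀ {a : Level} → ExcludedMiddle a) {c ℓ : Level} (R : CommutativeRing c ℓ)
  (R-isField : Adjunction.IsField R) {i j : Level} (I : Set i) (J : Set j) where

  open CommutativeRing R hiding (zero)
  open Adjunction.IsField R-isField
  open import Data.Bool.Base using (Bool; true; T; not; _∧_)
  open import Data.Bool.Properties using (T-∧)
  open import Data.Fin.Base using (Fin; zero; suc; punchIn)
  open import Data.List.Base using (List; []; _∷_; length; filterᵇ)
  open import Data.List.Relation.Unary.All as All using (All; []; _∷_)
  open import Data.List.Relation.Unary.All.Properties using (all-filter)
  open import Data.Nat.Base as ℕ using (ℕ; zero; suc; z≤n; s≤s)
  import Data.Nat.Properties as ℕ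
  import Data.Nat.Tactic.RingSolver as ℕ-Solver
  open import Data.Vec.Functional using (Vector; removeAt)
  open import Relation.Binary.PropositionalEquality.Core as ≡ using (_≡_)
  open import Relation.Binary.Reasoning.Setoid setoid
  open import Algebra.Properties.Semiring.Exp semiring using (_^_; ^-homo-*)
  open Regularity
  open Regularity.Classical em
  open Adjunction R
  open FieldExtensions em R R-isField I J
  open LinearIndependence em R R-isField I J

  open LatticeReduction em R R-isField I J

  -- The fuel k = N·2D and the degree bound m = n·2D + 1 of the monomials, with N = n + 1, satisfy
  -- n·k < m·N, while t^(k ∸ e) exceeds the degree of a pairing as soon as e < D.
  module Parameters (n : ℕ) where
    private
      fuel-arithmetic : ∀ D → n ℕ.* (suc n ℕ.* (2 ℕ.* D)) ℕ.< suc (n ℕ.* (2 ℕ.* D)) ℕ.* suc n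
      fuel-arithmetic D = ℕ.<-≤-trans (ℕ.m<m+n _ (s≤s z≤n)) (ℕ.≤-reflexive (arithmetic n (2 ℕ.* D)))
        where
        arithmetic : ∀ n q → n ℕ.* (suc n ℕ.* q) ℕ.+ suc n ≡ suc (n ℕ.* q) ℕ.* suc n
        arithmetic = ℕ-Solver.solve-∀

      degree-arithmetic : ∀ {D e} → e ℕ.< D → e ℕ.+ (suc (n ℕ.* (2 ℕ.* D)) ℕ.+ D) ℕ.≤ suc n ℕ.* (2 ℕ.* D)
      degree-arithmetic {D} {e} e<D = ℕ.≤-trans (ℕ.≤-reflexive (shuffle e n D))
        (ℕ.≤-trans (ℕ.+-monoˡ-≤ _ e<D) (ℕ.≤-reflexive (collect n D)))
        where
        shuffle : ∀ e n d → e ℕ.+ (suc (n ℕ.* (2 ℕ.* d)) ℕ.+ d) ≡ suc e ℕ.+ (n ℕ.* (2 ℕ.* d) ℕ.+ d)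
        shuffle = ℕ-Solver.solve-∀
        collect : ∀ n d → d ℕ.+ (n ℕ.* (2 ℕ.* d) ℕ.+ d) ≡ suc n ℕ.* (2 ℕ.* d)
        collect = ℕ-Solver.solve-∀

      -- Here s is the total of e over l points, and b of them have e ≥ D. Threshold 4N and fuel
      -- N·2D give s ≤ D l / 2, so D b ≤ s leaves at most half of the points.
      half-arithmetic : ∀ {D₀ b s l} → suc D₀ ℕ.* b ℕ.≤ s → 4 ℕ.* suc n ℕ.* s ℕ.≤ suc n ℕ.* (2 ℕ.* suc D₀) ℕ.* l → 2 ℕ.* b ℕ.≤ l
      half-arithmetic {D₀} {b} db≤s le = ℕ.*-cancelˡ-≤ (suc n ℕ.* (2 ℕ.* suc D₀))
        (ℕ.≤-trans (ℕ.≤-reflexive (rearrange (suc n) (suc D₀) b)) (ℕ.≤-trans (ℕ.*-monoʳ-≤ (4 ℕ.* suc n) db≤s) le))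
        where
        rearrange : ∀ N D b → N ℕ.* (2 ℕ.* D) ℕ.* (2 ℕ.* b) ≡ 4 ℕ.* N ℕ.* (D ℕ.* b)
        rearrange = ℕ-Solver.solve-∀

    abstract
      threshold : ℕ
      threshold = 4 ℕ.* suc n

      fuel bound : ℕ → ℕ
      fuel D  = suc n ℕ.* (2 ℕ.* D)
      bound D = suc (n ℕ.* (2 ℕ.* D))

      fuel-bound : ∀ D → n ℕ.* fuel D ℕ.< bound D ℕ.* suc n
      fuel-bound = fuel-arithmetic

      degree-bound : ∀ {D e} → e ℕ.< D → e ℕ.+ (bound D ℕ.+ D) ℕ.≤ fuel D
      degree-bound {D} {e} = degree-arithmetic {D} {e}

      half-bound : ∀ {D₀ b s l} → suc D₀ ℕ.* b ℕ.≤ s → threshold ℕ.* s ℕ.≤ fuel (suc D₀) ℕ.* l → 2 ℕ.* b ℕ.≤ l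
      half-bound {D₀} {b} {s} {l} = half-arithmetic {D₀} {b} {s} {l}

  module _ {F : Pred Carrier (c ⊔ ℓ)} (F-isSubfield : IsSubfield F) (t : Carrier)
           (transcendental : Transcendental F-isSubfield t) where
    private module F = IsSubfield F-isSubfield
    open Polynomials F.isSubring t
    private
      module O = IsSubring adjoined-isSubring
      M : Pred Carrier (c ⊔ ℓ)
      M = Multiple F-isSubfield t
    open Transcendental transcendental
    open Lattices F-isSubfield t transcendental

    uniform-degree : ∀ {n} {x : Vector Carrier n} → Integral x → ∃[ m ] (∀ k → Poly m (x k))
    uniform-degree {zero}  x∈ = 0 , λ ()
    uniform-degree {suc n} x∈ =
      let (m , x₀∈) = x∈ zero ; (m′ , x′∈) = uniform-degree (x∈ ∘ suc)
      in m ℕ.⊔ m′ , λ { zero    → poly-weaken (ℕ.m≤m⊔n m m′) x₀∈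
                      ; (suc k) → poly-weaken (ℕ.m≤n⊔m m m′) (x′∈ k) }

    -- The bound depends on xs, so it may enter the number of steps but no constant of a rectangle.
    -- It is made positive because the averaging argument divides by it.
    uniform-degrees : ∀ {n} {u : I → Vector Carrier n} → (∀ a → Integral (u a)) → ∀ xs →
                      ∃[ m ] All (λ a → ∀ k → Poly (suc m) (u a k)) xs
    uniform-degrees u∈ []       = 0 , []
    uniform-degrees u∈ (a ∷ xs) =
      let (m , a∈) = uniform-degree (u∈ a) ; (m′ , xs∈) = uniform-degrees u∈ xs
      in m ℕ.⊔ m′ , (λ k → poly-weaken (ℕ.m≤n⇒m≤1+n (ℕ.m≤m⊔n m m′)) (a∈ k)) ∷
                    All.map (λ x∈ k → poly-weaken (s≤s (ℕ.m≤n⊔m m m′)) (x∈ k)) xs∈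

    record Residue {n} (x : Vector Carrier n) : Set (c ⊔ ℓ) where
      field
        residue quotient  : Vector Carrier n
        residue∈          : ∀ k → F (residue k)
        quotient∈         : Integral quotient
        decompose         : ∀ k → x k ≈ residue k + t * quotient k

    residue-of : ∀ {n} {x : Vector Carrier n} → Integral x → Residue x
    residue-of x∈ = record
      { residue   = λ k → proj₁ (split-constant (x∈ k))
      ; quotient  = λ k → proj₁ (proj₂ (split-constant (x∈ k)))
      ; residue∈  = λ k → proj₁ (proj₂ (proj₂ (split-constant (x∈ k))))
      ; quotient∈ = λ k → proj₁ (proj₂ (proj₂ (proj₂ (split-constant (x∈ k)))))
      ; decompose = λ k → proj₂ (proj₂ (proj₂ (proj₂ (split-constant (x∈ k)))))
      }

    residue-dot : ∀ {n} {x : Vector Carrier n} (x↦ : Residue x) {y} → Integral y →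
                  ∃[ z ] Adjoined z × dot x y ≈ dot (Residue.residue x↦) y + t * z
    residue-dot {x = x} x↦ {y} y∈ = dot quotient y , O.dot-closed quotient∈ y∈ , (begin
      dot x y  ≈⟨ dot-cong {v = y} (λ k → trans (decompose k) (+-congʳ (sym (*-identityˡ _)))) (λ _ → refl) ⟩
      dot (λ k → 1# * residue k + t * quotient k) y      ≈⟨ dot-linearˡ 1# t residue quotient y ⟩
      1# * dot residue y + t * dot quotient y  ≈⟨ +-congʳ (*-identityˡ _) ⟩
      dot residue y + t * dot quotient y                 ∎)
      where open Residue x↦

    residues-orthogonal : ∀ {n} {x y : Vector Carrier n} (x↦ : Residue x) (y↦ : Residue y) → Integral y →
                          dot x y ≈ 0# → dot (Residue.residue x↦) (Residue.residue y↦) ≈ 0#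
    residues-orthogonal {x = x} {y} x↦ y↦ y∈ xy≈0 =
      let (z , z∈ , xy≈) = residue-dot x↦ y∈
          (w , w∈ , yx̄≈) = residue-dot y↦ {X.residue} (base-adjoined ∘ X.residue∈)
      in constant-unique (F.dot-closed X.residue∈ Y.residue∈) (- (w + z) , O.neg-closed (O.+-closed w∈ z∈) , (begin
           dot X.residue Y.residue  ≈⟨ dot-comm X.residue Y.residue ⟩
           dot Y.residue X.residue  ≈⟨ solve 4 (λ d t w z → d := (d :+ t :* w) :+ t :* z :+ t :* (:- (w :+ z))) refl (dot Y.residue X.residue) t w z ⟩
           (dot Y.residue X.residue + t * w) + t * z + t * - (w + z) ≈⟨ +-congʳ (+-congʳ yx̄≈) ⟨
           dot y X.residue + t * z + t * - (w + z)  ≈⟨ +-congʳ (+-congʳ (dot-comm y X.residue)) ⟩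
           dot X.residue y + t * z + t * - (w + z)  ≈⟨ +-congʳ xy≈ ⟨
           dot x y + t * - (w + z)  ≈⟨ trans (+-congʳ xy≈0) (+-identityˡ _) ⟩
           t * - (w + z)                                             ∎))
      where
      module X = Residue x↦
      module Y = Residue y↦

    record Primitive {n} (y : Vector Carrier n) : Set (c ⊔ ℓ) where
      field
        vector     : Vector Carrier n
        integral   : Integral vector
        residue    : Residue vector
        residue-nonzero : ¬ (∀ k → y k ≈ 0#) → ¬ (∀ k → Residue.residue residue k ≈ 0#)
        order      : ℕ
        scaled     : ∀ k → y k ≈ t ^ order * vector k

    -- Common factors t are divided out until some entry has a nonzero residue; each division lowers
    -- the degree bound m, so this stops.
    primitive-of : ∀ {n m} {y : Vector Carrier n} → (∀ k → Poly m (y k)) → Primitive y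
    primitive-of {n} {zero} {y} y∈ = record
      { vector    = y
      ; integral  = λ k → 0 , y∈ k
      ; residue   = residue-of λ k → 0 , y∈ k
      ; residue-nonzero = λ y≉0 → contradiction (λ k → zero-poly (y∈ k)) y≉0
      ; order     = 0
      ; scaled    = λ k → sym (*-identityˡ (y k))
      }
      where
      zero-poly : ∀ {x} → Poly 0 x → x ≈ 0#
      zero-poly (nil x≈0) = x≈0
    primitive-of {n} {suc m} {y} y∈ with em {_} {∀ k → Residue.residue (residue-of {x = y} (λ k → suc m , y∈ k)) k ≈ 0#}
    ... | no ¬zero = record
      { vector    = y
      ; integral  = λ k → suc m , y∈ k
      ; residue   = residue-of λ k → suc m , y∈ k
      ; residue-nonzero = λ _ → ¬zero
      ; order     = 0
      ; scaled    = λ k → sym (*-identityˡ (y k))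
      }
    ... | yes zeros = record
      { vector    = P.vector
      ; integral  = P.integral
      ; residue   = P.residue
      ; residue-nonzero = λ y≉0 → P.residue-nonzero λ q≈0 → y≉0 λ k → trans (y≈tq k) (trans (*-congˡ (q≈0 k)) (zeroʳ t))
      ; order     = suc P.order
      ; scaled    = λ k → trans (y≈tq k) (trans (*-congˡ (P.scaled k)) (sym (*-assoc t (t ^ P.order) (P.vector k))))
      }
      where
      Y = residue-of {x = y} (λ k → suc m , y∈ k)
      quotient-poly : ∀ {x} (x∈ : Poly (suc m) x) → Poly m (proj₁ (proj₂ (split-constant (suc m , x∈))))
      quotient-poly (cons _ q∈ _) = q∈
      y≈tq : ∀ k → y k ≈ t * Residue.quotient Y k
      y≈tq k = trans (Residue.decompose Y k) (trans (+-congʳ (zeros k)) (+-identityˡ _))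
      module P = Primitive (primitive-of {y = Residue.quotient Y} (λ k → quotient-poly (y∈ k)))

    module _ (F-dotRegular : DotRegular F) (n δ₀ : ℕ) where
      private
        k₀ = proj₁ (F-dotRegular (suc n))
        k₁ = proj₁ (empty-rectangle {X = I} {Y = J} {r = ℓ} k₀ δ₀)

      spread-constant : ℕ
      spread-constant = suc (suc (2 ℕ.* k₁))

      -- Zero vectors are orthogonal to everything, so if they make up half of ys, the rectangle is
      -- full. Otherwise nonzero v b are replaced by the residues w̄ b of their primitive parts. As
      -- no hyperplane contains nearly all residues of xs, each w̄ b has a proportion 1 / δ₀ of
      -- non-orthogonal partners, and regularity over F yields pairs that are not orthogonal even
      -- modulo t.
      spread-rectangle : ∀ {xs ys} {u : I → Vector Carrier (suc n)} {v : J → Vector Carrier (suc n)} →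
        (∀ a → Integral (u a)) → (∀ b → Integral (v b)) → ¬ Concentrated δ₀ xs u →
        HomogeneousRectangle spread-constant (λ a b → dot (u a) (v b) ≈ 0#) xs ys
      spread-rectangle {xs} {ys} {u} {v} u∈ v∈ ¬concentrated with half-majority (λ b → decide (∀ k → v b k ≈ 0#)) ys
      ... | inj₁ many-zeros = rectangle (const true) (λ b → decide (∀ k → v b k ≈ 0#)) (count-everything (suc (2 ℕ.* k₁)) xs)
        (ℕ.≤-trans many-zeros (ℕ.*-monoˡ-≤ (count (λ b → decide (∀ k → v b k ≈ 0#)) ys) {2} {spread-constant} (s≤s (s≤s z≤n)))) (inj₁ λ {a} _ zero → dot-zeroʳ {u = u a} (decided zero))
      ... | inj₂ few-zeros =
        let (p , q′ , lx , ly , empty) = proj₂ (empty-rectangle k₀ δ₀)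
              (proj₂ (F-dotRegular (suc n)) ū w̄ (λ a → Residue.residue∈ (U a)) (λ b → Residue.residue∈ (V.residue b)))
              xs (filterᵇ q ys) (All.map dense (all-filter (T? ∘ q) ys))
        in rectangle p (λ b → q b ∧ q′ b)
             (ℕ.≤-trans lx (ℕ.*-monoˡ-≤ (count p xs) {k₁} {spread-constant} (ℕ.m≤n⇒m≤o+n 2 (ℕ.m≤n*m k₁ 2))))
             (ℕ.≤-trans (refine-count 2 k₁ q q′ ys few-zeros ly) (ℕ.*-monoˡ-≤ _ {2 ℕ.* k₁} {spread-constant} (ℕ.m≤n+m (2 ℕ.* k₁) 2)))
             (inj₂ λ {a} {b} pa qb uv≈0 → empty pa (proj₂ (Equivalence.to T-∧ qb))
               (residues-orthogonal (U a) (V.residue b) (V.integral b) (cancel (power-nonzero (V.order b)) (begin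
                 t ^ V.order b * dot (u a) (V.vector b)  ≈⟨ *-congˡ (dot-comm (u a) (V.vector b)) ⟩
                 t ^ V.order b * dot (V.vector b) (u a)  ≈⟨ dot-* (t ^ V.order b) (V.vector b) (u a) ⟨
                 dot (λ k → t ^ V.order b * V.vector b k) (u a)     ≈⟨ dot-cong {v = u a} (V.scaled b) (λ _ → refl) ⟨
                 dot (v b) (u a)  ≈⟨ dot-comm (v b) (u a) ⟩
                 dot (u a) (v b)  ≈⟨ uv≈0 ⟩
                 0#                                                 ∎))))
        where
        q : J → Bool
        q b = not (decide (∀ k → v b k ≈ 0#))
        U : ∀ a → Residue (u a)
        U a = residue-of (u∈ a)
        module V b = Primitive (primitive-of {y = v b} (proj₂ (uniform-degree (v∈ b))))
        ū : I → Vector Carrier (suc n)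
        ū a = Residue.residue (U a)
        w̄ : J → Vector Carrier (suc n)
        w̄ b = Residue.residue (V.residue b)
        dense : ∀ {b} → T (q b) → length xs ℕ.≤ δ₀ ℕ.* count (non-edges (λ a b → dot (ū a) (w̄ b) ≈ 0#) b) xs
        dense {b} qb =
          let (p , w̄p≉0) = nonzero-entry (V.residue-nonzero b (undecided qb))
              (r , r∈ , rw̄p≈1) = F.reciprocal (Residue.residue∈ (V.residue b) p) w̄p≉0
              -- Normalised by r to have the entry 1 at p, as `Concentrated` demands of a
              -- hyperplane.
              h = λ k → r * w̄ b k
              h∈ = λ k → F.*-closed r∈ (Residue.residue∈ (V.residue b) k)
          in ℕ.≤-trans (ℕ.≰⇒≥ (λ few → ¬concentrated (p , h , h∈ , rw̄p≈1 , few)))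
               (ℕ.*-monoʳ-≤ δ₀ (count-mono (All.universal (λ a out → decide-false λ ūw̄≈0 →
                 undecided out (multiple a r∈ ūw̄≈0)) xs)))
          where
          multiple : ∀ a {r} → F r → dot (ū a) (w̄ b) ≈ 0# → M (dot (λ k → r * w̄ b k) (u a))
          multiple a {r} r∈ ūw̄≈0 =
            let (z , z∈ , eq) = residue-dot (U a) {w̄ b} (base-adjoined ∘ Residue.residue∈ (V.residue b))
            in r * z , O.*-closed (base-adjoined r∈) z∈ , (begin
                 dot (λ k → r * w̄ b k) (u a)      ≈⟨ dot-* r (w̄ b) (u a) ⟩
                 r * dot (w̄ b) (u a)  ≈⟨ *-congˡ (trans (dot-comm (w̄ b) (u a)) eq) ⟩
                 r * (dot (ū a) (w̄ b) + t * z)    ≈⟨ *-congˡ (trans (+-congʳ ūw̄≈0) (+-identityˡ _)) ⟩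
                 r * (t * z)  ≈⟨ solve 3 (λ r t z → r :* (t :* z) := t :* (r :* z)) refl r t z ⟩
                 t * (r * z)                      ∎)

    module _ {n D k m δ₀} (enough : n ℕ.* k ℕ.< m ℕ.* suc n) (long : ∀ {e} → e ℕ.< D → e ℕ.+ (m ℕ.+ D) ℕ.≤ k)
             (half : ∀ {b s l} → D ℕ.* b ℕ.≤ s → δ₀ ℕ.* s ℕ.≤ k ℕ.* l → 2 ℕ.* b ℕ.≤ l) where

      Orthogonal : List I → (I → Vector Carrier (suc n)) → Set _
      Orthogonal xs u = ∃[ w ] Integral w × ¬ (∀ l → w l ≈ 0#) ×
        length xs ℕ.≤ 2 ℕ.* count (λ a → decide (dot w (u a) ≈ 0#)) xs

      -- If e a < D, the value of the witness at u a has degree below m + D but is divisible by t ^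
      -- (k ∸ e a), hence vanishes. By Markov's inequality this covers at least half of xs.
      escape-orthogonal : ∀ {xs} {u : I → Vector Carrier (suc n)} → All (λ a → ∀ l → Poly D (u a l)) xs →
        Escape δ₀ xs u k (monomials F-isSubfield t m) → Orthogonal xs u
      escape-orthogonal {xs} {u} degrees esc = E.witness , (λ l → m , witness-poly l) , E.witness-nonzero ,
        half-complement orthogonal xs (half (markov D (All.map
          (λ ua∈ not-orthogonal → ℕ.≮⇒≥ λ e<D → undecided not-orthogonal (vanish ua∈ e<D)) degrees)) E.e-small)
        where
        module E = Escape esc
        witness-poly : ∀ l → Poly m (E.witness l)
        witness-poly = span-poly F-isSubfield t E.in-span
        orthogonal : I → Bool
        orthogonal a = decide (dot E.witness (u a) ≈ 0#)
        vanish : ∀ {a} → (∀ l → Poly D (u a l)) → E.e a ℕ.< D → dot E.witness (u a) ≈ 0#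
        vanish {a} ua∈ e<D with E.divisible a
        ... | z , z∈ , eq = divisible-zero (poly-sum λ l → poly-* (witness-poly l) (ua∈ l)) m+D≤r z∈
          (*-cancelˡ (power-nonzero (E.e a)) (begin
            t ^ E.e a * dot E.witness (u a)    ≈⟨ eq ⟩
            t ^ k * z  ≈⟨ *-congʳ (reflexive (≡.cong (t ^_) (≡.sym (ℕ.m+[n∸m]≡n e≤k)))) ⟩
            t ^ (E.e a ℕ.+ r) * z  ≈⟨ *-congʳ (^-homo-* t (E.e a) r) ⟩
            t ^ E.e a * t ^ r * z  ≈⟨ *-assoc _ _ z ⟩
            t ^ E.e a * (t ^ r * z)            ∎))
          where
          r = k ℕ.∸ E.e a
          e≤k : E.e a ℕ.≤ k
          e≤k = ℕ.≤-trans (ℕ.m≤m+n _ _) (long e<D)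
          m+D≤r : m ℕ.+ D ℕ.≤ r
          m+D≤r = ℕ.m+n≤o⇒m≤o∸n (m ℕ.+ D) (ℕ.≤-trans (ℕ.≤-reflexive (ℕ.+-comm (m ℕ.+ D) (E.e a))) (long e<D))

      rectangle-or-orthogonal : ∀ (F-dotRegular : DotRegular F) {u : I → Vector Carrier (suc n)} {v : J → Vector Carrier (suc n)} →
        (∀ a → Integral (u a)) → (∀ b → Integral (v b)) → ∀ xs ys → All (λ a → ∀ l → Poly D (u a l)) xs →
        HomogeneousRectangle (spread-constant F-dotRegular n δ₀) (λ a b → dot (u a) (v b) ≈ 0#) xs ys ⊎ Orthogonal xs u
      rectangle-or-orthogonal F-dotRegular {u} {v} u∈ v∈ xs ys degrees
        with escape {xs = xs} {ys} {u} {v} (spread-rectangle F-dotRegular n δ₀) k u∈ v∈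
      ... | inj₁ rect = inj₁ rect
      ... | inj₂ esc  = inj₂ (escape-orthogonal degrees
        (esc (All.map (λ x∈ l → m , x∈ l) (monomials-poly F-isSubfield t m))
             (monomials-independent F-isSubfield t transcendental m)
             (≡.subst (n ℕ.* k ℕ.<_) (≡.sym (length-monomials F-isSubfield t (suc n) m)) enough)))

    -- C is chosen before u and xs. Their degree D only affects the fuel and the supply of
    -- monomials, whereas `spread-constant` involves the threshold 4 (n + 1) alone.
    concentrate : DotRegular F → ∀ n → ∃[ C ] (∀ {u : I → Vector Carrier (suc n)} {v : J → Vector Carrier (suc n)} →
      (∀ a → Integral (u a)) → (∀ b → Integral (v b)) → ∀ xs ys →
      HomogeneousRectangle C (λ a b → dot (u a) (v b) ≈ 0#) xs ys ⊎
      ∃[ w ] Integral w × ¬ (∀ l → w l ≈ 0#) × length xs ℕ.≤ 2 ℕ.* count (λ a → decide (dot w (u a) ≈ 0#)) xs)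
    concentrate F-dotRegular n = spread-constant F-dotRegular n P.threshold , λ u∈ v∈ xs ys →
      let (D , degrees) = uniform-degrees u∈ xs in
      rectangle-or-orthogonal (P.fuel-bound (suc D)) P.degree-bound P.half-bound F-dotRegular u∈ v∈ xs ys degrees
      where module P = Parameters n

    -- Since w is orthogonal to x, subtracting a multiple of w from w_p y does not change the
    -- pairing with x. The multiple y_p w is chosen to cancel the entry at p.
    drop-coordinate : ∀ {n} (p : Fin (suc n)) {w x : Vector Carrier (suc n)} y → ¬ w p ≈ 0# → dot w x ≈ 0# →
      dot (removeAt x p) (removeAt (λ k → w p * y k - y p * w k) p) ≈ 0# ⇔ dot x y ≈ 0#
    drop-coordinate p {w} {x} y wp≉0 wx≈0 = mk⇔
      (λ eq → cancel wp≉0 (trans (sym same) eq))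
      (λ eq → trans same (trans (*-congˡ eq) (zeroʳ (w p))))
      where
      y′ : Vector Carrier _
      y′ k = w p * y k - y p * w k
      same : dot (removeAt x p) (removeAt y′ p) ≈ w p * dot x y
      same = begin
        dot (removeAt x p) (removeAt y′ p)  ≈⟨ +-identityˡ _ ⟨
        0# + dot (removeAt x p) (removeAt y′ p)  ≈⟨ +-congʳ (trans (*-congˡ (trans (+-congʳ (*-comm (w p) (y p))) (-‿inverseʳ (y p * w p)))) (zeroʳ (x p))) ⟨
        x p * y′ p + dot (removeAt x p) (removeAt y′ p)   ≈⟨ sum-remove {i = p} (λ k → x k * y′ k) ⟨
        dot x y′  ≈⟨ dot-cong {u = x} {v = y′} {λ k → w p * y k + - y p * w k} (λ _ → refl) (λ k → +-congˡ (-‿distribˡ-* (y p) (w k))) ⟩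
        dot x (λ k → w p * y k + - y p * w k)  ≈⟨ dot-linearʳ (w p) (- y p) y w x ⟩
        w p * dot x y + - y p * dot x w  ≈⟨ +-congˡ (trans (*-congˡ (trans (dot-comm x w) wx≈0)) (zeroʳ (- y p))) ⟩
        w p * dot x y + 0#  ≈⟨ +-identityʳ _ ⟩
        w p * dot x y                                     ∎
        where open import Algebra.Properties.Ring ring using (-‿distribˡ-*)

    transcendental-dotRegular : DotRegular F → DotRegular Adjoined
    transcendental-dotRegular F-dotRegular zero    = 1 , λ u v _ _ → regular-true refl
    transcendental-dotRegular F-dotRegular (suc n) = C ℕ.+ 2 ℕ.* k , regular
      where
      k = proj₁ (transcendental-dotRegular F-dotRegular n)
      C = proj₁ (concentrate F-dotRegular n)
      regular : ∀ (u : I → Vector Carrier (suc n)) (v : J → Vector Carrier (suc n)) →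
        (∀ a → Integral (u a)) → (∀ b → Integral (v b)) → Regular (C ℕ.+ 2 ℕ.* k) (λ a b → dot (u a) (v b) ≈ 0#)
      regular u v u∈ v∈ xs ys with proj₂ (concentrate F-dotRegular n) {u} {v} u∈ v∈ xs ys
      ... | inj₁ rect = rectangle-weaken (ℕ.m≤m+n C _) rect
      ... | inj₂ (w , w∈ , w≉0 , many) =
        let (p , wp≉0) = nonzero-entry w≉0
        in rectangle-weaken (ℕ.m≤n+m _ C) (rectangle-refine {c = 2} {k}
          (λ a → decide (dot w (u a) ≈ 0#)) (const true) many (count-everything 1 ys)
          (λ {a} {b} wu≈0 _ → drop-coordinate p {w} {u a} (v b) wp≉0 (decided wu≈0))
          (proj₂ (transcendental-dotRegular F-dotRegular n)
            (λ a → removeAt (u a) p) (λ b → removeAt (λ k → w p * v b k - v b p * w k) p)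
            (λ a k → u∈ a (punchIn p k))
            (λ b k → O.minus-closed (O.*-closed (w∈ p) (v∈ b _)) (O.*-closed (v∈ b p) (w∈ _))) _ _))

-- Finite fields and towers of extensions

module Towers (em : ∀ {a : Level} → ExcludedMiddle a) {c ℓ : Level} (R : CommutativeRing c ℓ)
  (R-isField : Adjunction.IsField R) {i j : Level} (I : Set i) (J : Set j) where

  open CommutativeRing R hiding (zero)
  open Adjunction.IsField R-isField
  open import Data.Bool.Base using (Bool; true; false; T; not; _∧_)
  open import Data.Bool.Properties using (T-∧)
  open import Data.Fin.Base using (Fin; zero; suc)
  open import Data.List.Base using (List; []; _∷_; length; filterᵇ)
  open import Data.List.Relation.Unary.All as All using (All; []; _∷_)
  open import Data.List.Relation.Unary.All.Properties using (all-filter; filter⁺)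
  open import Data.Nat.Base as ℕ using (ℕ; zero; suc; z≤n)
  import Data.Nat.Properties as ℕ
  open import Data.Vec.Functional using (Vector)
  open import Relation.Binary.PropositionalEquality.Core using (_≡_)
  open import Relation.Unary using (_⊆_)
  open import Relation.Binary.Reasoning.Setoid setoid
  open import Algebra.Properties.Semiring.Exp semiring using (_^_)
  open Regularity
  open Regularity.Classical em
  open Adjunction R
  open Noetherian em R using (add-leading)
  open FieldExtensions em R R-isField I J
  open LinearIndependence em R R-isField I J
  open TranscendentalExtensions em R R-isField I J

  -- Either the first class holds half of xs or its complement does. Repeated halving gives the
  -- factor 2 ^ m, which is again independent of xs. The predicate `const false` serves the case
  -- without classes, where xs is empty.
  pigeonhole : ∀ {x y} {X : Set x} {m} (P : Fin m → X → Bool) (Q : (X → Bool) → Set y) → Q (const false) → (∀ k → Q (P k)) →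
               ∀ xs → All (λ x → ∃[ k ] T (P k x)) xs → ∃[ p ] Q p × length xs ℕ.≤ 2 ℕ.^ m ℕ.* count p xs
  pigeonhole {m = zero}  P Q Q-false Q-P []       []              = const false , Q-false , z≤n
  pigeonhole {m = zero}  P Q Q-false Q-P (x ∷ xs) ((() , _) ∷ _)
  pigeonhole {m = suc m} P Q Q-false Q-P xs covered with half-majority (P zero) xs
  ... | inj₁ large = P zero , Q-P zero , ℕ.≤-trans large (ℕ.*-monoˡ-≤ _ (ℕ.m≤m*n 2 (2 ℕ.^ m) ⦃ ℕ.m^n≢0 2 m ⦄))
  ... | inj₂ large =
    let (p , Qp , le) = pigeonhole (P ∘ suc) Q Q-false (Q-P ∘ suc) (filterᵇ (not ∘ P zero) xs)
                          (All.map later (All.zip (all-filter (T? ∘ (not ∘ P zero)) xs , filter⁺ (T? ∘ (not ∘ P zero)) covered)))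
    in p , Qp , ℕ.≤-trans (refine-count 2 (2 ℕ.^ m) (not ∘ P zero) p xs large le)
         (ℕ.*-monoʳ-≤ (2 ℕ.^ suc m) (count-mono (All.universal (λ x → proj₂ ∘ Equivalence.to T-∧) xs)))
    where
    later : ∀ {x} → T (not (P zero x)) × ∃[ k ] T (P k x) → ∃[ k ] T (P (suc k) x)
    later (¬p , zero  , p) = contradiction p (T-not ¬p)
    later (_  , suc k , p) = k , p

  module _ {F : Pred Carrier (c ⊔ ℓ)} {q} (elements : Fin q → Carrier) (enumerates : ∀ {x} → F x → ∃[ k ] x ≈ elements k) where

    constant-on-large : ∀ {y n} {X : Set y} (u : X → Vector Carrier n) → (∀ a k → F (u a k)) → ∀ xs →
      ∃[ p ] (∀ {a b} → T (p a) → T (p b) → ∀ k → u a k ≈ u b k) × length xs ℕ.≤ (2 ℕ.^ q) ℕ.^ n ℕ.* count p xs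
    constant-on-large {n = zero}  u u∈ xs = const true , (λ _ _ ()) , count-everything 0 xs
    constant-on-large {n = suc n} {X} u u∈ xs =
      let (p , p-constant , large) = pigeonhole (λ l a → decide (u a zero ≈ elements l))
            (λ p → ∀ {a b} → T (p a) → T (p b) → u a zero ≈ u b zero) (λ ())
            (λ l ua≈ ub≈ → trans (decided ua≈) (sym (decided ub≈))) xs
            (All.universal (λ a → let (l , eq) = enumerates (u∈ a zero) in l , decide-true eq) xs)
          (p′ , p′-constant , large′) = constant-on-large (λ a k → u a (suc k)) (λ a k → u∈ a (suc k)) (filterᵇ p xs)
      in (λ a → p a ∧ p′ a) ,
         (λ pa pb → λ { zero    → p-constant (proj₁ (Equivalence.to T-∧ pa)) (proj₁ (Equivalence.to T-∧ pb))
                      ; (suc k) → p′-constant (proj₂ (Equivalence.to T-∧ pa)) (proj₂ (Equivalence.to T-∧ pb)) k }) ,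
         refine-count (2 ℕ.^ q) ((2 ℕ.^ q) ℕ.^ n) p p′ xs large large′

    -- On large parts of xs and ys all coordinates are constant, so the dot product takes only one
    -- value there.
    finite-dotRegular : DotRegular F
    finite-dotRegular n = (2 ℕ.^ q) ℕ.^ n , regular
      where
      regular : ∀ (u : I → Vector Carrier n) (v : J → Vector Carrier n) → (∀ a i → F (u a i)) → (∀ b i → F (v b i)) →
                Regular ((2 ℕ.^ q) ℕ.^ n) (λ a b → dot (u a) (v b) ≈ 0#)
      regular u v u∈ v∈ xs ys with constant-on-large u u∈ xs | constant-on-large v v∈ ys
      ... | p , p-constant , lx | p′ , p′-constant , ly = rectangle p p′ lx ly homogeneous
        where
        homogeneous : Homogeneous (λ a b → dot (u a) (v b) ≈ 0#) p p′
        homogeneous with em {_} {∃[ a ] ∃[ b ] T (p a) × T (p′ b) × dot (u a) (v b) ≈ 0#}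
        ... | yes (a , b , pa , p′b , eq) = inj₁ λ px p′y →
          trans (dot-cong (p-constant px pa) (p′-constant p′y p′b)) eq
        ... | no none = inj₂ λ {a} {b} pa p′b eq → none (a , b , pa , p′b , eq)

  record RegularExtension (F : Pred Carrier (c ⊔ ℓ)) : Set (Level.suc (c ⊔ ℓ) ⊔ i ⊔ j) where
    field
      {L}          : Pred Carrier (c ⊔ ℓ)
      isSubfield   : IsSubfield L
      dotRegular   : DotRegular L
      extends      : F ⊆ L

  module _ {F : Pred Carrier (c ⊔ ℓ)} (F-isSubfield : IsSubfield F) where
    private module F = IsSubfield F-isSubfield

    -- If t is invertible in F[t], then reversing the coefficients of its inverse s makes s integral over F.
    inverse-algebraic : ∀ {s t} → t * s ≈ 1# → Polynomials.Adjoined F.isSubring t s → Algebraic F-isSubfield s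
    inverse-algebraic {s} {t} ts≈1 (m , s∈) = m , S.poly-resp
      (trans (*-assoc (s ^ m) t s) (trans (*-congˡ ts≈1) (*-identityʳ (s ^ m)))) (reverse s∈)
      where
      module S = Polynomials F.isSubring s
      module T = Polynomials F.isSubring t
      reverse : ∀ {m x} → T.Poly m x → S.Poly m (s ^ m * t * x)
      reverse (T.nil x≈0) = S.nil (trans (*-congˡ x≈0) (zeroʳ _))
      reverse {suc m} {x} (T.cons {a = a} {y = z} a∈ z∈ x≈) = S.poly-resp (begin
          a * s ^ m + s ^ m * t * z    ≈⟨ solve 4 (λ a t p z → a :* p :+ p :* t :* z := p :* (a :+ t :* z)) refl a t (s ^ m) z ⟩
          s ^ m * (a + t * z)  ≈⟨ *-congˡ x≈ ⟨
          s ^ m * x  ≈⟨ trans (*-congʳ ts≈1) (*-identityˡ _) ⟨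
          t * s * (s ^ m * x)  ≈⟨ solve 4 (λ s t p x → t :* s :* (p :* x) := s :* p :* t :* x) refl s t (s ^ m) x ⟩
          s * s ^ m * t * x            ∎)
        (add-leading F.isSubring s a∈ (reverse z∈))

    -- If a nonzero constant is a multiple of t in F [ t ], then 1 / t lies in F [ t ], and
    -- reversing its coefficients gives a monic relation for 1 / t. Adjoining s = 1 / t and passing
    -- to fractions then yields t as well.
    trichotomy : ∀ t → Algebraic F-isSubfield t ⊎ Transcendental F-isSubfield t ⊎
                 ∃[ s ] t * s ≈ 1# × Algebraic F-isSubfield s
    trichotomy t with em {_} {Algebraic F-isSubfield t}
    ... | yes algebraic = inj₁ algebraic
    ... | no ¬algebraic with em {_} {∃[ a ] F a × Multiple F-isSubfield t a × ¬ a ≈ 0#}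
    ...   | no none = inj₂ (inj₁ record
      { nonzero = λ t≈0 → ¬algebraic (1 , poly-resp (sym (trans (*-identityʳ t) t≈0)) (poly-zero 1))
      ; constant-unique = λ {a} a∈ multiple → decidable-stable em λ a≉0 → none (a , a∈ , multiple , a≉0)
      })
      where open Polynomials F.isSubring t
    ...   | yes (a , a∈ , (y , (m , y∈) , a≈ty) , a≉0) =
      let (b , b∈ , ba≈1) = F.reciprocal a∈ a≉0
          t[by]≈1 = trans (solve 3 (λ b t y → t :* (b :* y) := b :* (t :* y)) refl b t y)
                      (trans (*-congˡ (sym a≈ty)) ba≈1)
      in inj₂ (inj₂ (b * y , t[by]≈1 , inverse-algebraic t[by]≈1 (m , poly-scale b∈ y∈)))
      where open Polynomials F.isSubring t

    module _ (F-dotRegular : DotRegular F) (t : Carrier) where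

      adjoin-with : ∀ s → DotRegular (Polynomials.Adjoined F.isSubring s) →
                    ∃[ E ] (RegularExtension.L {F} E) s
      adjoin-with s reg = record
        { isSubfield = fraction-isSubfield adjoined-isSubring
        ; dotRegular = fraction-dotRegular adjoined-isSubring reg
        ; extends    = subring-fraction adjoined-isSubring ∘ base-adjoined
        } , subring-fraction adjoined-isSubring t-adjoined
        where open Polynomials F.isSubring s

      adjoin : ∃[ E ] (RegularExtension.L {F} E) t
      adjoin with trichotomy t
      ... | inj₁ algebraic = adjoin-with t (algebraic-dotRegular F-isSubfield t algebraic F-dotRegular)
      ... | inj₂ (inj₁ transcendental) = adjoin-with t (transcendental-dotRegular F-isSubfield t transcendental F-dotRegular)
      ... | inj₂ (inj₂ (s , ts≈1 , algebraic)) =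
        let (E , s∈) = adjoin-with s (algebraic-dotRegular F-isSubfield s algebraic F-dotRegular)
        in E , IsSubfield.inv-closed (RegularExtension.isSubfield E) ts≈1 s∈

  adjoin-all : ∀ {F : Pred Carrier (c ⊔ ℓ)} → IsSubfield F → DotRegular F → ∀ {k} (g : Vector Carrier k) →
               ∃[ E ] (∀ l → RegularExtension.L {F} E (g l))
  adjoin-all F-isSubfield F-dotRegular {zero}  g =
    record { isSubfield = F-isSubfield ; dotRegular = F-dotRegular ; extends = λ x∈ → x∈ } , λ ()
  adjoin-all F-isSubfield F-dotRegular {suc k} g =
    let (E , g₀∈) = adjoin F-isSubfield F-dotRegular (g zero)
        module E = RegularExtension E
        (E′ , g∈) = adjoin-all E.isSubfield E.dotRegular (g ∘ suc)
        module E′ = RegularExtension E′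
    in record { isSubfield = E′.isSubfield ; dotRegular = E′.dotRegular ; extends = E′.extends ∘ E.extends } ,
       λ { zero → E′.extends g₀∈ ; (suc l) → g∈ l }

-- Dot products over a finitely generated extension of the prime field

module FunctionField (em : ∀ {a : Level} → ExcludedMiddle a) {c ℓ ℓ# : Level} (K : HeytingField c ℓ ℓ#) where

  open import Defs
  open import Level using (lift; lower)
  open import Algebra.Morphism.Structures using (module RingMorphisms)
  open import Data.Fin.Base using (Fin; zero; toℕ; fromℕ<)
  open import Data.Fin.Properties using (toℕ-fromℕ<)
  open import Data.Integer.Base as ℤ using (ℤ; +_; 0ℤ; 1ℤ)
  open import Data.Integer.Divisibility.Signed as ℤ using (divides)
  import Data.Integer.Properties as ℤ
  import Data.Integer.DivMod as ℤ
  open import Data.Nat.Base using (ℕ)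
  open import Data.Nat.Primality using (prime⇒nonZero)
  open import Data.Vec.Functional using (Vector)
  open import Relation.Binary.PropositionalEquality.Core as ≡ using (_≡_)
  open Regularity
  open Adjunction (commutativeRing K)
  open CommutativeRing (commutativeRing K) hiding (zero; rawRing)
  private module K = HeytingField K

  isField : IsField
  isField = record
    { 1≉0     = λ 1≈0 → proj₂ (K.tight 1# 0#) 1≈0 (K.invertible⇒# (1# ,
        trans (*-identityˡ _) 1-0≈1 , trans (*-identityʳ _) 1-0≈1))
    ; inverse = λ x x≉0 →
        let (y , y[x-0]≈1 , _) = K.#⇒invertible (decidable-stable em λ ¬x#0 → x≉0 (proj₁ (K.tight x 0#) ¬x#0))
        in y , trans (*-congˡ (sym (x-0≈x x))) y[x-0]≈1
    }
    where
    x-0≈x : ∀ x → x - 0# ≈ x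
    x-0≈x x = solve 1 (λ x → x :- con (0 , 0) := x) refl x
    1-0≈1 : 1# - 0# ≈ 1#
    1-0≈1 = x-0≈x 1#

  module _ {p : ℕ} {p-prime : Prime p} (K/𝔽 : Extension (𝔽 p p-prime) K) where
    open Extension K/𝔽
    open RingMorphisms (rawRing (𝔽 p p-prime)) (rawRing K)
    open IsRingHomomorphism isRingHomomorphism
    open Mod p using (mod) renaming (_≈_ to _≡ₚ_)

    PrimeField : Pred Carrier (c ⊔ ℓ)
    PrimeField x = ∃[ z ] x ≈ ι (lower {ℓ = c} z)

    module _ {i j} (I : Set i) (J : Set j) where
      open FieldExtensions em (commutativeRing K) isField I J using (IsSubfield; DotRegular)
      open Towers em (commutativeRing K) isField I J using (RegularExtension; adjoin-all; finite-dotRegular)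

      primeField-isSubfield : IsSubfield PrimeField
      primeField-isSubfield = record
        { isSubring = record
          { resp       = λ x≈y (z , x≈) → z , trans (sym x≈y) x≈
          ; 0∈         = lift 0ℤ , sym 0#-homo
          ; 1∈         = lift 1ℤ , sym 1#-homo
          ; +-closed   = λ (lift z , x≈) (lift w , y≈) → lift (z ℤ.+ w) , trans (+-cong x≈ y≈) (sym (+-homo z w))
          ; *-closed   = λ (lift z , x≈) (lift w , y≈) → lift (z ℤ.* w) , trans (*-cong x≈ y≈) (sym (*-homo z w))
          ; neg-closed = λ (lift z , x≈) → lift (ℤ.- z) , trans (-‿cong x≈) (sym (-‿homo z))
          }
        ; inv-closed = λ {x} {y} yx≈1 (lift z , x≈) →
            let z≉0 = λ z≈0 → IsField.1≉0 isField (trans (sym yx≈1) (trans (*-congˡ (trans x≈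
                        (trans (⟦⟧-cong z≈0) 0#-homo))) (zeroʳ y)))
                (w , zw≈1) = Mod.inverse p p-prime {z} {0ℤ} z≉0
                xw≈1 : x * ι w ≈ 1#
                xw≈1 = trans (*-congʳ x≈) (trans (sym (*-homo z w))
                         (trans (⟦⟧-cong (≡.subst (λ v → v ℤ.* w ≡ₚ 1ℤ) (ℤ.+-identityʳ z) zw≈1)) 1#-homo))
            in lift w , trans (sym (*-identityʳ y)) (trans (*-congˡ (sym xw≈1))
                 (trans (sym (*-assoc y x (ι w))) (trans (*-congʳ yx≈1) (*-identityˡ (ι w)))))
        }

      primeField-dotRegular : DotRegular PrimeField
      primeField-dotRegular = finite-dotRegular {F = PrimeField} {q = p} (λ k → ι (+ toℕ k)) λ { (lift z , x≈) →
        fromℕ< (ℤ.n%ℕd<d z p) , trans x≈ (⟦⟧-cong (remainder z)) }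
        where
        instance p≢0 = prime⇒nonZero p-prime
        remainder : ∀ z → z ≡ₚ + toℕ (fromℕ< (ℤ.n%ℕd<d z p))
        remainder z = mod (divides (z ℤ./ℕ p) (≡.trans
          (≡.cong₂ (λ a b → a ℤ.- + b) (ℤ.a≡a%ℕn+[a/ℕn]*n z p) (toℕ-fromℕ< (ℤ.n%ℕd<d z p)))
          (cancel (+ (z ℤ.%ℕ p)) ((z ℤ./ℕ p) ℤ.* + p))))
          where
          open import Data.Integer.Tactic.RingSolver using (solve-∀)
          cancel : ∀ a b → (a ℤ.+ b) ℤ.- a ≡ b
          cancel = solve-∀

      dot-regular : FinitelyGenerated K/𝔽 → ∀ n → ∃[ k ] (∀ (u : I → Vector Carrier n) (v : J → Vector Carrier n) →
                    Regular k (λ a b → dot (u a) (v b) ≈ 0#))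
      dot-regular (_ , g , generates) n =
        let (E , g∈) = adjoin-all primeField-isSubfield primeField-dotRegular g
            (k , regular) = RegularExtension.dotRegular E n
        in k , λ u v → regular u v (λ a l → everything E g∈ (generates (u a l))) (λ b l → everything E g∈ (generates (v b l)))
        where
        everything : ∀ (E : RegularExtension PrimeField) → (∀ l → RegularExtension.L E (g l)) →
                     ∀ {x} → Adjoin K/𝔽 g x → RegularExtension.L E x
        everything E g∈ = member
          where
          open RegularExtension E
          open IsSubfield isSubfield renaming (resp to L-resp)
          member : ∀ {x} → Adjoin K/𝔽 g x → L x
          member (Adjoin.base z)        = extends (lift z , refl)
          member (Adjoin.gen l)         = g∈ l
          member (Adjoin.add x∈ y∈)     = +-closed (member x∈) (member y∈)
          member (Adjoin.neg x∈)        = neg-closed (member x∈)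
          member (Adjoin.mul x∈ y∈)     = *-closed (member x∈) (member y∈)
          member (Adjoin.inv xy≈1 x∈)   = inv-closed (trans (*-comm _ _) xy≈1) (member x∈)
          member (Adjoin.resp x≈y x∈)   = L-resp x≈y (member x∈)

-- Zero sets are regular

module ZeroSets (em : ∀ {a : Level} → ExcludedMiddle a) {c ℓ ℓ# : Level} (K : HeytingField c ℓ ℓ#) where

  open import Defs
  import Algebra.Construct.Pointwise as Pointwise
  import Algebra.Definitions.RawSemiring as RawSemiringDefinitions
  open import Data.Fin.Base using (Fin; zero; suc; _↑ˡ_; _↑ʳ_)
  open import Data.List.Base using (List; []; _∷_; length)
  open import Data.List.Relation.Unary.All as All using (All; []; _∷_)
  open import Data.Nat.Base as ℕ using (ℕ; zero; suc)
  open import Data.Vec.Functional using (Vector; _++_) renaming (_∷_ to _◂_; [] to ⟨⟩)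
  open import Data.Vec.Functional.Properties using (lookup-++ˡ; lookup-++ʳ)
  open import Relation.Binary.PropositionalEquality.Core as ≡ using (_≡_)
  open import Relation.Unary using (_∈_)
  open Regularity
  open CommutativeRing (commutativeRing K) hiding (zero; rawRing)
  open Adjunction (commutativeRing K) using (dot; IsField; sum-split)
  open FunctionField em K using (isField; dot-regular)
  open import Relation.Binary.Reasoning.Setoid setoid
  open IsField isField
  open RawSemiringDefinitions (RawRing.rawSemiring (rawRing K)) using (_^_; product)
  open import Algebra.Properties.Monoid.Sum *-monoid using () renaming (sum-cong-≋ to product-cong)

  -- Hilbert's basis theorem is applied to polynomial functions, generated by the coordinates over
  -- the constants inside the ring of all functions. There different presentations of a polynomial
  -- become equal, and zero sets depend on the functions only.
  Functions : ℕ → CommutativeRing c (c ⊔ ℓ)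
  Functions N = Pointwise.commutativeRing (Point K N) (commutativeRing K)

  module PolynomialFunctions (N : ℕ) where
    private module Fun = CommutativeRing (Functions N)
    open Adjunction (Functions N) using (IsSubring)
    open Noetherian em (Functions N)

    Constant : Pred Fun.Carrier (c ⊔ ℓ)
    Constant f = ∃[ a ] f Fun.≈ λ _ → a

    constant-isSubring : IsSubring Constant
    constant-isSubring = record
      { resp       = λ f≈g (a , f≈a) → a , λ v → trans (sym (f≈g v)) (f≈a v)
      ; 0∈         = 0# , λ _ → refl
      ; 1∈         = 1# , λ _ → refl
      ; +-closed   = λ (a , f≈a) (b , g≈b) → a + b , λ v → +-cong (f≈a v) (g≈b v)
      ; *-closed   = λ (a , f≈a) (b , g≈b) → a * b , λ v → *-cong (f≈a v) (g≈b v)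
      ; neg-closed = λ (a , f≈a) → - a , λ v → -‿cong (f≈a v)
      }

    constant-noetherian : Noetherian Constant
    constant-noetherian = field-noetherian constant-isSubring λ (a , f≈a) f≉0 →
      let (b , ba≈1) = inverse a λ a≈0 → f≉0 λ v → trans (f≈a v) a≈0
      in (λ _ → b) , (b , λ _ → refl) , λ v → trans (*-congˡ (f≈a v)) ba≈1

    private
      extension = adjoin-noetherian constant-isSubring constant-noetherian (λ i v → v i)
      module Q = NoetherianExtension (proj₁ extension)
      open IsSubring Q.isSubring

    power-closed : ∀ {f} n → Q.L f → Q.L (λ v → f v ^ n)
    power-closed zero    f∈ = 1∈
    power-closed (suc n) f∈ = *-closed f∈ (power-closed n f∈)

    product-closed : ∀ {k} {f : Fin k → Fun.Carrier} → (∀ i → Q.L (f i)) → Q.L (λ v → product (λ i → f i v))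
    product-closed {zero}  f∈ = 1∈
    product-closed {suc k} f∈ = *-closed (f∈ zero) (product-closed (f∈ ∘ suc))

    eval-closed : ∀ f → Q.L (eval K f)
    eval-closed []            = 0∈
    eval-closed ((a , e) ∷ f) = +-closed
      (*-closed (Q.extends (a , λ _ → refl)) (product-closed λ i → power-closed (e i) (proj₂ extension i)))
      (eval-closed f)

    ideal-vanishes : ∀ {fs f v} → Ideal Q.L fs f → All (λ g → g v ≈ 0#) fs → f v ≈ 0#
    ideal-vanishes {v = v} (nil f≈0) [] = f≈0 v
    ideal-vanishes {v = v} (cons {r = r} _ y∈ f≈) (g≈0 ∷ gs≈0) = trans (f≈ v)
      (trans (+-cong (trans (*-congˡ g≈0) (zeroʳ (r v))) (ideal-vanishes y∈ gs≈0)) (+-identityʳ 0#))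

    finite-subsystem : ∀ {r} (S : Pred (Polynomial K N) r) →
      ∃[ fs ] All (_∈ S) fs × (∀ v → All (λ f → eval K f v ≈ 0#) fs → ∀ f → f ∈ S → eval K f v ≈ 0#)
    finite-subsystem S =
      let (gs , gs∈ , generates) = finitely-generated Q.L {P = λ g → ∃[ f ] f ∈ S × g ≡ eval K f}
                                     (λ { (f , _ , ≡.refl) → eval-closed f }) Q.noetherian
          (fs , fs∈ , vanish) = representatives gs∈
      in fs , fs∈ , λ v fs≈0 f f∈ → ideal-vanishes (generates (f , f∈ , ≡.refl)) (vanish fs≈0)
      where
      representatives : ∀ {gs} → All (λ g → ∃[ f ] f ∈ S × g ≡ eval K f) gs →
        ∃[ fs ] All (_∈ S) fs × (∀ {v} → All (λ f → eval K f v ≈ 0#) fs → All (λ g → g v ≈ 0#) gs)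
      representatives [] = [] , [] , λ _ → []
      representatives ((f , f∈ , ≡.refl) ∷ gs∈) =
        let (fs , fs∈ , vanish) = representatives gs∈
        in f ∷ fs , f∈ ∷ fs∈ , λ { (f≈0 ∷ fs≈0) → f≈0 ∷ vanish fs≈0 }

  open PolynomialFunctions using (finite-subsystem)

  module _ {n m : ℕ} where

    -- One coordinate per term: a monomial in (x , y) is a monomial in x times one in y, and the
    -- coefficient goes to x.
    left-part : (f : Polynomial K (n ℕ.+ m)) → Point K n → Vector Carrier (length f)
    left-part []            x = ⟨⟩
    left-part ((a , e) ∷ f) x = (a * product (λ i → x i ^ e (i ↑ˡ m))) ◂ left-part f x

    right-part : (f : Polynomial K (n ℕ.+ m)) → Point K m → Vector Carrier (length f)
    right-part []            y = ⟨⟩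
    right-part ((a , e) ∷ f) y = product (λ j → y j ^ e (n ↑ʳ j)) ◂ right-part f y

    eval-dot : ∀ f (x : Point K n) (y : Point K m) → eval K f (x ++ y) ≈ dot (left-part f x) (right-part f y)
    eval-dot []            x y = refl
    eval-dot ((a , e) ∷ f) x y = +-cong (trans (*-congˡ (begin
        product (λ i → (x ++ y) i ^ e i)
          ≈⟨ sum-split *-monoid n (λ i → (x ++ y) i ^ e i) ⟩
        product (λ i → (x ++ y) (i ↑ˡ m) ^ e (i ↑ˡ m)) * product (λ j → (x ++ y) (n ↑ʳ j) ^ e (n ↑ʳ j))
          ≈⟨ *-cong (product-cong λ i → reflexive (≡.cong (_^ e (i ↑ˡ m)) (lookup-++ˡ x y i)))
                    (product-cong λ j → reflexive (≡.cong (_^ e (n ↑ʳ j)) (lookup-++ʳ x y j))) ⟩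
        product (λ i → x i ^ e (i ↑ˡ m)) * product (λ j → y j ^ e (n ↑ʳ j)) ∎))
      (sym (*-assoc a _ _))) (eval-dot f x y)

    module _ {p p-prime} (K/𝔽 : Extension (𝔽 p p-prime) K) (generated : FinitelyGenerated K/𝔽) where

      system-regular : ∀ (fs : List (Polynomial K (n ℕ.+ m))) →
                       ∃[ k ] Regular k (λ x y → All (λ f → eval K f (x ++ y) ≈ 0#) fs)
      system-regular []       = 1 , regular-true []
      system-regular (f ∷ fs) =
        let (k , regular)   = dot-regular K/𝔽 (Point K n) (Point K m) generated (length f)
            (k′ , regular′) = system-regular fs
        in k ℕ.* k′ , regular-resp
             (λ {x} {y} → mk⇔ (λ (uv≈0 , fs≈0) → trans (eval-dot f x y) uv≈0 ∷ fs≈0)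
                              (λ { (f≈0 ∷ fs≈0) → trans (sym (eval-dot f x y)) f≈0 , fs≈0 }))
             (regular-∩ (regular (left-part f) (right-part f)) regular′)

      zeroSet-regular : ∀ {r} (S : Pred (Polynomial K (n ℕ.+ m)) r) → ∃[ k ] Regular k (ZeroSet K {n = n} {m = m} S)
      zeroSet-regular S =
        let (fs , fs∈ , vanish) = finite-subsystem (n ℕ.+ m) S
            (k , regular) = system-regular fs
        in k , regular-resp (λ {x} {y} → mk⇔ (vanish (x ++ y)) (λ zeros → All.map (λ {f} f∈ → zeros f f∈) fs∈)) regular

-- Counting incidences in regular relations without large rectangles

module Powers where

  open import Data.Nat.Base
  open import Data.Nat.Properties
  open import Data.Nat.Tactic.RingSolver using (solve-∀)
  open import Relation.Binary.PropositionalEquality using (_≡_; refl; trans; cong)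

  ^-distribʳ-* : ∀ m n k → (m * n) ^ k ≡ m ^ k * n ^ k
  ^-distribʳ-* m n zero    = refl
  ^-distribʳ-* m n (suc k) = trans (cong (m * n *_) (^-distribʳ-* m n k)) (swap m n (m ^ k) (n ^ k))
    where
    swap : ∀ a b c d → a * b * (c * d) ≡ a * c * (b * d)
    swap = solve-∀

  ^-cancel-≤ : ∀ k .{{_ : NonZero k}} {m n} → m ^ k ≤ n ^ k → m ≤ n
  ^-cancel-≤ k le = ≮⇒≥ λ n<m → <⇒≱ (^-monoˡ-< k n<m) le

module Incidences (em : ∀ {a : Level} → ExcludedMiddle a) where

  open import Data.Bool.Base using (Bool; true; false; T; not; if_then_else_)
  open import Data.List.Base using (List; []; _∷_; length; filterᵇ)
  open import Data.List.Relation.Unary.All as All using (All; []; _∷_)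
  open import Data.List.Relation.Unary.All.Properties using (all-filter)
  open import Data.List.Relation.Binary.Sublist.Propositional using (_⊆_; []; _∷_; _∷ʳ_; ⊆-refl; ⊆-trans; minimum)
  open import Data.List.Relation.Binary.Sublist.Propositional.Properties using (filter-⊆; All-resp-⊆)
  open import Data.Nat.Base hiding (_⊔_)
  open import Data.Nat.DivMod using (_/_; m/n*n≤m; m≡m%n+[m/n]*n; m%n<n)
  open import Data.Nat.Properties
  open import Data.Nat.Tactic.RingSolver using (solve-∀)
  open import Data.Sum.Base as Sum using (_⊎_; inj₁; inj₂)
  open import Relation.Binary.PropositionalEquality using (_≡_; refl; sym; trans; cong; cong₂)
  open Regularity
  open Powers
  open Regularity.Classical em
  open ≤-Reasoning

  choose : ℕ → ℕ → ℕ
  choose n       zero    = 1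
  choose zero    (suc k) = 0
  choose (suc n) (suc k) = choose n k + choose n (suc k)

  choose≤^ : ∀ n k → choose n k ≤ n ^ k
  choose≤^ n       zero    = ≤-refl
  choose≤^ zero    (suc k) = z≤n
  choose≤^ (suc n) (suc k) = begin
    choose n k + choose n (suc k)   ≤⟨ +-mono-≤ (choose≤^ n k) (choose≤^ n (suc k)) ⟩
    n ^ k + n * n ^ k  ≤⟨ *-monoʳ-≤ (suc n) (^-monoˡ-≤ k (n≤1+n n)) ⟩
    suc n * suc n ^ k               ∎

  choose-absorb : ∀ n k → suc k * choose (suc n) (suc k) ≡ suc n * choose n k
  choose-absorb zero    zero    = refl
  choose-absorb zero    (suc k) = *-zeroʳ (suc (suc k))
  choose-absorb (suc n) zero    = trans (*-identityˡ _) (trans (cong suc (trans (sym (*-identityˡ _)) (choose-absorb n zero))) (one n))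
    where
    one : ∀ n → suc (suc n * 1) ≡ suc (suc n) * 1
    one = solve-∀
  choose-absorb (suc n) (suc k) = begin-equality
    suc (suc k) * (x + choose (suc n) (suc (suc k)))  ≡⟨ *-distribˡ-+ (suc (suc k)) x _ ⟩
    suc (suc k) * x + suc (suc k) * choose (suc n) (suc (suc k))  ≡⟨ cong (suc (suc k) * x +_) (choose-absorb n (suc k)) ⟩
    suc (suc k) * x + suc n * choose n (suc k)  ≡⟨ split k x (suc n * choose n (suc k)) ⟩
    x + (suc k * x + suc n * choose n (suc k))  ≡⟨ cong (λ y → x + (y + suc n * choose n (suc k))) (choose-absorb n k) ⟩
    x + (suc n * choose n k + suc n * choose n (suc k))  ≡⟨ collect n (choose n k) (choose n (suc k)) ⟩
    suc (suc n) * x                                               ∎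
    where
    x = choose (suc n) (suc k)
    split : ∀ k x y → suc (suc k) * x + y ≡ x + (suc k * x + y)
    split = solve-∀
    collect : ∀ n a b → (a + b) + (suc n * a + suc n * b) ≡ suc (suc n) * (a + b)
    collect = solve-∀

  -- The estimate (n / k)^k ≤ C(n, k). Induction by C(n + 1, k + 1) = (n + 1) / (k + 1) · C(n, k)
  -- reduces it to (n + 1) / (k + 1) ≤ n / k, which holds for k ≤ n.
  ^≤choose : ∀ {n k} → k ≤ n → n ^ k ≤ k ^ k * choose n k
  ^≤choose {n}     {zero}  _          = ≤-refl
  ^≤choose {suc n} {suc k} (s≤s k≤n) = *-cancelˡ-≤ (suc k) (begin
    suc k * (suc n * suc n ^ k)  ≤⟨ *-monoʳ-≤ (suc k) (*-monoʳ-≤ (suc n) (step k k≤n)) ⟩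
    suc k * (suc n * (suc k ^ k * choose n k))  ≡⟨ shuffle (suc k) (suc n) (suc k ^ k) (choose n k) ⟩
    suc k * suc k ^ k * (suc n * choose n k)  ≡⟨ cong (suc k * suc k ^ k *_) (choose-absorb n k) ⟨
    suc k * suc k ^ k * (suc k * choose (suc n) (suc k))    ≡⟨ rotate (suc k) (suc k ^ k) (choose (suc n) (suc k)) ⟩
    suc k * (suc k ^ suc k * choose (suc n) (suc k))        ∎)
    where
    shuffle : ∀ a b c d → a * (b * (c * d)) ≡ a * c * (b * d)
    shuffle = solve-∀
    rotate : ∀ a b c → a * b * (a * c) ≡ a * (a * b * c)
    rotate = solve-∀
    cross : ∀ n k → suc n * k + n ≡ n * suc k + k
    cross = solve-∀
    swap : ∀ a b c → a * (b * c) ≡ b * (a * c)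
    swap = solve-∀
    step : ∀ k → k ≤ n → suc n ^ k ≤ suc k ^ k * choose n k
    step zero      _   = ≤-refl
    step k@(suc _) k≤n = *-cancelˡ-≤ (k ^ k) ⦃ m^n≢0 k k ⦄ (begin
      k ^ k * suc n ^ k  ≡⟨ *-comm (k ^ k) (suc n ^ k) ⟩
      suc n ^ k * k ^ k  ≡⟨ ^-distribʳ-* (suc n) k k ⟨
      (suc n * k) ^ k  ≤⟨ ^-monoˡ-≤ k (+-cancelʳ-≤ n _ _ (≤-trans (≤-reflexive (cross n k)) (+-monoʳ-≤ (n * suc k) k≤n))) ⟩
      (n * suc k) ^ k  ≡⟨ ^-distribʳ-* n (suc k) k ⟩
      n ^ k * suc k ^ k  ≤⟨ *-monoˡ-≤ (suc k ^ k) (^≤choose k≤n) ⟩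
      k ^ k * choose n k * suc k ^ k ≡⟨ trans (*-assoc (k ^ k) _ _) (cong (k ^ k *_) (*-comm _ (suc k ^ k))) ⟩
      k ^ k * (suc k ^ k * choose n k) ∎)

  private variable
    i j r : Level
    X : Set i
    Y : Set j

  total-cong : ∀ {f g : X → ℕ} → (∀ x → f x ≡ g x) → ∀ xs → total f xs ≡ total g xs
  total-cong f≡g []       = refl
  total-cong f≡g (x ∷ xs) = cong₂ _+_ (f≡g x) (total-cong f≡g xs)

  total-mono : ∀ {f g : X → ℕ} → (∀ x → f x ≤ g x) → ∀ xs → total f xs ≤ total g xs
  total-mono f≤g []       = z≤n
  total-mono f≤g (x ∷ xs) = +-mono-≤ (f≤g x) (total-mono f≤g xs)

  total-+ : ∀ (f g : X → ℕ) xs → total (λ x → f x + g x) xs ≡ total f xs + total g xs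
  total-+ f g []       = refl
  total-+ f g (x ∷ xs) = trans (cong (f x + g x +_) (total-+ f g xs)) (interchange (f x) (g x) (total f xs) (total g xs))
    where
    interchange : ∀ a b c d → a + b + (c + d) ≡ a + c + (b + d)
    interchange = solve-∀

  total-* : ∀ k (f : X → ℕ) xs → total (λ x → k * f x) xs ≡ k * total f xs
  total-* k f []       = sym (*-zeroʳ k)
  total-* k f (x ∷ xs) = trans (cong (k * f x +_) (total-* k f xs)) (sym (*-distribˡ-+ k (f x) (total f xs)))

  total-const : ∀ k (xs : List X) → total (const k) xs ≡ length xs * k
  total-const k []       = refl
  total-const k (x ∷ xs) = cong (k +_) (total-const k xs)

  total-filter : ∀ (q : X → Bool) f xs → total (λ x → if q x then f x else 0) xs ≡ total f (filterᵇ q xs)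
  total-filter q f []       = refl
  total-filter q f (x ∷ xs) with q x
  ... | true  = cong (f x +_) (total-filter q f xs)
  ... | false = total-filter q f xs

  total-split : ∀ (q : X → Bool) f xs → total f xs ≡ total f (filterᵇ q xs) + total f (filterᵇ (not ∘ q) xs)
  total-split q f []       = refl
  total-split q f (x ∷ xs) with q x
  ... | true  = trans (cong (f x +_) (total-split q f xs)) (sym (+-assoc (f x) _ _))
  ... | false = trans (cong (f x +_) (total-split q f xs)) (swap (f x) (total f (filterᵇ q xs)) _)
    where
    swap : ∀ a b c → a + (b + c) ≡ b + (a + c)
    swap = solve-∀

  count-split : ∀ (q p : X → Bool) xs → count p xs ≡ count p (filterᵇ q xs) + count p (filterᵇ (not ∘ q) xs)
  count-split q p []       = refl
  count-split q p (x ∷ xs) with q x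
  ... | true with p x
  ...   | true  = cong suc (count-split q p xs)
  ...   | false = count-split q p xs
  count-split q p (x ∷ xs) | false with p x
  ...   | true  = trans (cong suc (count-split q p xs)) (sym (+-suc _ _))
  ...   | false = count-split q p xs

  module _ (E : REL X Y r) where

    degree : List X → Y → ℕ
    degree xs y = count (λ x → decide (E x y)) xs

    incidences : List X → List Y → ℕ
    incidences xs ys = total (degree xs) ys

    Free : ℕ → ℕ → List X → List Y → Set _
    Free d s xs ys = ∀ {xs′ ys′} → xs′ ⊆ xs → ys′ ⊆ ys → All (λ x → All (E x) ys′) xs′ →
                     length xs′ < d ⊎ length ys′ < s

    free-⊆ : ∀ {d s xs ys xs′ ys′} → xs′ ⊆ xs → ys′ ⊆ ys → Free d s xs ys → Free d s xs′ ys′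
    free-⊆ xs⊆ ys⊆ free xs″⊆ ys″⊆ = free (⊆-trans xs″⊆ xs⊆) (⊆-trans ys″⊆ ys⊆)

    -- Double counting: a set of d elements of xs has fewer than s common neighbours. In the
    -- induction, Pascal's rule separates the d-sets that contain x, which are (d - 1)-sets seen
    -- from the neighbours of x, from the others.
    total-choose : ∀ d s xs ys → Free d s xs ys → total (λ y → choose (degree xs y) d) ys ≤ s * choose (length xs) d
    total-choose zero s xs ys free with free (minimum xs) ⊆-refl []
    ... | inj₂ ys<s = ≤-trans (≤-reflexive (total-const 1 ys)) (*-monoˡ-≤ 1 (<⇒≤ ys<s))
    total-choose (suc d) s [] ys free = ≤-trans (≤-reflexive (trans (total-const 0 ys) (*-zeroʳ (length ys)))) z≤n
    total-choose (suc d) s (x ∷ xs) ys free = begin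
      total (λ y → choose (degree (x ∷ xs) y) (suc d)) ys
        ≡⟨ total-cong pascal ys ⟩
      total (λ y → (if decide (E x y) then choose (degree xs y) d else 0) + choose (degree xs y) (suc d)) ys
        ≡⟨ trans (total-+ _ _ ys) (cong (_+ _) (total-filter (λ y → decide (E x y)) _ ys)) ⟩
      total (λ y → choose (degree xs y) d) neighbours + total (λ y → choose (degree xs y) (suc d)) ys
        ≤⟨ +-mono-≤ (total-choose d s xs neighbours free′)
                    (total-choose (suc d) s xs ys (free-⊆ (x ∷ʳ ⊆-refl) ⊆-refl free)) ⟩
      s * choose (length xs) d + s * choose (length xs) (suc d)
        ≡⟨ *-distribˡ-+ s _ _ ⟨
      s * choose (suc (length xs)) (suc d) ∎
      where
      neighbours = filterᵇ (λ y → decide (E x y)) ys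
      pascal : ∀ y → choose (degree (x ∷ xs) y) (suc d) ≡
               (if decide (E x y) then choose (degree xs y) d else 0) + choose (degree xs y) (suc d)
      pascal y with decide (E x y)
      ... | true  = refl
      ... | false = refl
      free′ : Free d s xs neighbours
      free′ xs′⊆ ys′⊆ full = Sum.map₁ s≤s⁻¹ (free (refl ∷ xs′⊆) (⊆-trans ys′⊆ (filter-⊆ _ ys))
        (All.map decided (All-resp-⊆ ys′⊆ (all-filter (λ y → T? (decide (E x y))) ys)) ∷ full))

    degree≤length : ∀ xs y → degree xs y ≤ length xs
    degree≤length xs y = ≤-trans (m≤m+n _ _) (≤-reflexive (count-complement (λ x → decide (E x y)) xs))

    -- A power-free form of the convexity in the Kővári–Sós–Turán argument: degrees beyond a
    -- threshold k are bounded by binomial coefficients, and k is chosen so that k v |ys| ≈ |xs| w.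
    -- The rational w / v plays the role of |ys|^(e/d).
    kővári–sós–turán : ∀ e s {xs ys} v w .{{_ : NonZero v}} → Free (suc e) s xs ys →
      length ys ^ e * v ^ suc e ≤ w ^ suc e →
      incidences xs ys * v ≤ suc (suc e ^ suc e * s + suc e) * (length xs * w + v * length ys)
    kővári–sós–turán e s {xs} {[]}         v w free le = z≤n
    kővári–sós–turán e s {xs} {ys@(_ ∷ _)} v w free le = *-cancelˡ-≤ (k ^ e) ⦃ m^n≢0 k e ⦄ (begin
      k ^ e * (incidences xs ys * v)  ≡⟨ *-assoc (k ^ e) _ v ⟨
      k ^ e * incidences xs ys * v  ≤⟨ *-monoˡ-≤ v threshold ⟩
      (β * (k ^ e * (k + d)) + d ^ d * (s * α ^ d)) * v
                                                  ≡⟨ rearrange β (k ^ e) k d (d ^ d) s (α ^ d) v ⟩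
      k ^ e * (k * (v * β) + d * (v * β)) + d ^ d * s * (α ^ d * v)
                                                  ≤⟨ +-mono-≤ (*-monoʳ-≤ (k ^ e) (+-monoˡ-≤ _ small)) (*-monoʳ-≤ (d ^ d * s) balanced) ⟩
      k ^ e * ((α * w + v * β) + d * (v * β)) + d ^ d * s * (k ^ e * (α * w))
                                                  ≤⟨ m≤m+n _ _ ⟩
      k ^ e * ((α * w + v * β) + d * (v * β)) + d ^ d * s * (k ^ e * (α * w)) + k ^ e * (d * (α * w) + d ^ d * s * (v * β))
                                                  ≡⟨ collect (k ^ e) (α * w) (v * β) d (d ^ d * s) ⟩
      k ^ e * (suc (d ^ d * s + d) * (α * w + v * β)) ∎)
      where
      d = suc e
      α = length xs
      β = length ys
      instance
        vβ≢0 : NonZero (v * β)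
        vβ≢0 = m*n≢0 v β
      k = suc ((α * w) / (v * β))
      rearrange : ∀ b p k d D s a v → (b * (p * (k + d)) + D * (s * a)) * v ≡ p * (k * (v * b) + d * (v * b)) + D * s * (a * v)
      rearrange = solve-∀
      collect : ∀ p x y d D → p * ((x + y) + d * y) + D * (p * x) + p * (d * x + D * y) ≡ p * (suc (D + d) * (x + y))
      collect = solve-∀
      small : k * (v * β) ≤ α * w + v * β
      small = ≤-trans (+-monoʳ-≤ (v * β) (m/n*n≤m (α * w) (v * β))) (≤-reflexive (+-comm (v * β) (α * w)))
      large : α * w ≤ k * (v * β)
      large = ≤-trans (≤-reflexive (m≡m%n+[m/n]*n (α * w) (v * β))) (+-monoˡ-≤ _ (<⇒≤ (m%n<n (α * w) (v * β))))
      balanced : α ^ d * v ≤ k ^ e * (α * w)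
      balanced = *-cancelˡ-≤ ((v * β) ^ e) ⦃ m^n≢0 (v * β) e ⦄ (begin
        (v * β) ^ e * (α ^ d * v)  ≡⟨ cong (_* (α ^ d * v)) (^-distribʳ-* v β e) ⟩
        v ^ e * β ^ e * (α ^ d * v)      ≡⟨ group (v ^ e) (β ^ e) (α ^ d) v ⟩
        α ^ d * (β ^ e * v ^ d)  ≤⟨ *-monoʳ-≤ (α ^ d) le ⟩
        α ^ d * w ^ d  ≡⟨ ^-distribʳ-* α w d ⟨
        (α * w) * (α * w) ^ e  ≤⟨ *-monoʳ-≤ (α * w) (^-monoˡ-≤ e large) ⟩
        (α * w) * (k * (v * β)) ^ e      ≡⟨ cong (α * w *_) (^-distribʳ-* k (v * β) e) ⟩
        (α * w) * (k ^ e * (v * β) ^ e)  ≡⟨ reverse (α * w) (k ^ e) ((v * β) ^ e) ⟩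
        (v * β) ^ e * (k ^ e * (α * w))  ∎)
        where
        group : ∀ p q a v → p * q * (a * v) ≡ a * (q * (v * p))
        group = solve-∀
        reverse : ∀ a b c → a * (b * c) ≡ c * (b * a)
        reverse = solve-∀
      -- Beyond the threshold, k ^ e * n ≤ n ^ e * n = n ^ d, which the binomial coefficient
      -- controls. The summand d in the threshold guarantees d ≤ n there.
      pointwise : ∀ n → k ^ e * n ≤ k ^ e * (k + d) + d ^ d * choose n d
      pointwise n with ≤-total n (k + d)
      ... | inj₁ n≤k+d = ≤-trans (*-monoʳ-≤ (k ^ e) n≤k+d) (m≤m+n _ _)
      ... | inj₂ k+d≤n = ≤-trans (≤-trans (*-monoˡ-≤ n (^-monoˡ-≤ e (≤-trans (m≤m+n k d) k+d≤n)))
        (≤-trans (≤-reflexive (*-comm (n ^ e) n)) (^≤choose (≤-trans (m≤n+m d k) k+d≤n)))) (m≤n+m _ _)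
      threshold : k ^ e * incidences xs ys ≤ β * (k ^ e * (k + d)) + d ^ d * (s * α ^ d)
      threshold = begin
        k ^ e * incidences xs ys  ≡⟨ total-* (k ^ e) (degree xs) ys ⟨
        total (λ y → k ^ e * degree xs y) ys  ≤⟨ total-mono (pointwise ∘ degree xs) ys ⟩
        total (λ y → k ^ e * (k + d) + d ^ d * choose (degree xs y) d) ys
          ≡⟨ trans (total-+ (const (k ^ e * (k + d))) (λ y → d ^ d * choose (degree xs y) d) ys)
                   (cong₂ _+_ (total-const (k ^ e * (k + d)) ys) (total-* (d ^ d) (λ y → choose (degree xs y) d) ys)) ⟩
        β * (k ^ e * (k + d)) + d ^ d * total (λ y → choose (degree xs y) d) ys
          ≤⟨ +-monoʳ-≤ (β * (k ^ e * (k + d))) (*-monoʳ-≤ (d ^ d)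
               (≤-trans (total-choose d s xs ys free) (*-monoʳ-≤ s (choose≤^ α d)))) ⟩
        β * (k ^ e * (k + d)) + d ^ d * (s * α ^ d)                ∎

    incidences≤ : ∀ xs ys → incidences xs ys ≤ length ys * length xs
    incidences≤ xs ys = ≤-trans (total-mono (degree≤length xs) ys) (≤-reflexive (total-const (length xs) ys))

    incidences-peel : ∀ {p q} → (∀ {x y} → T (p x) → T (q y) → ¬ E x y) → ∀ xs ys →
      incidences xs ys ≡ incidences (filterᵇ p xs) (filterᵇ (not ∘ q) ys) + incidences (filterᵇ (not ∘ p) xs) ys
    incidences-peel {p} {q} empty xs ys = begin-equality
      incidences xs ys
        ≡⟨ total-cong (λ y → count-split p (λ x → decide (E x y)) xs) ys ⟩
      total (λ y → degree (filterᵇ p xs) y + degree (filterᵇ (not ∘ p) xs) y) ys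
        ≡⟨ total-+ (degree (filterᵇ p xs)) (degree (filterᵇ (not ∘ p) xs)) ys ⟩
      incidences (filterᵇ p xs) ys + incidences (filterᵇ (not ∘ p) xs) ys
        ≡⟨ cong (_+ incidences (filterᵇ (not ∘ p) xs) ys) (trans (total-split q (degree (filterᵇ p xs)) ys)
             (cong (_+ incidences (filterᵇ p xs) (filterᵇ (not ∘ q) ys)) (no-incidences (all-filter (T? ∘ q) ys)))) ⟩
      incidences (filterᵇ p xs) (filterᵇ (not ∘ q) ys) + incidences (filterᵇ (not ∘ p) xs) ys ∎
      where
      no-neighbours : ∀ {y xs} → T (q y) → All (T ∘ p) xs → degree xs y ≡ 0
      no-neighbours {y} {[]}     qy []         = refl
      no-neighbours {y} {x ∷ xs} qy (px ∷ pxs) with em {_} {E x y}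
      ... | yes e = contradiction e (empty px qy)
      ... | no  _ = no-neighbours qy pxs
      no-incidences : ∀ {ys} → All (T ∘ q) ys → incidences (filterᵇ p xs) ys ≡ 0
      no-incidences []         = refl
      no-incidences (qy ∷ qys) = cong₂ _+_ (no-neighbours qy (all-filter (T? ∘ p) xs)) (no-incidences qys)

    module _ {c₀ : ℕ} (regular : Regular (suc c₀) E) (e s : ℕ) where
      private
        c = suc c₀
        d = suc (suc e)
        -- Chosen with c₀ (h + 1)^2 ≤ c h^2, so that h / (h + 1) bounds the square root of c₀ / c.
        -- Then P₀ is defined by 1 + P₀ = c (h + 1).
        h = suc (2 * c₀)
        P₀ = suc (4 * c₀ + 2 * c₀ * c₀)

      peel-constant : ℕ
      peel-constant = suc (d ^ d * s + d) + (c * d + c * s)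

      private
        K = peel-constant

        P≡ : ∀ c → suc (suc (4 * c + 2 * c * c)) ≡ suc c * suc (suc (2 * c))
        P≡ = solve-∀

        -- If ys shrinks by c₀ / c, then |ys|^((d-1)/d) shrinks at least by the square root of c₀ /
        -- c, because d ≥ 2, and so at least by h / (h + 1). This is the passage from w / v to (w *
        -- h) / (v * suc h).
        decay : ∀ {β β′ v w} → c * β′ ≤ c₀ * β → β ^ suc e * v ^ d ≤ w ^ d → β′ ^ suc e * (v * suc h) ^ d ≤ (w * h) ^ d
        decay {β} {β′} {v} {w} cβ′≤ le = *-cancelˡ-≤ (c ^ suc e) ⦃ m^n≢0 c (suc e) ⦄ (begin
          c ^ suc e * (β′ ^ suc e * (v * suc h) ^ d)      ≡⟨ cong (λ y → c ^ suc e * (β′ ^ suc e * y)) (^-distribʳ-* v (suc h) d) ⟩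
          c ^ suc e * (β′ ^ suc e * (v ^ d * suc h ^ d))  ≡⟨ *-assoc (c ^ suc e) (β′ ^ suc e) _ ⟨
          c ^ suc e * β′ ^ suc e * (v ^ d * suc h ^ d)    ≡⟨ cong (_* (v ^ d * suc h ^ d)) (^-distribʳ-* c β′ (suc e)) ⟨
          (c * β′) ^ suc e * (v ^ d * suc h ^ d)  ≤⟨ *-monoˡ-≤ _ (^-monoˡ-≤ (suc e) cβ′≤) ⟩
          (c₀ * β) ^ suc e * (v ^ d * suc h ^ d)  ≡⟨ cong (_* (v ^ d * suc h ^ d)) (^-distribʳ-* c₀ β (suc e)) ⟩
          c₀ ^ suc e * β ^ suc e * (v ^ d * suc h ^ d)    ≡⟨ regroup (c₀ ^ suc e) (β ^ suc e) (v ^ d) (suc h ^ d) ⟩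
          c₀ ^ suc e * suc h ^ d * (β ^ suc e * v ^ d)    ≤⟨ *-mono-≤ ratio le ⟩
          c ^ suc e * h ^ d * w ^ d  ≡⟨ trans (*-assoc (c ^ suc e) _ _) (cong (c ^ suc e *_) (trans (*-comm (h ^ d) (w ^ d)) (sym (^-distribʳ-* w h d)))) ⟩
          c ^ suc e * (w * h) ^ d                         ∎)
          where
          regroup : ∀ a b p q → a * b * (p * q) ≡ a * q * (b * p)
          regroup = solve-∀
          square : c₀ * (suc h * suc h) ≤ c * (h * h)
          square = ≤-trans (m≤m+n _ (suc c₀)) (≤-reflexive (expand c₀))
            where
            expand : ∀ c → c * (suc (suc (2 * c)) * suc (suc (2 * c))) + suc c ≡ suc c * (suc (2 * c) * suc (2 * c))
            expand = solve-∀
          double : ∀ x → x ^ d * x ^ e ≡ (x * x) ^ suc e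
          double x = trans (reorder x (x ^ e)) (sym (^-distribʳ-* x x (suc e)))
            where
            reorder : ∀ x y → x * (x * y) * y ≡ x * y * (x * y)
            reorder = solve-∀
          ratio : c₀ ^ suc e * suc h ^ d ≤ c ^ suc e * h ^ d
          ratio = *-cancelʳ-≤ _ _ (h ^ e) ⦃ m^n≢0 h e ⦄ (begin
            c₀ ^ suc e * suc h ^ d * h ^ e  ≤⟨ *-monoʳ-≤ (c₀ ^ suc e * suc h ^ d) (^-monoˡ-≤ e (n≤1+n h)) ⟩
            c₀ ^ suc e * suc h ^ d * suc h ^ e  ≡⟨ trans (*-assoc (c₀ ^ suc e) _ _) (cong (c₀ ^ suc e *_) (double (suc h))) ⟩
            c₀ ^ suc e * (suc h * suc h) ^ suc e     ≡⟨ ^-distribʳ-* c₀ (suc h * suc h) (suc e) ⟨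
            (c₀ * (suc h * suc h)) ^ suc e  ≤⟨ ^-monoˡ-≤ (suc e) square ⟩
            (c * (h * h)) ^ suc e  ≡⟨ ^-distribʳ-* c (h * h) (suc e) ⟩
            c ^ suc e * (h * h) ^ suc e  ≡⟨ trans (*-assoc (c ^ suc e) _ _) (cong (c ^ suc e *_) (double h)) ⟨
            c ^ suc e * h ^ d * h ^ e                ∎)

        -- The α₁ points of p meet a smaller ys, so they count with weight h / (h + 1), the other α₀
        -- with weight 1. As p has at least a proportion 1 / c of α = α₀ + α₁, the weighted sum is
        -- at most α (1 - 1 / (c (h + 1))) = α P₀ / (1 + P₀). The two copies of T * β account for
        -- the doubling of 2 ^ L.
        combine : ∀ {i₀ i₁ α₀ α₁ β β′ v w X Y T} →
          i₀ * v * Y ≤ K * (X * (α₀ * w) + Y * (v * (T * β + α₀))) →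
          i₁ * (v * suc h) * Y ≤ K * (X * (α₁ * (w * h)) + Y * (v * suc h * (T * β′ + α₁))) →
          α₁ + α₀ ≤ c * α₁ → β′ ≤ β →
          (i₁ + i₀) * v * (suc P₀ * Y) ≤ K * (P₀ * X * ((α₁ + α₀) * w) + suc P₀ * Y * (v * (2 * T * β + (α₁ + α₀))))
        combine {i₀} {i₁} {α₀} {α₁} {β} {β′} {v} {w} {X} {Y} {T} ih₀ ih₁ α≤ β′≤β = begin
          (i₁ + i₀) * v * (suc P₀ * Y)
            ≡⟨ trans (cong (λ P → (i₁ + i₀) * v * (P * Y)) (P≡ c₀)) (distribute i₀ i₁ v c (suc h) Y) ⟩
          c * suc h * (i₀ * v * Y) + c * (i₁ * (v * suc h) * Y)
            ≤⟨ +-mono-≤ (*-monoʳ-≤ (c * suc h) ih₀) (*-monoʳ-≤ c ih₁) ⟩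
          c * suc h * (K * (X * (α₀ * w) + Y * (v * (T * β + α₀)))) + c * (K * (X * (α₁ * (w * h)) + Y * (v * suc h * (T * β′ + α₁))))
            ≡⟨ collect K X Y α₀ α₁ w v T β β′ c h ⟩
          K * (c * (suc h * α₀ + h * α₁) * X * w + c * suc h * Y * (v * (T * (β + β′) + (α₁ + α₀))))
            ≤⟨ *-monoʳ-≤ K (+-mono-≤ (*-monoˡ-≤ w (*-monoˡ-≤ X gain))
                 (*-monoʳ-≤ (c * suc h * Y) (*-monoʳ-≤ v (+-monoˡ-≤ (α₁ + α₀) (≤-trans (*-monoʳ-≤ T (+-monoʳ-≤ β β′≤β)) (≤-reflexive (twice T β))))))) ⟩
          K * (P₀ * (α₁ + α₀) * X * w + c * suc h * Y * (v * (2 * T * β + (α₁ + α₀))))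
            ≡⟨ cong₂ (λ a P → K * (a + P * Y * (v * (2 * T * β + (α₁ + α₀))))) (shuffle P₀ (α₁ + α₀) X w) (sym (P≡ c₀)) ⟩
          K * (P₀ * X * ((α₁ + α₀) * w) + suc P₀ * Y * (v * (2 * T * β + (α₁ + α₀)))) ∎
          where
          distribute : ∀ i₀ i₁ v c g Y → (i₁ + i₀) * v * (c * g * Y) ≡ c * g * (i₀ * v * Y) + c * (i₁ * (v * g) * Y)
          distribute = solve-∀
          collect : ∀ K X Y α₀ α₁ w v T β β′ c h →
            c * suc h * (K * (X * (α₀ * w) + Y * (v * (T * β + α₀)))) + c * (K * (X * (α₁ * (w * h)) + Y * (v * suc h * (T * β′ + α₁)))) ≡
            K * (c * (suc h * α₀ + h * α₁) * X * w + c * suc h * Y * (v * (T * (β + β′) + (α₁ + α₀))))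
          collect = solve-∀
          twice : ∀ T β → T * (β + β) ≡ 2 * T * β
          twice = solve-∀
          shuffle : ∀ p a x w → p * a * x * w ≡ p * x * (a * w)
          shuffle = solve-∀
          factor : ∀ c h a b → c * (suc h * b + h * a) + c * a ≡ c * suc h * (a + b)
          factor = solve-∀
          gain : c * (suc h * α₀ + h * α₁) ≤ P₀ * (α₁ + α₀)
          gain = +-cancelʳ-≤ (α₁ + α₀) _ _ (begin
            c * (suc h * α₀ + h * α₁) + (α₁ + α₀)   ≤⟨ +-monoʳ-≤ (c * (suc h * α₀ + h * α₁)) α≤ ⟩
            c * (suc h * α₀ + h * α₁) + c * α₁      ≡⟨ factor c h α₁ α₀ ⟩
            c * suc h * (α₁ + α₀)  ≡⟨ cong (_* (α₁ + α₀)) (P≡ c₀) ⟨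
            suc P₀ * (α₁ + α₀)  ≡⟨ +-comm (α₁ + α₀) _ ⟩
            P₀ * (α₁ + α₀) + (α₁ + α₀)              ∎)

      -- The factor λ gained in each of the L steps is P₀ / (1 + P₀).
      peel : ∀ L {xs ys} v w .{{_ : NonZero v}} → Free d s xs ys → length ys ^ suc e * v ^ d ≤ w ^ d →
        incidences xs ys * v * suc P₀ ^ L ≤
        K * (P₀ ^ L * (length xs * w) + suc P₀ ^ L * (v * (2 ^ L * length ys + length xs)))
      peel zero {xs} {ys} v w free le = begin
        incidences xs ys * v * 1  ≡⟨ *-identityʳ _ ⟩
        incidences xs ys * v  ≤⟨ kővári–sós–turán (suc e) s v w free le ⟩
        suc (d ^ d * s + d) * (length xs * w + v * length ys)  ≤⟨ *-mono-≤ (m≤m+n (suc (d ^ d * s + d)) (c * d + c * s))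
                                                                             (m≤m+n (length xs * w + v * length ys) (v * length xs)) ⟩
        K * (length xs * w + v * length ys + v * length xs)  ≡⟨ cong (K *_) (units (length xs * w) v (length ys) (length xs)) ⟩
        K * (1 * (length xs * w) + 1 * (v * (1 * length ys + length xs))) ∎
        where
        units : ∀ a v b x → a + v * b + v * x ≡ 1 * a + 1 * (v * (1 * b + x))
        units = solve-∀
      peel (suc L) {xs} {ys} v w free le with regular xs ys
      -- In a free relation a full rectangle has a side shorter than d or s. Then xs or ys has at
      -- most c * d or c * s elements and the trivial bound is already linear; the summand c * d + c
      -- * s of K pays for this.
      ... | rectangle p q lx ly (inj₁ full) = begin
        incidences xs ys * v * Q  ≤⟨ *-monoˡ-≤ Q (*-monoˡ-≤ v trivial) ⟩
        K * (2 ^ suc L * length ys + length xs) * v * Q  ≡⟨ rotate K _ v Q ⟩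
        K * (Q * (v * (2 ^ suc L * length ys + length xs))) ≤⟨ *-monoʳ-≤ K (m≤n+m _ _) ⟩
        K * (P₀ ^ suc L * (length xs * w) + Q * (v * (2 ^ suc L * length ys + length xs))) ∎
        where
        Q = suc P₀ ^ suc L
        rotate : ∀ k a v q → k * a * v * q ≡ k * (q * (v * a))
        rotate = solve-∀
        trivial : incidences xs ys ≤ K * (2 ^ suc L * length ys + length xs)
        trivial with free (filter-⊆ (T? ∘ p) xs) (filter-⊆ (T? ∘ q) ys)
                      (All.map (λ px → All.map (full px) (all-filter (T? ∘ q) ys)) (all-filter (T? ∘ p) xs))
        ... | inj₁ few = begin
          incidences xs ys  ≤⟨ incidences≤ xs ys ⟩
          length ys * length xs  ≤⟨ *-monoʳ-≤ (length ys) (≤-trans lx (*-monoʳ-≤ c (<⇒≤ few))) ⟩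
          length ys * (c * d)  ≡⟨ *-comm (length ys) (c * d) ⟩
          c * d * length ys  ≤⟨ *-mono-≤ {c * d} {K} (≤-trans (m≤m+n (c * d) (c * s)) (m≤n+m (c * d + c * s) (suc (d ^ d * s + d))))
                                                      (≤-trans (m≤n*m (length ys) (2 ^ suc L) ⦃ m^n≢0 2 (suc L) ⦄) (m≤m+n (2 ^ suc L * length ys) (length xs))) ⟩
          K * (2 ^ suc L * length ys + length xs) ∎
        ... | inj₂ few = begin
          incidences xs ys  ≤⟨ incidences≤ xs ys ⟩
          length ys * length xs  ≤⟨ *-monoˡ-≤ (length xs) (≤-trans ly (*-monoʳ-≤ c (<⇒≤ few))) ⟩
          c * s * length xs  ≤⟨ *-mono-≤ {c * s} {K} (≤-trans (m≤n+m (c * s) (c * d)) (m≤n+m (c * d + c * s) (suc (d ^ d * s + d)))) (m≤n+m (length xs) (2 ^ suc L * length ys)) ⟩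
          K * (2 ^ suc L * length ys + length xs) ∎
      ... | rectangle p q lx ly (inj₂ empty) = ≤-trans
        (≤-reflexive (cong (λ i → i * v * suc P₀ ^ suc L) (incidences-peel empty xs ys)))
        (≤-trans (combine {incidences (filterᵇ (not ∘ p) xs) ys} {incidences (filterᵇ p xs) (filterᵇ (not ∘ q) ys)} {v = v} {w} {P₀ ^ L} {suc P₀ ^ L} {2 ^ L}
          (peel L v w (free-⊆ (filter-⊆ _ xs) ⊆-refl free) le)
          (peel L (v * suc h) (w * h) ⦃ m*n≢0 v (suc h) ⦄ (free-⊆ (filter-⊆ _ xs) (filter-⊆ _ ys) free)
            (decay {length ys} {count (not ∘ q) ys} {v} {w} (complement-shrinks c₀ q ys ly) le))
          (≤-trans (≤-reflexive (count-complement p xs)) lx)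
          (≤-trans (m≤n+m _ (count q ys)) (≤-reflexive (count-complement q ys))))
        (≤-reflexive (cong (λ a → K * (P₀ ^ suc L * (a * w) + suc P₀ ^ suc L * (v * (2 ^ suc L * length ys + a)))) (count-complement p xs))))

-- The choice of L, in terms of powers of natural numbers

module Exponents where

  open import Data.Nat.Base
  open import Data.Nat.Properties
  open import Data.Nat.Tactic.RingSolver using (solve-∀)
  open import Relation.Binary.PropositionalEquality using (_≡_; refl; sym; trans; cong; cong₂)
  open Powers
  open ≤-Reasoning

  swap-^ : ∀ a k l → (a ^ k) ^ l ≡ (a ^ l) ^ k
  swap-^ a k l = trans (^-*-assoc a k l) (trans (cong (a ^_) (*-comm k l)) (sym (^-*-assoc a l k)))

  -- The search descends until the predecessor of z is too small. As z ≤ 2 (z - 1) for z ≥ 2, the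
  -- root is overshot by at most the factor 2.
  approximate-root : ∀ k b → ∃[ z ] b ≤ z ^ suc k × z ^ suc k ≤ 2 ^ suc k * b
  approximate-root k b = search b (m≤m^n b)
    where
    m≤m^n : ∀ b → b ≤ b ^ suc k
    m≤m^n zero    = z≤n
    m≤m^n (suc b) = m≤m*n (suc b) (suc b ^ k) ⦃ m^n≢0 (suc b) k ⦄
    search : ∀ z → b ≤ z ^ suc k → ∃[ z ] b ≤ z ^ suc k × z ^ suc k ≤ 2 ^ suc k * b
    search zero    le = zero , le , z≤n
    search (suc z) le with ≤-<-connex b (z ^ suc k)
    ... | inj₁ b≤z^ = search z b≤z^
    ... | inj₂ z^<b = suc z , le , upper z z^<b
      where
      upper : ∀ z → z ^ suc k < b → suc z ^ suc k ≤ 2 ^ suc k * b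
      upper zero    0<b  = begin
        1 ^ suc k  ≤⟨ ^-monoˡ-≤ (suc k) (s≤s (z≤n {1})) ⟩
        2 ^ suc k  ≤⟨ m≤m*n (2 ^ suc k) b ⦃ >-nonZero 0<b ⦄ ⟩
        2 ^ suc k * b   ∎
      upper z@(suc z′) z^<b = begin
        suc z ^ suc k  ≤⟨ ^-monoˡ-≤ (suc k) (≤-trans (s≤s (m≤n+m z z′)) (≤-reflexive (double z′))) ⟩
        (2 * z) ^ suc k  ≡⟨ ^-distribʳ-* 2 z (suc k) ⟩
        2 ^ suc k * z ^ suc k  ≤⟨ *-monoʳ-≤ (2 ^ suc k) (<⇒≤ z^<b) ⟩
        2 ^ suc k * b          ∎
        where
        double : ∀ n → suc (n + suc n) ≡ 2 * suc n
        double = solve-∀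

  -- For α < z no L satisfies the lower bound, hence the alternative L ≡ 0.
  logarithm : ∀ α z .{{_ : NonZero z}} → ∃[ L ] α < 4 ^ suc L * z × (L ≡ 0 ⊎ 4 ^ L * z ≤ α)
  logarithm α z = search α (<-≤-trans (n<4^ α) (m≤m*n (4 ^ suc α) z))
    where
    n<4^ : ∀ n → n < 4 ^ suc n
    n<4^ zero    = s≤s z≤n
    n<4^ (suc n) = begin-strict
      suc n  <⟨ s≤s (n<4^ n) ⟩
      suc (4 ^ suc n)  ≤⟨ +-mono-≤ (m^n>0 4 (suc n)) (m≤m+n (4 ^ suc n) (2 * 4 ^ suc n)) ⟩
      4 ^ suc n + 3 * 4 ^ suc n  ∎
    search : ∀ n → α < 4 ^ suc n * z → ∃[ L ] α < 4 ^ suc L * z × (L ≡ 0 ⊎ 4 ^ L * z ≤ α)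
    search zero    lt = 0 , lt , inj₁ refl
    search (suc n) lt with ≤-<-connex (4 ^ suc n * z) α
    ... | inj₁ le  = suc n , lt , inj₂ le
    ... | inj₂ lt′ = search n lt′

  -- One of the M factors α is traded for 4 ^ suc L * z. The resulting 4 ^ L is absorbed by the gap,
  -- since 4 * P₀ ^ M ≤ P ^ M, and one power of α has become one of z.
  main-term : ∀ {P₀ P n α z L} → let M = suc (suc n) in 4 * P₀ ^ M ≤ P ^ M → α < 4 ^ suc L * z →
    (P₀ ^ L * (α * z)) ^ M ≤ (P ^ L) ^ M * (4 * (α ^ suc n * z ^ suc M))
  main-term {P₀} {P} {n} {α} {z} {L} gap α< = begin
    (P₀ ^ L * (α * z)) ^ M  ≡⟨ ^-distribʳ-* (P₀ ^ L) (α * z) M ⟩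
    (P₀ ^ L) ^ M * (α * z) ^ M  ≡⟨ cong₂ _*_ (swap-^ P₀ L M) (^-distribʳ-* α z M) ⟩
    (P₀ ^ M) ^ L * (α ^ M * z ^ M)  ≤⟨ *-monoʳ-≤ ((P₀ ^ M) ^ L) (*-monoˡ-≤ (z ^ M) (*-monoˡ-≤ (α ^ suc n) (<⇒≤ α<))) ⟩
    (P₀ ^ M) ^ L * (4 * 4 ^ L * z * α ^ suc n * z ^ M) ≡⟨ rearrange ((P₀ ^ M) ^ L) (4 ^ L) z (α ^ suc n) (z ^ M) ⟩
    4 ^ L * (P₀ ^ M) ^ L * (4 * (α ^ suc n * (z * z ^ M))) ≡⟨ cong (_* (4 * (α ^ suc n * z ^ suc M))) (^-distribʳ-* 4 (P₀ ^ M) L) ⟨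
    (4 * P₀ ^ M) ^ L * (4 * (α ^ suc n * z ^ suc M))  ≤⟨ *-monoˡ-≤ _ (^-monoˡ-≤ L gap) ⟩
    (P ^ M) ^ L * (4 * (α ^ suc n * z ^ suc M))   ≡⟨ cong (_* (4 * (α ^ suc n * z ^ suc M))) (swap-^ P M L) ⟩
    (P ^ L) ^ M * (4 * (α ^ suc n * z ^ suc M))   ∎
    where
    M = suc (suc n)
    rearrange : ∀ p q z a y → p * (4 * q * z * a * y) ≡ q * p * (4 * (a * (z * y)))
    rearrange = solve-∀

  -- Two estimates combine: β ≤ z * z, because (d-1)/d ≥ 1/2, and (2 ^ L) ^ M ≤ (4 ^ L) ^ (M - 1),
  -- because M ≤ 2 (M - 1). For L = 0 the term is β itself and belongs to the linear part.
  linear-term : ∀ {e n α β z L} → let M = suc (suc n) in .{{_ : NonZero z}} → β ^ suc e ≤ z ^ suc (suc e) →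
    L ≡ 0 ⊎ 4 ^ L * z ≤ α → 2 ^ L * β ≡ β ⊎ (2 ^ L * β) ^ M ≤ α ^ suc n * z ^ suc M
  linear-term {β = β} β≤ (inj₁ refl) = inj₁ (+-identityʳ β)
  linear-term {e} {n} {α} {β} {z} {L} β≤ (inj₂ 4^Lz≤α) = inj₂ (begin
    (2 ^ L * β) ^ M  ≡⟨ ^-distribʳ-* (2 ^ L) β M ⟩
    (2 ^ L) ^ M * β ^ M  ≤⟨ *-mono-≤ (power (2 ^ L) ⦃ m^n≢0 2 L ⦄ {n}) (^-monoˡ-≤ M β≤z²) ⟩
    (2 ^ L * 2 ^ L) ^ suc n * (z * z) ^ M  ≡⟨ cong₂ (λ a b → a ^ suc n * b) (sym (^-distribʳ-* 2 2 L)) (^-distribʳ-* z z M) ⟩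
    (4 ^ L) ^ suc n * (z ^ M * z ^ M)  ≡⟨ cong ((4 ^ L) ^ suc n *_) (reassociate z (z ^ n)) ⟩
    (4 ^ L) ^ suc n * (z ^ suc n * z ^ suc M)     ≡⟨ *-assoc ((4 ^ L) ^ suc n) (z ^ suc n) (z ^ suc M) ⟨
    (4 ^ L) ^ suc n * z ^ suc n * z ^ suc M  ≡⟨ cong (_* z ^ suc M) (^-distribʳ-* (4 ^ L) z (suc n)) ⟨
    (4 ^ L * z) ^ suc n * z ^ suc M  ≤⟨ *-monoˡ-≤ (z ^ suc M) (^-monoˡ-≤ (suc n) 4^Lz≤α) ⟩
    α ^ suc n * z ^ suc M                         ∎)
    where
    M = suc (suc n)
    double : ∀ t k → t ^ suc k * t ^ suc k ≡ (t * t) ^ suc k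
    double t k = sym (^-distribʳ-* t t (suc k))
    power : ∀ t .{{_ : NonZero t}} {k} → t ^ suc (suc k) ≤ (t * t) ^ suc k
    power t {k} = ≤-trans (*-monoˡ-≤ (t ^ suc k) (m≤m*n t (t ^ k) ⦃ m^n≢0 t k ⦄)) (≤-reflexive (double t k))
    reassociate : ∀ z y → z * (z * y) * (z * (z * y)) ≡ z * y * (z * (z * (z * y)))
    reassociate = solve-∀
    β≤z² : β ≤ z * z
    β≤z² = ^-cancel-≤ (suc e) (≤-trans β≤ (power z {e}))

  module _ {α β z e n a m b k : ℕ}
           (z≤ : z ^ suc (suc e) ≤ 2 ^ suc (suc e) * β ^ suc e)
           (x-bound : α ^ suc n * m ^ suc (suc n) ≤ a ^ suc (suc n))
           (y-bound : β ^ (suc e * suc (suc (suc n))) * k ^ (suc (suc e) * suc (suc n)) ≤ b ^ (suc (suc e) * suc (suc n))) where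
    private
      M d : ℕ
      M = suc (suc n)
      d = suc (suc e)

    -- Up to a factor 2, z is β^((d-1)/d), while b / k bounds the power of β with exponent
    -- (d-1)(M+1) / (d M). Raising to the power d makes both exponents integral.
    root-bound : z ^ suc M * k ^ M ≤ 2 ^ suc M * b ^ M
    root-bound = ^-cancel-≤ d (begin
      (z ^ suc M * k ^ M) ^ d  ≡⟨ ^-distribʳ-* (z ^ suc M) (k ^ M) d ⟩
      (z ^ suc M) ^ d * (k ^ M) ^ d  ≡⟨ cong₂ _*_ (swap-^ z (suc M) d) (trans (swap-^ k M d) (^-*-assoc k d M)) ⟩
      (z ^ d) ^ suc M * k ^ (d * M)  ≤⟨ *-monoˡ-≤ _ (^-monoˡ-≤ (suc M) z≤) ⟩
      (2 ^ d * β ^ suc e) ^ suc M * k ^ (d * M)  ≡⟨ cong (_* k ^ (d * M)) (trans (^-distribʳ-* (2 ^ d) (β ^ suc e) (suc M))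
                                                              (cong₂ _*_ (swap-^ 2 d (suc M)) (^-*-assoc β (suc e) (suc M)))) ⟩
      (2 ^ suc M) ^ d * β ^ (suc e * suc M) * k ^ (d * M) ≡⟨ *-assoc ((2 ^ suc M) ^ d) _ _ ⟩
      (2 ^ suc M) ^ d * (β ^ (suc e * suc M) * k ^ (d * M)) ≤⟨ *-monoʳ-≤ ((2 ^ suc M) ^ d) y-bound ⟩
      (2 ^ suc M) ^ d * b ^ (d * M)  ≡⟨ cong ((2 ^ suc M) ^ d *_) (trans (swap-^ b M d) (^-*-assoc b d M)) ⟨
      (2 ^ suc M) ^ d * (b ^ M) ^ d  ≡⟨ ^-distribʳ-* (2 ^ suc M) (b ^ M) d ⟨
      (2 ^ suc M * b ^ M) ^ d                           ∎)

    -- The constant 16 comes from 4 * 2 ^ suc M ≤ 16 ^ M: the rounding of L costs 4, that of the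
    -- root 2 ^ suc M.
    product-bound : ∀ {Q V} → Q ^ M ≤ V ^ M * (4 * (α ^ suc n * z ^ suc M)) → Q * (m * k) ≤ V * (16 * (a * b))
    product-bound {Q} {V} le = ^-cancel-≤ M (begin
      (Q * (m * k)) ^ M  ≡⟨ trans (^-distribʳ-* Q (m * k) M) (cong (Q ^ M *_) (^-distribʳ-* m k M)) ⟩
      Q ^ M * (m ^ M * k ^ M)  ≤⟨ *-monoˡ-≤ _ le ⟩
      V ^ M * (4 * (α ^ suc n * z ^ suc M)) * (m ^ M * k ^ M) ≡⟨ group (V ^ M) (α ^ suc n) (z ^ suc M) (m ^ M) (k ^ M) ⟩
      V ^ M * (4 * ((α ^ suc n * m ^ M) * (z ^ suc M * k ^ M))) ≤⟨ *-monoʳ-≤ (V ^ M) (*-monoʳ-≤ 4 (*-mono-≤ x-bound root-bound)) ⟩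
      V ^ M * (4 * (a ^ M * (2 ^ suc M * b ^ M)))  ≡⟨ regroup (V ^ M) (a ^ M) (2 ^ M) (b ^ M) ⟩
      8 * 2 ^ M * (V ^ M * (a ^ M * b ^ M))  ≤⟨ *-monoˡ-≤ _ (*-monoˡ-≤ (2 ^ M) (^-monoʳ-≤ 8 (s≤s (z≤n {suc n})))) ⟩
      8 ^ M * 2 ^ M * (V ^ M * (a ^ M * b ^ M))  ≡⟨ cong (_* (V ^ M * (a ^ M * b ^ M))) (^-distribʳ-* 8 2 M) ⟨
      16 ^ M * (V ^ M * (a ^ M * b ^ M))  ≡⟨ order (16 ^ M) (V ^ M) (a ^ M * b ^ M) ⟩
      V ^ M * (16 ^ M * (a ^ M * b ^ M))  ≡⟨ cong (λ y → V ^ M * (16 ^ M * y)) (^-distribʳ-* a b M) ⟨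
      V ^ M * (16 ^ M * (a * b) ^ M)  ≡⟨ cong (V ^ M *_) (^-distribʳ-* 16 (a * b) M) ⟨
      V ^ M * (16 * (a * b)) ^ M  ≡⟨ ^-distribʳ-* V (16 * (a * b)) M ⟨
      (V * (16 * (a * b))) ^ M                            ∎)
      where
      group : ∀ v α z m k → v * (4 * (α * z)) * (m * k) ≡ v * (4 * ((α * m) * (z * k)))
      group = solve-∀
      regroup : ∀ v a t b → v * (4 * (a * (2 * t * b))) ≡ 8 * t * (v * (a * b))
      regroup = solve-∀
      order : ∀ p q r → p * (q * r) ≡ q * (p * r)
      order = solve-∀

    -- Both Q and, unless it equals β, the term B contribute 16 * (a * b), whence the factor 32.
    collect-terms : ∀ {K I Q V B} .{{_ : NonZero V}} → I * V ≤ K * (Q + V * (B + α)) →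
      Q ^ M ≤ V ^ M * (4 * (α ^ suc n * z ^ suc M)) → B ≡ β ⊎ B ^ M ≤ α ^ suc n * z ^ suc M →
      I * (m * k) ≤ 32 * K * (a * b + (α + β) * (m * k))
    collect-terms {K} {I} {Q} {V} {B} le Q≤ B≤ = *-cancelˡ-≤ V (begin
      V * (I * (m * k))  ≡⟨ first V I (m * k) ⟩
      I * V * (m * k)  ≤⟨ *-monoˡ-≤ (m * k) le ⟩
      K * (Q + V * (B + α)) * (m * k)  ≡⟨ second K Q V B α (m * k) ⟩
      K * (Q * (m * k) + V * (B * (m * k) + α * (m * k)))  ≤⟨ *-monoʳ-≤ K (+-mono-≤ (product-bound {Q} {V} Q≤) (*-monoʳ-≤ V (+-monoˡ-≤ (α * (m * k)) (linear B≤)))) ⟩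
      K * (V * (16 * (a * b)) + V * ((16 * (a * b) + β * (m * k)) + α * (m * k))) ≤⟨ m≤m+n _ _ ⟩
      K * (V * (16 * (a * b)) + V * ((16 * (a * b) + β * (m * k)) + α * (m * k))) + V * (31 * K * ((α + β) * (m * k)))
                                                                 ≡⟨ third K V (a * b) α β (m * k) ⟩
      V * (32 * K * (a * b + (α + β) * (m * k)))                 ∎)
      where
      first : ∀ v i p → v * (i * p) ≡ i * v * p
      first = solve-∀
      second : ∀ K Q V B α p → K * (Q + V * (B + α)) * p ≡ K * (Q * p + V * (B * p + α * p))
      second = solve-∀
      third : ∀ K V x α β p → K * (V * (16 * x) + V * ((16 * x + β * p) + α * p)) + V * (31 * K * ((α + β) * p)) ≡
              V * (32 * K * (x + (α + β) * p))
      third = solve-∀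
      linear : ∀ {B} → B ≡ β ⊎ B ^ M ≤ α ^ suc n * z ^ suc M → B * (m * k) ≤ 16 * (a * b) + β * (m * k)
      linear (inj₁ refl)   = m≤n+m _ _
      linear {B} (inj₂ B≤) = ≤-trans (product-bound {B} {1} (≤-trans B≤ (≤-trans (m≤n*m _ 4)
          (≤-reflexive (trans (sym (*-identityˡ _)) (cong (_* (4 * (α ^ suc n * z ^ suc M))) (sym (^-zeroˡ M))))))))
        (≤-trans (≤-reflexive (*-identityˡ _)) (m≤m+n _ _))

-- The choice of ε

module PowerSaving (em : ∀ {a : Level} → ExcludedMiddle a) where

  open import Data.List.Base using (List; []; _∷_; length)
  open import Data.Nat.Base hiding (_⊔_)
  open import Data.Nat.Properties
  open import Relation.Binary.PropositionalEquality using (_≡_; _≢_; refl; trans; cong)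
  open Regularity
  open Powers
  open Incidences em
  open Exponents
  open ≤-Reasoning

  module _ {i j r} {X : Set i} {Y : Set j} {E : REL X Y r} {c} (regular : Regular c E) (e s : ℕ) where

    private
      regular′ : Regular (suc c) E
      regular′ xs ys = rectangle-weaken (n≤1+n c) (regular xs ys)
      P₀ = suc (4 * c + 2 * c * c)
      K = peel-constant E regular′ e s
      -- The 4 is the base of the logarithm that defines L. The exponent found here is raised by 2,
      -- which preserves the inequality and ensures M ≥ 2.
      gap = power-gap P₀ 4
      gap₂ : 4 * P₀ ^ suc (suc (proj₁ gap)) ≤ suc P₀ ^ suc (suc (proj₁ gap))
      gap₂ = begin
        4 * (P₀ * (P₀ * P₀ ^ proj₁ gap))  ≡⟨ swap 4 P₀ (P₀ ^ proj₁ gap) ⟩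
        P₀ * (P₀ * (4 * P₀ ^ proj₁ gap))  ≤⟨ *-mono-≤ (n≤1+n P₀) (*-mono-≤ (n≤1+n P₀) (<⇒≤ (proj₂ gap))) ⟩
        suc P₀ ^ suc (suc (proj₁ gap))                  ∎
        where
        open import Data.Nat.Tactic.RingSolver using (solve-∀)
        swap : ∀ k p q → k * (p * (p * q)) ≡ p * (p * (k * q))
        swap = solve-∀

    -- With ε = 1 / M, the fractions a / m and b / k bound |xs|^(1-ε) and |ys|^((d-1)/d (1+ε)), d = e + 2.
    power-saving : ∃[ n ] ∃[ C ] (∀ {xs ys} → Free E (suc (suc e)) s xs ys → ∀ {a m b k} →
      length xs ^ suc n * m ^ suc (suc n) ≤ a ^ suc (suc n) →
      length ys ^ (suc e * suc (suc (suc n))) * k ^ (suc (suc e) * suc (suc n)) ≤ b ^ (suc (suc e) * suc (suc n)) →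
      incidences E xs ys * (m * k) ≤ C * (a * b + (length xs + length ys) * (m * k)))
    power-saving = proj₁ gap , 32 * K , bound
      where
      n = proj₁ gap
      bound : ∀ {xs ys} → Free E (suc (suc e)) s xs ys → ∀ {a m b k} →
        length xs ^ suc n * m ^ suc (suc n) ≤ a ^ suc (suc n) →
        length ys ^ (suc e * suc (suc (suc n))) * k ^ (suc (suc e) * suc (suc n)) ≤ b ^ (suc (suc e) * suc (suc n)) →
        incidences E xs ys * (m * k) ≤ 32 * K * (a * b + (length xs + length ys) * (m * k))
      -- An empty ys is set aside because z must be nonzero for the logarithm.
      bound {xs} {[]}         free _ _ = z≤n
      bound {xs} {ys@(_ ∷ _)} free {a} {m} {b} {k} x-bound y-bound
        with approximate-root (suc e) (length ys ^ suc e)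
      ... | z , ≤z , z≤ with logarithm (length xs) z ⦃ ≢-nonZero z≢0 ⦄
        where
        z≢0 : z ≢ 0
        z≢0 refl = <⇒≱ (m^n>0 (length ys) (suc e)) ≤z
      ... | L , upper , lower = collect-terms {length xs} {length ys} {z} {e} {n} {a} {m} {b} {k} z≤ x-bound y-bound
        {K} {incidences E xs ys} {P₀ ^ L * (length xs * z)} {suc P₀ ^ L} {2 ^ L * length ys} ⦃ m^n≢0 (suc P₀) L ⦄
        (begin
          incidences E xs ys * suc P₀ ^ L  ≡⟨ cong (_* suc P₀ ^ L) (*-identityʳ (incidences E xs ys)) ⟨
          incidences E xs ys * 1 * suc P₀ ^ L   ≤⟨ peel E regular′ e s L 1 z free
                                                      (≤-trans (≤-reflexive (trans (cong (length ys ^ suc e *_) (^-zeroˡ (suc (suc e)))) (*-identityʳ _))) ≤z) ⟩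
          K * (P₀ ^ L * (length xs * z) + suc P₀ ^ L * (1 * (2 ^ L * length ys + length xs)))
                                                ≡⟨ cong (λ y → K * (P₀ ^ L * (length xs * z) + suc P₀ ^ L * y)) (*-identityˡ _) ⟩
          K * (P₀ ^ L * (length xs * z) + suc P₀ ^ L * (2 ^ L * length ys + length xs)) ∎)
        (main-term {P₀} {suc P₀} {n} {length xs} {z} {L} gap₂ upper)
        (linear-term {e} {n} {length xs} {length ys} {z} {L} ⦃ ≢-nonZero z≢0 ⦄ ≤z lower)
        where
        z≢0 : z ≢ 0
        z≢0 refl = <⇒≱ (m^n>0 (length ys) (suc e)) ≤z

-- Rational upper bounds of powers as inequalities between natural numbers

module RationalBounds where

  import Algebra.Definitions.RawSemiring as RawSemiringDefinitions
  open import Data.Integer.Base as ℤ using (ℤ; +_; -[1+_]; 1ℤ)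
  import Data.Integer.Properties as ℤ
  import Data.Integer.Tactic.RingSolver as ℤ-Solver
  open import Data.Nat.Base as ℕ using (ℕ; zero; suc; NonZero)
  import Data.Nat.Properties as ℕ
  open import Data.Rational.Base hiding (NonZero)
  open import Data.Rational.Properties
  open import Data.Rational.Solver using (module +-*-Solver)
  open import Data.Rational.Unnormalised.Base as ℚᵘ using (ℚᵘ; mkℚᵘ; *≡*; *≤*)
  import Data.Rational.Unnormalised.Properties as ℚᵘ
  open import Relation.Binary.PropositionalEquality using (_≡_; refl; sym; trans; cong; cong₂)
  open import Defs using (_/1; _^_≤_)
  open Powers
  open RawSemiringDefinitions +-*-rawSemiring using () renaming (_^_ to _^ℚ_)
  open +-*-Solver using (solve; _:=_; _:+_; _:*_)

  toℚᵘ-/ : ∀ z d-1 → toℚᵘ (z / suc d-1) ℚᵘ.≃ mkℚᵘ z d-1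
  toℚᵘ-/ z d-1 = toℚᵘ-fromℚᵘ (mkℚᵘ z d-1)

  /1-homo-+ : ∀ m n → (m ℕ.+ n) /1 ≡ m /1 + n /1
  /1-homo-+ m n = toℚᵘ-injective (begin
    toℚᵘ ((m ℕ.+ n) /1)  ≈⟨ toℚᵘ-/ (+ (m ℕ.+ n)) 0 ⟩
    mkℚᵘ (+ (m ℕ.+ n)) 0  ≈⟨ *≡* (trans (cong (λ z → z ℤ.* 1ℤ) (ℤ.pos-+ m n)) (identity (+ m) (+ n))) ⟩
    mkℚᵘ (+ m) 0 ℚᵘ.+ mkℚᵘ (+ n) 0   ≈⟨ ℚᵘ.+-cong (toℚᵘ-/ (+ m) 0) (toℚᵘ-/ (+ n) 0) ⟨
    toℚᵘ (m /1) ℚᵘ.+ toℚᵘ (n /1)     ≈⟨ toℚᵘ-homo-+ (m /1) (n /1) ⟨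
    toℚᵘ (m /1 + n /1)               ∎)
    where
    open ℚᵘ.≃-Reasoning
    identity : ∀ a b → (a ℤ.+ b) ℤ.* 1ℤ ≡ (a ℤ.* 1ℤ ℤ.+ b ℤ.* 1ℤ) ℤ.* 1ℤ
    identity = ℤ-Solver.solve-∀

  /1-homo-* : ∀ m n → (m ℕ.* n) /1 ≡ m /1 * n /1
  /1-homo-* m n = toℚᵘ-injective (begin
    toℚᵘ ((m ℕ.* n) /1)  ≈⟨ toℚᵘ-/ (+ (m ℕ.* n)) 0 ⟩
    mkℚᵘ (+ (m ℕ.* n)) 0  ≈⟨ *≡* (cong (λ z → z ℤ.* 1ℤ) (ℤ.pos-* m n)) ⟩
    mkℚᵘ (+ m) 0 ℚᵘ.* mkℚᵘ (+ n) 0   ≈⟨ ℚᵘ.*-cong (toℚᵘ-/ (+ m) 0) (toℚᵘ-/ (+ n) 0) ⟨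
    toℚᵘ (m /1) ℚᵘ.* toℚᵘ (n /1)     ≈⟨ toℚᵘ-homo-* (m /1) (n /1) ⟨
    toℚᵘ (m /1 * n /1)               ∎)
    where open ℚᵘ.≃-Reasoning

  /1-homo-^ : ∀ m k → (m ℕ.^ k) /1 ≡ m /1 ^ℚ k
  /1-homo-^ m zero    = refl
  /1-homo-^ m (suc k) = trans (/1-homo-* m (m ℕ.^ k)) (cong (m /1 *_) (/1-homo-^ m k))

  /1-mono-≤ : ∀ {m n} → m ℕ.≤ n → m /1 ≤ n /1
  /1-mono-≤ {m} {n} m≤n = toℚᵘ-cancel-≤ (ℚᵘ.≤-respˡ-≃ (ℚᵘ.≃-sym (toℚᵘ-/ (+ m) 0)) (ℚᵘ.≤-respʳ-≃ (ℚᵘ.≃-sym (toℚᵘ-/ (+ n) 0))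
    (*≤* (ℤ.*-monoʳ-≤-nonNeg 1ℤ (ℤ.+≤+ m≤n)))))

  /1-cancel-≤ : ∀ {m n} → m /1 ≤ n /1 → m ℕ.≤ n
  /1-cancel-≤ {m} {n} le with ℚᵘ.≤-respˡ-≃ (toℚᵘ-/ (+ m) 0) (ℚᵘ.≤-respʳ-≃ (toℚᵘ-/ (+ n) 0) (toℚᵘ-mono-≤ le))
  ... | *≤* m*1≤n*1 = ℤ.drop‿+≤+ (ℤ.*-cancelʳ-≤-pos (+ m) (+ n) 1ℤ m*1≤n*1)

  /1-nonNeg : ∀ n → NonNegative (n /1)
  /1-nonNeg n = nonNegative (/1-mono-≤ {0} {n} ℕ.z≤n)

  /1-positive : ∀ n .{{_ : NonZero n}} → Positive (n /1)
  /1-positive n@(suc _) = normalize-pos n 1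

  ^ℚ-distribʳ-* : ∀ p q k → (p * q) ^ℚ k ≡ p ^ℚ k * q ^ℚ k
  ^ℚ-distribʳ-* p q zero    = refl
  ^ℚ-distribʳ-* p q (suc k) = trans (cong (p * q *_) (^ℚ-distribʳ-* p q k))
    (solve 4 (λ p q a b → p :* q :* (a :* b) := p :* a :* (q :* b)) refl p q (p ^ℚ k) (q ^ℚ k))

  record Fraction (x : ℚ) : Set where
    field
      numerator denominator : ℕ
      .{{denominator≢0}}    : NonZero denominator
      clear                 : x * denominator /1 ≡ numerator /1

  fraction : ∀ {x} → 0ℚ ≤ x → Fraction x
  fraction {mkℚ -[1+ n ] m-1 _} 0≤x with nonNegative 0≤x
  ... | ()
  fraction {x@(mkℚ (+ n) m-1 _)} 0≤x = record
    { numerator   = n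
    ; denominator = suc m-1
    ; clear       = toℚᵘ-injective (begin
        toℚᵘ (x * suc m-1 /1)  ≈⟨ toℚᵘ-homo-* x (suc m-1 /1) ⟩
        toℚᵘ x ℚᵘ.* toℚᵘ (suc m-1 /1)  ≈⟨ ℚᵘ.*-congˡ {mkℚᵘ (+ n) m-1} (toℚᵘ-/ (+ suc m-1) 0) ⟩
        mkℚᵘ (+ n) m-1 ℚᵘ.* mkℚᵘ (+ suc m-1) 0 ≈⟨ *≡* (identity (+ n) (+ suc m-1)) ⟩
        mkℚᵘ (+ n) 0  ≈⟨ toℚᵘ-/ (+ n) 0 ⟨
        toℚᵘ (n /1)                         ∎)
    }
    where
    open ℚᵘ.≃-Reasoning
    identity : ∀ n m → (n ℤ.* m) ℤ.* 1ℤ ≡ n ℤ.* (m ℤ.* 1ℤ)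
    identity = ℤ-Solver.solve-∀

  upper-bound-nonNeg : ∀ {a} q {x} → a ^ q ≤ x → 0ℚ ≤ x
  upper-bound-nonNeg (mkℚ (+ _)    _ _) = proj₁
  upper-bound-nonNeg (mkℚ -[1+ _ ] _ _) = proj₁

  power-fraction : ∀ {N x} k (x↦ : Fraction x) → N /1 ≤ x ^ℚ k →
                   N ℕ.* Fraction.denominator x↦ ℕ.^ k ℕ.≤ Fraction.numerator x↦ ℕ.^ k
  power-fraction {N} {x} k x↦ le = /1-cancel-≤ (begin
    (N ℕ.* m ℕ.^ k) /1  ≡⟨ /1-homo-* N (m ℕ.^ k) ⟩
    N /1 * (m ℕ.^ k) /1  ≤⟨ *-monoʳ-≤-nonNeg ((m ℕ.^ k) /1) ⦃ /1-nonNeg (m ℕ.^ k) ⦄ le ⟩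
    x ^ℚ k * (m ℕ.^ k) /1     ≡⟨ cong (x ^ℚ k *_) (/1-homo-^ m k) ⟩
    x ^ℚ k * (m /1) ^ℚ k      ≡⟨ ^ℚ-distribʳ-* x (m /1) k ⟨
    (x * m /1) ^ℚ k  ≡⟨ cong (_^ℚ k) clear ⟩
    (n /1) ^ℚ k  ≡⟨ /1-homo-^ n k ⟨
    (n ℕ.^ k) /1              ∎)
    where
    open ≤-Reasoning
    open Fraction x↦ renaming (numerator to n; denominator to m)

  -- The upper bound is read off the reduced form u′ / v′ of q, which cannot be computed for
  -- exponents depending on variables. It is transferred to any form u / v by raising both sides to
  -- the power v′, where u′ v = u v′ applies, and cancelling v′.
  upper-bound-fraction : ∀ {a} q {x u v-1} → toℚᵘ q ℚᵘ.≃ mkℚᵘ (+ u) v-1 → a ^ q ≤ x → (x↦ : Fraction x) →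
    a ℕ.^ u ℕ.* Fraction.denominator x↦ ℕ.^ suc v-1 ℕ.≤ Fraction.numerator x↦ ℕ.^ suc v-1
  upper-bound-fraction (mkℚ -[1+ u′ ] v′-1 _) {u = u} (*≡* eq) _ _ =
    contradiction (trans eq (sym (ℤ.pos-* u (suc v′-1)))) λ ()
  upper-bound-fraction {a} (mkℚ (+ u′) v′-1 _) {x} {u} {v-1} (*≡* eq) (_ , le) x↦ = ^-cancel-≤ v′ (begin
    (a ℕ.^ u ℕ.* m ℕ.^ v) ℕ.^ v′  ≡⟨ ^-distribʳ-* (a ℕ.^ u) (m ℕ.^ v) v′ ⟩
    (a ℕ.^ u) ℕ.^ v′ ℕ.* (m ℕ.^ v) ℕ.^ v′     ≡⟨ cong₂ ℕ._*_ (trans (ℕ.^-*-assoc a u v′) (trans (cong (a ℕ.^_) (sym cross)) (sym (ℕ.^-*-assoc a u′ v))))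
                                                             (trans (ℕ.^-*-assoc m v v′) (trans (cong (m ℕ.^_) (ℕ.*-comm v v′)) (sym (ℕ.^-*-assoc m v′ v)))) ⟩
    (a ℕ.^ u′) ℕ.^ v ℕ.* (m ℕ.^ v′) ℕ.^ v     ≡⟨ ^-distribʳ-* (a ℕ.^ u′) (m ℕ.^ v′) v ⟨
    (a ℕ.^ u′ ℕ.* m ℕ.^ v′) ℕ.^ v  ≤⟨ ℕ.^-monoˡ-≤ v (power-fraction {a ℕ.^ u′} v′ x↦ le) ⟩
    (n ℕ.^ v′) ℕ.^ v  ≡⟨ trans (ℕ.^-*-assoc n v′ v) (trans (cong (n ℕ.^_) (ℕ.*-comm v′ v)) (sym (ℕ.^-*-assoc n v v′))) ⟩
    (n ℕ.^ v) ℕ.^ v′                          ∎)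
    where
    open ℕ.≤-Reasoning
    open Fraction x↦ renaming (numerator to n; denominator to m)
    v = suc v-1
    v′ = suc v′-1
    cross : u′ ℕ.* v ≡ u ℕ.* v′
    cross = ℤ.+-injective (trans (ℤ.pos-* u′ v) (trans eq (sym (ℤ.pos-* u v′))))

  clear-denominators : ∀ {x y} (x↦ : Fraction x) (y↦ : Fraction y) {C α β N} →
    let open Fraction x↦ renaming (numerator to a; denominator to m)
        open Fraction y↦ renaming (numerator to b; denominator to k) in
    N ℕ.* (m ℕ.* k) ℕ.≤ C ℕ.* (a ℕ.* b ℕ.+ (α ℕ.+ β) ℕ.* (m ℕ.* k)) → N /1 ≤ C /1 * (x * y + α /1 + β /1)
  clear-denominators {x} {y} x↦ y↦ {C} {α} {β} {N} le = *-cancelʳ-≤-pos ((m ℕ.* k) /1) ⦃ /1-positive (m ℕ.* k) ⦃ ℕ.m*n≢0 m k ⦄ ⦄ (begin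
    N /1 * (m ℕ.* k) /1  ≡⟨ /1-homo-* N (m ℕ.* k) ⟨
    (N ℕ.* (m ℕ.* k)) /1  ≤⟨ /1-mono-≤ le ⟩
    (C ℕ.* (a ℕ.* b ℕ.+ (α ℕ.+ β) ℕ.* (m ℕ.* k))) /1  ≡⟨ trans (/1-homo-* C _) (cong (C /1 *_) (trans (/1-homo-+ (a ℕ.* b) _) (cong₂ _+_ product linear))) ⟩
    C /1 * (x * m /1 * (y * k /1) + (α /1 + β /1) * (m /1 * k /1)) ≡⟨ solve 7 (λ C x m y k α β → C :* (x :* m :* (y :* k) :+ (α :+ β) :* (m :* k)) :=
                                                                        C :* (x :* y :+ α :+ β) :* (m :* k)) refl (C /1) x (m /1) y (k /1) (α /1) (β /1) ⟩
    C /1 * (x * y + α /1 + β /1) * (m /1 * k /1)  ≡⟨ cong (C /1 * (x * y + α /1 + β /1) *_) (/1-homo-* m k) ⟨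
    C /1 * (x * y + α /1 + β /1) * (m ℕ.* k) /1                    ∎)
    where
    open ≤-Reasoning
    open Fraction x↦ renaming (numerator to a; denominator to m; clear to clear-x; denominator≢0 to m≢0)
    open Fraction y↦ renaming (numerator to b; denominator to k; clear to clear-y; denominator≢0 to k≢0)
    product : (a ℕ.* b) /1 ≡ x * m /1 * (y * k /1)
    product = trans (/1-homo-* a b) (sym (cong₂ _*_ clear-x clear-y))
    linear : ((α ℕ.+ β) ℕ.* (m ℕ.* k)) /1 ≡ (α /1 + β /1) * (m /1 * k /1)
    linear = trans (/1-homo-* (α ℕ.+ β) (m ℕ.* k)) (cong₂ _*_ (/1-homo-+ α β) (/1-homo-* m k))

  left-exponent : ∀ n → toℚᵘ (1ℚ - + 1 / suc (suc n)) ℚᵘ.≃ mkℚᵘ (+ suc n) (suc n)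
  left-exponent n = begin
    toℚᵘ (1ℚ - ε)  ≈⟨ toℚᵘ-homo-+ 1ℚ (- ε) ⟩
    ℚᵘ.1ℚᵘ ℚᵘ.+ toℚᵘ (- ε)  ≈⟨ ℚᵘ.+-congʳ ℚᵘ.1ℚᵘ (ℚᵘ.≃-trans (toℚᵘ-homo‿- ε) (ℚᵘ.-‿cong (toℚᵘ-/ (+ 1) (suc n)))) ⟩
    ℚᵘ.1ℚᵘ ℚᵘ.+ ℚᵘ.- mkℚᵘ (+ 1) (suc n)  ≈⟨ *≡* (identity (+ suc n)) ⟩
    mkℚᵘ (+ suc n) (suc n)                     ∎
    where
    open ℚᵘ.≃-Reasoning
    ε = + 1 / suc (suc n)
    identity : ∀ m → (1ℤ ℤ.* (1ℤ ℤ.+ m) ℤ.+ (ℤ.- 1ℤ) ℤ.* 1ℤ) ℤ.* (1ℤ ℤ.+ m) ≡ m ℤ.* (1ℤ ℤ.* (1ℤ ℤ.+ m))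
    identity = ℤ-Solver.solve-∀

  right-exponent : ∀ e n → toℚᵘ (((+ suc (suc e) ℤ.- 1ℤ) / suc (suc e)) * (1ℚ + + 1 / suc (suc n))) ℚᵘ.≃
                       mkℚᵘ (+ (suc e ℕ.* suc (suc (suc n)))) (ℕ.pred (suc (suc e) ℕ.* suc (suc n)))
  right-exponent e n = begin
    toℚᵘ (κ * (1ℚ + ε))  ≈⟨ toℚᵘ-homo-* κ (1ℚ + ε) ⟩
    toℚᵘ κ ℚᵘ.* toℚᵘ (1ℚ + ε)  ≈⟨ ℚᵘ.*-cong (toℚᵘ-/ (+ suc e) (suc e))
                                                                          (ℚᵘ.≃-trans (toℚᵘ-homo-+ 1ℚ ε) (ℚᵘ.+-congʳ ℚᵘ.1ℚᵘ (toℚᵘ-/ (+ 1) (suc n)))) ⟩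
    mkℚᵘ (+ suc e) (suc e) ℚᵘ.* (ℚᵘ.1ℚᵘ ℚᵘ.+ mkℚᵘ (+ 1) (suc n))     ≈⟨ *≡* (trans (identity (+ suc e) (+ suc (suc n)) (+ (d ℕ.* suc (suc n))))
                                                                          (cong₂ ℤ._*_ (sym (ℤ.pos-* (suc e) (suc (suc (suc n)))))
                                                                            (cong (λ k → + (d ℕ.* k)) (sym (ℕ.*-identityˡ (suc (suc n))))))) ⟩
    mkℚᵘ (+ (suc e ℕ.* suc (suc (suc n)))) (ℕ.pred (d ℕ.* suc (suc n))) ∎
    where
    open ℚᵘ.≃-Reasoning
    d = suc (suc e)
    κ = (+ d ℤ.- 1ℤ) / d
    ε = + 1 / suc (suc n)
    identity : ∀ e M D → (e ℤ.* (1ℤ ℤ.* M ℤ.+ 1ℤ ℤ.* 1ℤ)) ℤ.* D ≡ e ℤ.* (1ℤ ℤ.+ M) ℤ.* D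
    identity = ℤ-Solver.solve-∀

-- From regularity to the incidence bound

open import Defs
open import Data.Integer.Base as ℤ using (+_; 1ℤ)
open import Data.Nat.Base as ℕ using (ℕ; NonZero)
open import Data.Rational.Base using (ℚ; _/_; _+_; _-_; _*_; _≤_; _<_; 0ℚ; 1ℚ)

module IncidenceBound (em : ∀ {a} → ExcludedMiddle a) where
  open import Level using (Lift; lift)
  open import Data.Bool.Base using (true; false)
  open import Data.List.Base using (List; []; _∷_; length; filter; map; cartesianProduct)
  open import Data.List.Properties using (filter-++; length-++)
  open import Data.List.Membership.Propositional using () renaming (_∈_ to _∈ˡ_)
  open import Data.List.Relation.Binary.Sublist.Propositional using (_⊆_; []; _∷_; _∷ʳ_)
  open import Data.List.Relation.Binary.Sublist.Propositional.Properties using (All-resp-⊆)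
  open import Data.List.Relation.Unary.All as All using (All)
  open import Data.List.Relation.Unary.AllPairs using (AllPairs; []; _∷_)
  open import Data.Nat.Base using (suc)
  import Data.Nat.Properties as ℕ
  open import Data.Rational.Properties using (positive⁻¹; normalize-pos)
  import Data.Sum.Base as Sum
  open import Relation.Binary.Bundles using (Setoid)
  open import Relation.Binary.Core using (Rel)
  open import Relation.Binary.PropositionalEquality using (_≡_; refl; sym; trans; cong; cong₂)
  open Regularity
  open Regularity.Classical em
  open Incidences em
  open PowerSaving em
  open RationalBounds

  allPairs-⊆ : ∀ {a r} {A : Set a} {R : Rel A r} {xs ys} → xs ⊆ ys → AllPairs R ys → AllPairs R xs
  allPairs-⊆ []          []         = []
  allPairs-⊆ (_ ∷ʳ xs⊆)  (_  ∷ rys) = allPairs-⊆ xs⊆ rys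
  allPairs-⊆ (refl ∷ xs⊆) (ry ∷ rys) = All-resp-⊆ xs⊆ ry ∷ allPairs-⊆ xs⊆ rys

  module _ {i j r} {X : Set i} {Y : Set j} (E : REL X Y r) where

    -- The product list runs through the rows x, while `incidences` sums over the columns y.
    count-product : ∀ xs ys → length (filter (λ (x , y) → em {_} {E x y}) (cartesianProduct xs ys)) ≡ incidences E xs ys
    count-product []       ys = sym (trans (total-const 0 ys) (ℕ.*-zeroʳ (length ys)))
    count-product (x ∷ xs) ys = trans
      (trans (cong length (filter-++ _ (map (x ,_) ys) _)) (length-++ (filter _ (map (x ,_) ys))))
      (trans (cong₂ ℕ._+_ (row ys) (count-product xs ys))
        (sym (trans (total-cong column ys) (total-+ (λ y → indicator (decide (E x y))) (degree E xs) ys))))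
      where
      row : ∀ ys → length (filter (λ (x , y) → em {_} {E x y}) (map (x ,_) ys)) ≡ total (λ y → indicator (decide (E x y))) ys
      row []       = refl
      row (y ∷ ys) with em {_} {E x y}
      ... | yes _ = cong suc (row ys)
      ... | no  _ = row ys
      column : ∀ y → degree E (x ∷ xs) y ≡ indicator (decide (E x y)) ℕ.+ degree E xs y
      column y with decide (E x y)
      ... | true  = refl
      ... | false = refl

  module _ {c ℓ c′ ℓ′ r} {X : Setoid c ℓ} {Y : Setoid c′ ℓ′} {E : REL (Setoid.Carrier X) (Setoid.Carrier Y) r} where

    -- Sublists become the subsets of their members, which they list without repetition; so the
    -- cardinality bounds apply to their lengths.
    kFree⇒free : ∀ {d s} → KFree {X = X} {Y = Y} E d s → (A : FiniteSubset X) (B : FiniteSubset Y) →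
                 Free E d s (FiniteSubset.elements A) (FiniteSubset.elements B)
    kFree⇒free kFree A B {xs} {ys} xs⊆ ys⊆ full = Sum.map
      (λ fewer → fewer xs (allPairs-⊆ xs⊆ (FiniteSubset.unique A)) (All.tabulate lift))
      (λ fewer → fewer ys (allPairs-⊆ ys⊆ (FiniteSubset.unique B)) (All.tabulate lift))
      (kFree (λ x → Lift ℓ (x ∈ˡ xs)) (λ y → Lift ℓ′ (y ∈ˡ ys))
        (λ (lift x∈) (lift y∈) → All.lookup (All.lookup full x∈) y∈))

    incidence-bound : ∀ {k} → Regular k E → (d s : ℕ) .{{_ : NonZero d}} → KFree {X = X} {Y = Y} E d s →
      ∃[ ε ] ∃[ C ] 0ℚ < ε × 0ℚ < C ×
      ((A : FiniteSubset X) (B : FiniteSubset Y) →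
       ∀ {x y : ℚ} → ∣ A ∣ ^ (1ℚ - ε) ≤ x → ∣ B ∣ ^ (((+ d ℤ.- 1ℤ) / d) * (1ℚ + ε)) ≤ y →
       ∣ E ∩ A × B ∣[ em ] /1 ≤ C * (x * y + ∣ A ∣ /1 + ∣ B ∣ /1))
    -- For d = 1 the exponent of |B| is 0, and the Kővári-Sós-Turán bound with v = w = 1 is already
    -- linear in |A| + |B|. The value 1 / 2 for ε is an arbitrary choice.
    incidence-bound regular 1 s kFree =
      + 1 / 2 , C /1 , positive⁻¹ (+ 1 / 2) ⦃ normalize-pos 1 2 ⦄ , positive⁻¹ (C /1) ⦃ /1-positive C ⦄ , bound
      where
      C = suc (1 ℕ.^ 1 ℕ.* s ℕ.+ 1)
      bound : (A : FiniteSubset X) (B : FiniteSubset Y) → ∀ {x y : ℚ} → ∣ A ∣ ^ (1ℚ - + 1 / 2) ≤ x →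
              ∣ B ∣ ^ (((+ 1 ℤ.- 1ℤ) / 1) * (1ℚ + + 1 / 2)) ≤ y →
              ∣ E ∩ A × B ∣[ em ] /1 ≤ C /1 * (x * y + ∣ A ∣ /1 + ∣ B ∣ /1)
      bound A B {x} {y} x-bound y-bound = clear-denominators x↦ y↦ {C} {∣ A ∣} {∣ B ∣} {∣ E ∩ A × B ∣[ em ]} (begin
        ∣ E ∩ A × B ∣[ em ] ℕ.* q  ≡⟨ cong (ℕ._* q) (count-product E as bs) ⟩
        incidences E as bs ℕ.* q  ≤⟨ ℕ.*-monoˡ-≤ q linear ⟩
        C ℕ.* (∣ A ∣ ℕ.+ ∣ B ∣) ℕ.* q  ≡⟨ ℕ.*-assoc C (∣ A ∣ ℕ.+ ∣ B ∣) q ⟩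
        C ℕ.* ((∣ A ∣ ℕ.+ ∣ B ∣) ℕ.* q)  ≤⟨ ℕ.*-monoʳ-≤ C (ℕ.m≤n+m ((∣ A ∣ ℕ.+ ∣ B ∣) ℕ.* q) (Fraction.numerator x↦ ℕ.* Fraction.numerator y↦)) ⟩
        C ℕ.* (Fraction.numerator x↦ ℕ.* Fraction.numerator y↦ ℕ.+ (∣ A ∣ ℕ.+ ∣ B ∣) ℕ.* q) ∎)
        where
        open ℕ.≤-Reasoning
        as = FiniteSubset.elements A
        bs = FiniteSubset.elements B
        x↦ : Fraction x
        x↦ = fraction (upper-bound-nonNeg {∣ A ∣} (1ℚ - + 1 / 2) x-bound)
        y↦ : Fraction y
        y↦ = fraction (upper-bound-nonNeg {∣ B ∣} (((+ 1 ℤ.- 1ℤ) / 1) * (1ℚ + + 1 / 2)) y-bound)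
        q = Fraction.denominator x↦ ℕ.* Fraction.denominator y↦
        linear : incidences E as bs ℕ.≤ C ℕ.* (∣ A ∣ ℕ.+ ∣ B ∣)
        linear = begin
          incidences E as bs  ≡⟨ ℕ.*-identityʳ _ ⟨
          incidences E as bs ℕ.* 1  ≤⟨ kővári–sós–turán E 0 s 1 1 (kFree⇒free kFree A B) ℕ.≤-refl ⟩
          C ℕ.* (∣ A ∣ ℕ.* 1 ℕ.+ 1 ℕ.* ∣ B ∣)  ≡⟨ cong (C ℕ.*_) (cong₂ ℕ._+_ (ℕ.*-identityʳ ∣ A ∣) (ℕ.*-identityˡ ∣ B ∣)) ⟩
          C ℕ.* (∣ A ∣ ℕ.+ ∣ B ∣)                      ∎
    incidence-bound regular (suc (suc e)) s kFree with power-saving regular e s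
    ... | n , C , saving =
      -- The successor makes the constant positive.
      ε , suc C /1 , positive⁻¹ ε ⦃ normalize-pos 1 (suc (suc n)) ⦄ , positive⁻¹ (suc C /1) ⦃ /1-positive (suc C) ⦄ , bound
      where
      ε = + 1 / suc (suc n)
      bound : (A : FiniteSubset X) (B : FiniteSubset Y) → ∀ {x y : ℚ} → ∣ A ∣ ^ (1ℚ - ε) ≤ x →
              ∣ B ∣ ^ (((+ suc (suc e) ℤ.- 1ℤ) / suc (suc e)) * (1ℚ + ε)) ≤ y →
              ∣ E ∩ A × B ∣[ em ] /1 ≤ suc C /1 * (x * y + ∣ A ∣ /1 + ∣ B ∣ /1)
      bound A B {x} {y} x-bound y-bound = clear-denominators x↦ y↦ {suc C} {∣ A ∣} {∣ B ∣} {∣ E ∩ A × B ∣[ em ]} (begin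
        ∣ E ∩ A × B ∣[ em ] ℕ.* q  ≡⟨ cong (ℕ._* q) (count-product E as bs) ⟩
        incidences E as bs ℕ.* q  ≤⟨ saving {as} {bs} (kFree⇒free kFree A B) {Fraction.numerator x↦} {Fraction.denominator x↦}
                                                          {Fraction.numerator y↦} {Fraction.denominator y↦}
                                                          (upper-bound-fraction {∣ A ∣} (1ℚ - ε) (left-exponent n) x-bound x↦)
                                                          (upper-bound-fraction {∣ B ∣} θ (right-exponent e n) y-bound y↦) ⟩
        C ℕ.* total-bound  ≤⟨ ℕ.*-monoˡ-≤ total-bound (ℕ.n≤1+n C) ⟩
        suc C ℕ.* total-bound                        ∎)
        where
        open ℕ.≤-Reasoning
        as = FiniteSubset.elements A
        bs = FiniteSubset.elements B
        θ = ((+ suc (suc e) ℤ.- 1ℤ) / suc (suc e)) * (1ℚ + ε)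
        x↦ : Fraction x
        x↦ = fraction (upper-bound-nonNeg {∣ A ∣} (1ℚ - ε) x-bound)
        y↦ : Fraction y
        y↦ = fraction (upper-bound-nonNeg {∣ B ∣} θ y-bound)
        q = Fraction.denominator x↦ ℕ.* Fraction.denominator y↦
        total-bound = Fraction.numerator x↦ ℕ.* Fraction.numerator y↦ ℕ.+ (∣ A ∣ ℕ.+ ∣ B ∣) ℕ.* q

theorem1p1 : (em : ∀ {a} → ExcludedMiddle a) →
    ∀ {c ℓ ℓ# r : Level} (p : ℕ) (p-prime : Prime p)
    (K : HeytingField c ℓ ℓ#) (K/𝔽 : Extension (𝔽 p p-prime) K) → FinitelyGenerated K/𝔽 →
    (n m : ℕ) (S : Pred (Polynomial K (n ℕ.+ m)) r) →
    let E = ZeroSet K {n = n} {m = m} S in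
    (d s : ℕ) .{{_ : NonZero d}} → KFree {X = 𝔸 K n} {Y = 𝔸 K m} E d s →
    ∃[ ε ] ∃[ C ] 0ℚ < ε × 0ℚ < C ×
    ((A : FiniteSubset (𝔸 K n)) (B : FiniteSubset (𝔸 K m)) →
    ∀ {x y : ℚ} → ∣ A ∣ ^ (1ℚ - ε) ≤ x → ∣ B ∣ ^ (((+ d ℤ.- 1ℤ) / d) * (1ℚ + ε)) ≤ y →
    ∣ E ∩ A × B ∣[ em ] /1 ≤ C * (x * y + ∣ A ∣ /1 + ∣ B ∣ /1))
theorem1p1 em p p-prime K K/𝔽 generated n m S = incidence-bound (proj₂ (zeroSet-regular K/𝔽 generated S))
  where
  open ZeroSets em K using (zeroSet-regular)
  open IncidenceBound em
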